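{- Let $n\ge 3$ and let $\phi$ be a vincular 3-pattern with $k_\phi\le 3$, with underlying classical pattern $\phi_c\in S_3$. Then for every $\lambda\vdash n$, $$\overline{\mathrm{pat}_\phi}(\lambda)=\frac{1}{(n)_{k_\phi}}\sum_{j=3}^{6}\frac{1}{(j-k_\phi)!}\sum_{\ell=1}^{L_j}u_{j\ell}(\phi)\,H_{j\ell}(\lambda),$$ where $L_3=3$, $L_4=4$, $L_5=2$, $L_6=1$, and $H_{j\ell}$ and $u_{j\ell}(\phi)$ are as defined in the context. In particular $u_{61}(\phi)=\binom{6-k_\phi}{3}$.
   Context: $S_n$ acts on $[n]=\{1,\dots,n\}$; permutations are written in one-line notation $\pi_1\cdots\pi_n$. $C_\lambda$ is the conjugacy class of cycle type $\lambda$; $p,q,r$ are the numbers of parts of $\lambda$ of sizes $1,2,3$. For $s:S_n\to\mathbb R$, the mean statistic is $\overline{s}(\lambda)=\frac{1}{|C_\lambda|}\sum_{\pi\in C_\lambda}s(\pi)$. $(n)_k=n(n-1)\cdots(n-k+1)$. Vincular 3-patterns: $\phi$ is a permutation $\phi_1\phi_2\phi_3\in S_3$ enclosed on the left by "[" or "(" and on the right by "]" or ")", with optionally a dash between adjacent letters. An occurrence of $\phi$ in $\pi$ is a subsequence $\pi_{i_1}\pi_{i_2}\pi_{i_3}$, $i_1<i_2<i_3$, in the same relative order as $\phi_c=\phi_1\phi_2\phi_3$, with $i_2=i_1+1$ (resp. $i_3=i_2+1$) if there is no dash between $\phi_1,\phi_2$ (resp. $\phi_2,\phi_3$), $i_1=1$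 if $\phi$ begins with "[", and $i_3=n$ if it ends with "]". $\mathrm{pat}_\phi(\pi)$ is the number of occurrences. $CI_\phi$ denotes these conditions plus $i_1<i_2<i_3$; $k_\phi$ is the number of conditions imposed by square brackets and missing dashes. Functions: $H_{31}=p(p-1)(p-2)$, $H_{32}=2pq$, $H_{33}=3r$, $H_{41}=p(p-1)(n-p)$, $H_{42}=2q(n-p-2)$, $H_{43}=p(n-p-2q)$, $H_{44}=n-p-2q-3r$, $H_{51}=p^3+3p^2+2pq-n(2p^2+3p)+n^2p$, $H_{52}=p^2+4p+2pq+8q+3r-n(2p+2q+4)+n^2$, $H_{61}=-p^3-9p^2-20p-6pq-24q-6r+n(3p^2+18p+6q+20)-n^2(3p+9)+n^3$. Classes of formal triples (symbols $i_1,i_2,i_3,a_4,a_5,a_6$): class $(3,1)$: $(i_1,i_2,i_3)$; $(3,2)$: $(i_1,i_3,i_2),(i_3,i_2,i_1),(i_2,i_1,i_3)$; $(3,3)$: $(i_2,i_3,i_1),(i_3,i_1,i_2)$; $(4,1)$: $(i_1,i_2,a_4),(i_1,a_4,i_3),(a_4,i_2,i_3)$; $(4,2)$: $(i_2,i_1,a_4),(i_3,a_4,i_1),(a_4,i_3,i_2)$; $(4,3)$: $(i_1,i_3,a_4),(i_1,a_4,i_2),(i_3,i_2,a_4),(a_4,i_2,i_1),(i_2,a_4,i_3),(a_4,i_1,i_3)$; $(4,4)$: $(i_2,i_3,a_4),(i_3,a_4,i_2),(i_3,i_1,a_4),(a_4,i_3,i_1),(i_2,a_4,i_1),(a_4,i_1,i_2)$;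 $(5,1)$: $(i_1,a_4,a_5),(a_4,i_2,a_5),(a_4,a_5,i_3)$; $(5,2)$: $(i_2,a_4,a_5),(i_3,a_4,a_5),(a_4,i_1,a_5),(a_4,i_3,a_5),(a_4,a_5,i_1),(a_4,a_5,i_2)$; $(6,1)$: $(a_4,a_5,a_6)$. A total order on $\{i_1,i_2,i_3,a_4,\dots,a_j\}$ is compatible with $CI_\phi$ if $i_1<i_2<i_3$ in it, nothing precedes $i_1$ when $\phi$ begins with "[", nothing follows $i_3$ when $\phi$ ends with "]", and nothing lies strictly between two $i$'s whose adjacency is required by a missing dash. Then $u_{j\ell}(\phi)$ is the number of pairs (compatible total order on $\{i_1,i_2,i_3,a_4,\dots,a_j\}$, triple $(x,y,z)$ in class $(j,\ell)$) such that $x,y,z$, compared in that total order, are in the same relative order as $\phi_c$. (For $j\ge4$ these triples correspond to the sets $\{\pi\in C_\lambda:\pi_{i_1}=x,\pi_{i_2}=y,\pi_{i_3}=z\}$ with $a_4,\dots,a_j$ distinct values outside $\{i_1,i_2,i_3\}$.) -}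

module Defs where

open import Data.Bool using (Bool; true; false; not; _∧_; _∨_; if_then_else_)
open import Data.Nat using (ℕ; zero; suc; _+_; _*_; _∸_; _≤ᵇ_; _<ᵇ_; _≡ᵇ_; _!)
open import Data.Nat.Combinatorics using (_P_)
open import Data.Fin using (Fin; toℕ)
open import Data.List using (List; []; _∷_; map; concatMap; filterᵇ; length; upTo; allFin; _++_)
open import Data.Vec using (Vec; toList) renaming (lookup to vlookup; [] to v[]; _∷_ to _v∷_)
open import Data.Bool.ListAction using (all; any)
open import Data.Product using (_×_; _,_)
open import Data.Integer using (ℤ; +_; -_) renaming (_+_ to _+ℤ_; _*_ to _*ℤ_)
open import Data.Rational using (ℚ; 0ℚ; _/_) renaming (_+_ to _+ℚ_; _*_ to _*ℚ_)
open import Relation.Binary.PropositionalEquality using (_≡_)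

sumℕ : List ℕ → ℕ
sumℕ [] = 0
sumℕ (x ∷ xs) = x + sumℕ xs

sumℚ : List ℚ → ℚ
sumℚ [] = 0ℚ
sumℚ (x ∷ xs) = x +ℚ sumℚ xs

count : ℕ → List ℕ → ℕ
count m xs = length (filterᵇ (λ x → x ≡ᵇ m) xs)

sameMultiset : List ℕ → List ℕ → Bool
sameMultiset xs ys = all (λ m → count m xs ≡ᵇ count m ys) (xs ++ ys)

distinctℕ : List ℕ → Bool
distinctℕ [] = true
distinctℕ (x ∷ xs) = not (any (λ y → y ≡ᵇ x) xs) ∧ distinctℕ xs

nth : List ℕ → ℕ → ℕ
nth [] _ = 0
nth (x ∷ xs) zero = x
nth (x ∷ xs) (suc k) = nth xs k

-- 1/m as a rational, for m ≠ 0 (only ever applied to nonzero m)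
inv : ℕ → ℚ
inv zero = 0ℚ
inv (suc m) = + 1 / suc m

-- Permutations of [n], in one-line notation.
-- [n] = {1,…,n} is represented by Fin n = {0,…,n-1} (order-preserving shift).
-- π is stored as the vector (π_1,…,π_n).

allVecs : (m k : ℕ) → List (Vec (Fin m) k)
allVecs m zero = v[] ∷ []
allVecs m (suc k) = concatMap (λ v → map (λ x → x v∷ v) (allFin m)) (allVecs m k)

isPerm : {n : ℕ} → Vec (Fin n) n → Bool
isPerm v = distinctℕ (map toℕ (toList v))

Sym : (n : ℕ) → List (Vec (Fin n) n)
Sym n = filterᵇ isPerm (allVecs n n)

iter : {n : ℕ} → Vec (Fin n) n → ℕ → Fin n → Fin n
iter π zero i = i
iter π (suc k) i = vlookup π (iter π k i)

firstOr0 : List ℕ → ℕ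
firstOr0 [] = 0
firstOr0 (x ∷ _) = x

cycleLen : {n : ℕ} → Vec (Fin n) n → Fin n → ℕ
cycleLen {n} π i = firstOr0 (filterᵇ (λ k → toℕ (iter π k i) ≡ᵇ toℕ i) (map suc (upTo n)))

isCycleMin : {n : ℕ} → Vec (Fin n) n → Fin n → Bool
isCycleMin {n} π i = all (λ k → toℕ i ≤ᵇ toℕ (iter π k i)) (upTo n)

cycleType : {n : ℕ} → Vec (Fin n) n → List ℕ
cycleType {n} π = map (cycleLen π) (filterᵇ (isCycleMin π) (allFin n))

nonIncreasing : List ℕ → Bool
nonIncreasing [] = true
nonIncreasing (x ∷ []) = true
nonIncreasing (x ∷ y ∷ xs) = (y ≤ᵇ x) ∧ nonIncreasing (y ∷ xs)

record Partition (n : ℕ) : Set where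
  field
    parts    : List ℕ
    positive : all (λ x → 1 ≤ᵇ x) parts ≡ true
    sorted   : nonIncreasing parts ≡ true
    sums     : sumℕ parts ≡ n
open Partition public

ConjClass : (n : ℕ) → Partition n → List (Vec (Fin n) n)
ConjClass n μ = filterᵇ (λ π → sameMultiset (cycleType π) (parts μ)) (Sym n)

pp qq rr : {n : ℕ} → Partition n → ℕ
pp μ = count 1 (parts μ)
qq μ = count 2 (parts μ)
rr μ = count 3 (parts μ)

sameOrder : ℕ × ℕ × ℕ → ℕ × ℕ × ℕ → Bool
sameOrder (a , b , c) (x , y , z) =
  ((a <ᵇ b) ≡ᵇB (x <ᵇ y)) ∧ ((a <ᵇ c) ≡ᵇB (x <ᵇ z)) ∧ ((b <ᵇ c) ≡ᵇB (y <ᵇ z))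
  where
  _≡ᵇB_ : Bool → Bool → Bool
  true ≡ᵇB true = true
  false ≡ᵇB false = true
  _ ≡ᵇB _ = false

record VPattern : Set where
  field
    φc     : Vec (Fin 3) 3
    φc-perm : isPerm φc ≡ true
    leftSq  : Bool                    -- true: begins with "[", false: "("
    rightSq : Bool                    -- true: ends with "]", false: ")"
    dash12  : Bool                    -- true: dash between φ₁ and φ₂
    dash23  : Bool                    -- true: dash between φ₂ and φ₃
open VPattern public

φcTriple : VPattern → ℕ × ℕ × ℕ
φcTriple φ = (toℕ (vlookup (φc φ) (Data.Fin.zero)) ,
              toℕ (vlookup (φc φ) (Data.Fin.suc Data.Fin.zero)) ,
              toℕ (vlookup (φc φ) (Data.Fin.suc (Data.Fin.suc Data.Fin.zero))))

b2n : Bool → ℕ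
b2n true = 1
b2n false = 0

kφ : VPattern → ℕ
kφ φ = b2n (leftSq φ) + b2n (rightSq φ) + b2n (not (dash12 φ)) + b2n (not (dash23 φ))

-- CI_φ for positions i₁,i₂,i₃ (0-based) among m positions 0,…,m-1
CI : VPattern → ℕ → ℕ → ℕ → ℕ → Bool
CI φ m i₁ i₂ i₃ =
  (i₁ <ᵇ i₂) ∧ (i₂ <ᵇ i₃)
  ∧ (not (leftSq φ)  ∨ (i₁ ≡ᵇ 0))
  ∧ (not (rightSq φ) ∨ (i₃ ≡ᵇ (m ∸ 1)))
  ∧ (dash12 φ ∨ (i₂ ≡ᵇ suc i₁))
  ∧ (dash23 φ ∨ (i₃ ≡ᵇ suc i₂))

triplesFin : (n : ℕ) → List (Fin n × Fin n × Fin n)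
triplesFin n = concatMap (λ a → concatMap (λ b → map (λ c → (a , b , c)) (allFin n)) (allFin n)) (allFin n)

pat : {n : ℕ} → VPattern → Vec (Fin n) n → ℕ
pat {n} φ π = length (filterᵇ occ (triplesFin n))
  where
  occ : Fin n × Fin n × Fin n → Bool
  occ (a , b , c) = CI φ n (toℕ a) (toℕ b) (toℕ c)
                    ∧ sameOrder (toℕ (vlookup π a) , toℕ (vlookup π b) , toℕ (vlookup π c)) (φcTriple φ)

meanPat : (n : ℕ) → VPattern → Partition n → ℚ
meanPat n φ μ = (+ sumℕ (map (pat φ) (ConjClass n μ)) / 1) *ℚ inv (length (ConjClass n μ))

-- Classes of formal triples.  Symbols are numbered
-- i₁ = 0, i₂ = 1, i₃ = 2, a₄ = 3, a₅ = 4, a₆ = 5.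

triClass : ℕ → ℕ → List (ℕ × ℕ × ℕ)
triClass 3 1 = (0 , 1 , 2) ∷ []
triClass 3 2 = (0 , 2 , 1) ∷ (2 , 1 , 0) ∷ (1 , 0 , 2) ∷ []
triClass 3 3 = (1 , 2 , 0) ∷ (2 , 0 , 1) ∷ []
triClass 4 1 = (0 , 1 , 3) ∷ (0 , 3 , 2) ∷ (3 , 1 , 2) ∷ []
triClass 4 2 = (1 , 0 , 3) ∷ (2 , 3 , 0) ∷ (3 , 2 , 1) ∷ []
triClass 4 3 = (0 , 2 , 3) ∷ (0 , 3 , 1) ∷ (2 , 1 , 3) ∷ (3 , 1 , 0) ∷ (1 , 3 , 2) ∷ (3 , 0 , 2) ∷ []
triClass 4 4 = (1 , 2 , 3) ∷ (2 , 3 , 1) ∷ (2 , 0 , 3) ∷ (3 , 2 , 0) ∷ (1 , 3 , 0) ∷ (3 , 0 , 1) ∷ []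
triClass 5 1 = (0 , 3 , 4) ∷ (3 , 1 , 4) ∷ (3 , 4 , 2) ∷ []
triClass 5 2 = (1 , 3 , 4) ∷ (2 , 3 , 4) ∷ (3 , 0 , 4) ∷ (3 , 2 , 4) ∷ (3 , 4 , 0) ∷ (3 , 4 , 1) ∷ []
triClass 6 1 = (3 , 4 , 5) ∷ []
triClass _ _ = []

-- A total order on the j symbols {i₁,i₂,i₃,a₄,…,a_j} is encoded by σ ∈ S_j,
-- σ(s) = rank (0-based) of symbol s.
rank : {j : ℕ} → Vec (Fin j) j → ℕ → ℕ
rank σ s = nth (map toℕ (toList σ)) s

compatible : {j : ℕ} → VPattern → Vec (Fin j) j → Bool
compatible {j} φ σ = CI φ j (rank σ 0) (rank σ 1) (rank σ 2)

u : (j ℓ : ℕ) → VPattern → ℕ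
u j ℓ φ = length (filterᵇ good
            (concatMap (λ σ → map (λ t → (σ , t)) (triClass j ℓ)) (filterᵇ (compatible φ) (Sym j))))
  where
  good : Vec (Fin j) j × (ℕ × ℕ × ℕ) → Bool
  good (σ , (x , y , z)) = sameOrder (rank σ x , rank σ y , rank σ z) (φcTriple φ)

H : (j ℓ : ℕ) → (n p q r : ℤ) → ℤ
H 3 1 n p q r = p *ℤ (p +ℤ - + 1) *ℤ (p +ℤ - + 2)
H 3 2 n p q r = + 2 *ℤ p *ℤ q
H 3 3 n p q r = + 3 *ℤ r
H 4 1 n p q r = p *ℤ (p +ℤ - + 1) *ℤ (n +ℤ - p)
H 4 2 n p q r = + 2 *ℤ q *ℤ (n +ℤ - p +ℤ - + 2)
H 4 3 n p q r = p *ℤ (n +ℤ - p +ℤ - (+ 2 *ℤ q))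
H 4 4 n p q r = n +ℤ - p +ℤ - (+ 2 *ℤ q) +ℤ - (+ 3 *ℤ r)
H 5 1 n p q r = p *ℤ p *ℤ p +ℤ + 3 *ℤ p *ℤ p +ℤ + 2 *ℤ p *ℤ q
                +ℤ - (n *ℤ (+ 2 *ℤ p *ℤ p +ℤ + 3 *ℤ p)) +ℤ n *ℤ n *ℤ p
H 5 2 n p q r = p *ℤ p +ℤ + 4 *ℤ p +ℤ + 2 *ℤ p *ℤ q +ℤ + 8 *ℤ q +ℤ + 3 *ℤ r
                +ℤ - (n *ℤ (+ 2 *ℤ p +ℤ + 2 *ℤ q +ℤ + 4)) +ℤ n *ℤ n
H 6 1 n p q r = - (p *ℤ p *ℤ p) +ℤ - (+ 9 *ℤ p *ℤ p) +ℤ - (+ 20 *ℤ p) +ℤ - (+ 6 *ℤ p *ℤ q)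
                +ℤ - (+ 24 *ℤ q) +ℤ - (+ 6 *ℤ r)
                +ℤ n *ℤ (+ 3 *ℤ p *ℤ p +ℤ + 18 *ℤ p +ℤ + 6 *ℤ q +ℤ + 20)
                +ℤ - (n *ℤ n *ℤ (+ 3 *ℤ p +ℤ + 9)) +ℤ n *ℤ n *ℤ n
H _ _ n p q r = + 0

L : ℕ → ℕ
L 3 = 3
L 4 = 4
L 5 = 2
L 6 = 1
L _ = 0

formulaRHS : (n : ℕ) → VPattern → Partition n → ℚ
formulaRHS n φ μ =
  inv (n P kφ φ) *ℚ
  sumℚ (map (λ j → inv ((j ∸ kφ φ) !) *ℚ
                   sumℚ (map (λ ℓ → (+ u j ℓ φ *ℤ H j ℓ (+ n) (+ pp μ) (+ qq μ) (+ rr μ)) / 1)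
                             (map suc (upTo (L j)))))
            (3 ∷ 4 ∷ 5 ∷ 6 ∷ []))

{-# OPTIONS --safe #-}

-- Summing pat_φ over C_λ and splitting each occurrence according to which of the values π_{i₁}, π_{i₂}, π_{i₃}
-- lie among the positions i₁, i₂, i₃ gives a sum, over the triples t of all classes (j,ℓ) and the injective
-- tuples w = (i₁,i₂,i₃,a₄,…,a_j) in [n], of the number of π ∈ C_λ matching t at w, restricted to those w that
-- satisfy CI_φ and show the order φ_c at t.  Since conjugation by S_n preserves C_λ and S_n acts transitively on
-- injective tuples, the number of matching π does not depend on w; double counting turns it into
-- |C_λ| H_{jℓ}(λ) / (n)_j, where H_{jℓ} counts the w matched by a single π ∈ C_λ and follows by inclusion–exclusion
-- from the numbers of fixed points, 2-cycles and 3-cycles.  Standardization splits the admissible w into a compatible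
-- total order of the symbols and an increasing j-sequence in [n] with k_φ prescribed tight gaps, and there are
-- binom(n - k_φ, j - k_φ) of the latter.  Finally binom(n - k, j - k) / (n)_j = 1 / ((n)_k (j - k)!).

module Submission where

open import Defs
import Algebra.Properties.CommutativeSemigroup as CommutativeSemigroupProperties
open import Data.Bool using (Bool; true; false; not; _∧_; _∨_; T)
import Data.Bool.Properties as Boolₚ
open import Data.Bool.ListAction using (all; any)
open import Data.Fin using (Fin; zero; suc; toℕ; fromℕ; fromℕ<; inject₁; _↑ˡ_; _↑ʳ_)
import Data.Fin as Fin
open import Data.Fin.Patterns using (0F; 1F; 2F; 3F)
import Data.Fin.Properties as Finₚ
open import Data.Fin.Permutation using (Permutation′; _⟨$⟩ʳ_; _⟨$⟩ˡ_; inverseˡ; inverseʳ; transpose; flip; _∘ₚ_)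
import Data.Fin.Permutation as Perm
import Data.Integer as ℤ
open import Data.Integer using (ℤ)
import Data.Integer.Properties as ℤₚ
open import Data.List.Relation.Unary.All using (All; []; _∷_)
import Data.List.Relation.Unary.All as All
open import Data.List using (List; []; _∷_; _++_; map; concatMap; filterᵇ; length; upTo; applyUpTo; allFin)
import Data.List as List
import Data.List.Properties as Listₚ
open import Data.Nat using (ℕ; zero; suc; _+_; _*_; _∸_; _≤_; _<_; _≤ᵇ_; _<ᵇ_; _≡ᵇ_; _!; z≤n; s≤s; NonZero)
import Data.Nat as ℕ
import Data.Nat.Properties as ℕₚ
open import Data.Nat.Combinatorics using (_C_; _P_)
import Data.Nat.Combinatorics as Comb
open import Data.Nat.Divisibility using (_∣_)
open import Data.Nat.DivMod using (_%_; _/_)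
import Data.Nat.DivMod as DivMod
open import Data.Product using (∃; _×_; _,_; proj₁; proj₂)
open import Data.Rational using (ℚ)
import Data.Rational as ℚ
import Data.Rational.Properties as ℚₚ
open import Data.Rational.Solver using (module +-*-Solver)
import Data.Rational.Unnormalised as ℚᵘ
import Data.Rational.Unnormalised.Properties as ℚᵘₚ
open import Data.Sum using (_⊎_; inj₁; inj₂)
open import Data.Unit using (tt)
open import Data.Vec using (Vec; []; _∷_; _∷ʳ_; toList; lookup; tabulate)
import Data.Vec as Vec
import Data.Vec.Properties as Vecₚ
open import Function using (_∘_; id; case_of_)
open import Data.Fin.Relation.Unary.Top using (view; ‵fromℕ; ‵inject₁)
open import Relation.Binary using (DecidableEquality; tri<; tri≈; tri>)
open import Relation.Binary.PropositionalEquality using (_≡_; _≢_; refl; sym; trans; cong; cong₂; subst; subst₂; module ≡-Reasoning)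
open import Relation.Nullary using (¬_; Dec; yes; no; does; contradiction; _×-dec_; _⊎-dec_; ¬?)
open import Relation.Nullary.Decidable using (T?; map′; dec-true; dec-false; from-yes)
import Data.Nat.Tactic.RingSolver as ℕ-Solver
import Data.Integer.Tactic.RingSolver as ℤ-Solver

open CommutativeSemigroupProperties ℕₚ.*-commutativeSemigroup using (x∙yz≈y∙xz)

-- Two denominators need care. The mean divides by |C_λ|, so a permutation of every cycle type has
-- to be built: a block sum of rotations. The double counting divides by (n)_j, which is 0 for j >
-- n; the identity is therefore proved with denominators cleared, so that both sides vanish there,
-- while for j ≤ n a binomial coefficient is cancelled. The classes and the polynomials H have one
-- source. With i₁, i₂, i₃ fixed, all that matters about a value is whether it is one of them, and
-- which; so a₄, a₅, a₆ merge into a fourth symbol. Of the 64 triples of symbols, those repeating an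
-- inner symbol cannot occur for an injective map. The other 34 are the members of the ten classes,
-- and each class is an orbit under simultaneous relabelling of positions and values, so that one
-- evaluation per class suffices. The outside symbol is never counted directly: it is what the three
-- inner symbols leave over, and H₆₁, with three outside values, is the last remainder. The counts
-- obey subtraction-free equations in ℕ and become polynomials with signs only in ℤ.

private
  variable
    A B : Set
    n m : ℕ

-- Finite sums

∑ : List A → (A → ℕ) → ℕ
∑ xs f = sumℕ (map f xs)

syntax ∑ xs (λ x → e) = ∑[ x ∈ xs ] e

⟦_⟧ : {P : Set} → Dec P → ℕ
⟦ d ⟧ = b2n (does d)

∑-cong : (xs : List A) {f g : A → ℕ} → (∀ x → f x ≡ g x) → ∑ xs f ≡ ∑ xs g
∑-cong []       eq = refl
∑-cong (x ∷ xs) eq = cong₂ _+_ (eq x) (∑-cong xs eq)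

∑-zero : (xs : List A) → ∑[ _ ∈ xs ] 0 ≡ 0
∑-zero []       = refl
∑-zero (_ ∷ xs) = ∑-zero xs

∑-+ : (xs : List A) {f g : A → ℕ} → ∑[ x ∈ xs ] (f x + g x) ≡ ∑ xs f + ∑ xs g
∑-+ []               = refl
∑-+ (x ∷ xs) {f} {g} = begin
  f x + g x + ∑[ x ∈ xs ] (f x + g x) ≡⟨ cong (_ +_) (∑-+ xs) ⟩
  f x + g x + (∑ xs f + ∑ xs g)       ≡⟨ interchange (f x) (g x) (∑ xs f) (∑ xs g) ⟩
  f x + ∑ xs f + (g x + ∑ xs g)       ∎
  where
  open ≡-Reasoning
  interchange : ∀ a b c d → a + b + (c + d) ≡ a + c + (b + d)
  interchange = ℕ-Solver.solve-∀

∑-*ˡ : (xs : List A) (c : ℕ) {f : A → ℕ} → ∑[ x ∈ xs ] (c * f x) ≡ c * ∑ xs f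
∑-*ˡ []       c     = sym (ℕₚ.*-zeroʳ c)
∑-*ˡ (x ∷ xs) c {f} = trans (cong (c * f x +_) (∑-*ˡ xs c)) (sym (ℕₚ.*-distribˡ-+ c (f x) (∑ xs f)))

∑-*ʳ : (xs : List A) (c : ℕ) {f : A → ℕ} → ∑[ x ∈ xs ] (f x * c) ≡ ∑ xs f * c
∑-*ʳ xs c {f} = begin
  ∑[ x ∈ xs ] (f x * c) ≡⟨ ∑-cong xs (λ x → ℕₚ.*-comm (f x) c) ⟩
  ∑[ x ∈ xs ] (c * f x) ≡⟨ ∑-*ˡ xs c ⟩
  c * ∑ xs f            ≡⟨ ℕₚ.*-comm c _ ⟩
  ∑ xs f * c            ∎
  where open ≡-Reasoning

∑-swap : (xs : List A) (ys : List B) {f : A → B → ℕ} →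
         ∑[ x ∈ xs ] ∑[ y ∈ ys ] f x y ≡ ∑[ y ∈ ys ] ∑[ x ∈ xs ] f x y
∑-swap []       ys     = sym (∑-zero ys)
∑-swap (x ∷ xs) ys {f} = trans (cong (∑ ys (f x) +_) (∑-swap xs ys)) (sym (∑-+ ys))

∑-++ : (xs ys : List A) {f : A → ℕ} → ∑ (xs ++ ys) f ≡ ∑ xs f + ∑ ys f
∑-++ []       ys     = refl
∑-++ (x ∷ xs) ys {f} = trans (cong (f x +_) (∑-++ xs ys)) (sym (ℕₚ.+-assoc (f x) _ _))

∑-map : (h : A → B) (xs : List A) {f : B → ℕ} → ∑ (map h xs) f ≡ ∑[ x ∈ xs ] f (h x)
∑-map h []       = refl
∑-map h (x ∷ xs) = cong (_ +_) (∑-map h xs)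

∑-concatMap : (h : A → List B) (xs : List A) {f : B → ℕ} →
              ∑ (concatMap h xs) f ≡ ∑[ x ∈ xs ] ∑ (h x) f
∑-concatMap h []       = refl
∑-concatMap h (x ∷ xs) = trans (∑-++ (h x) _) (cong (_ +_) (∑-concatMap h xs))

∑-filterᵇ : (p : A → Bool) (xs : List A) {f : A → ℕ} →
            ∑ (filterᵇ p xs) f ≡ ∑[ x ∈ xs ] (b2n (p x) * f x)
∑-filterᵇ p []           = refl
∑-filterᵇ p (x ∷ xs) {f} with p x
... | true  = cong₂ _+_ (sym (ℕₚ.+-identityʳ (f x))) (∑-filterᵇ p xs)
... | false = ∑-filterᵇ p xs

length-∑ : (xs : List A) → length xs ≡ ∑[ _ ∈ xs ] 1
length-∑ []       = refl
length-∑ (_ ∷ xs) = cong suc (length-∑ xs)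

∑-const : (xs : List A) (c : ℕ) → ∑[ _ ∈ xs ] c ≡ length xs * c
∑-const []       c = refl
∑-const (_ ∷ xs) c = cong (c +_) (∑-const xs c)

length-filterᵇ : (p : A → Bool) (xs : List A) → length (filterᵇ p xs) ≡ ∑[ x ∈ xs ] b2n (p x)
length-filterᵇ p xs = begin
  length (filterᵇ p xs)        ≡⟨ length-∑ (filterᵇ p xs) ⟩
  ∑[ _ ∈ filterᵇ p xs ] 1      ≡⟨ ∑-filterᵇ p xs ⟩
  ∑[ x ∈ xs ] (b2n (p x) * 1)  ≡⟨ ∑-cong xs (λ x → ℕₚ.*-identityʳ _) ⟩
  ∑[ x ∈ xs ] b2n (p x)        ∎
  where open ≡-Reasoning

b2n-∧ : ∀ a b → b2n (a ∧ b) ≡ b2n a * b2n b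
b2n-∧ true  b = sym (ℕₚ.+-identityʳ (b2n b))
b2n-∧ false b = refl

⟦⟧-yes : {P : Set} (d : Dec P) → P → ⟦ d ⟧ ≡ 1
⟦⟧-yes (yes _) p = refl
⟦⟧-yes (no ¬p) p = contradiction p ¬p

⟦⟧-no : {P : Set} (d : Dec P) → ¬ P → ⟦ d ⟧ ≡ 0
⟦⟧-no (yes p) ¬p = contradiction p ¬p
⟦⟧-no (no _)  ¬p = refl

⟦⟧-⇔ : {P Q : Set} (d : Dec P) (e : Dec Q) → (P → Q) → (Q → P) → ⟦ d ⟧ ≡ ⟦ e ⟧
⟦⟧-⇔ (yes p) e f g = sym (⟦⟧-yes e (f p))
⟦⟧-⇔ (no ¬p) e f g = sym (⟦⟧-no e (¬p ∘ g))

⟦⟧-× : {P Q : Set} (d : Dec P) (e : Dec Q) → ⟦ d ×-dec e ⟧ ≡ ⟦ d ⟧ * ⟦ e ⟧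
⟦⟧-× d e = b2n-∧ (does d) (does e)

⟦⟧*-cong : {P : Set} (d : Dec P) {a b : ℕ} → (P → a ≡ b) → ⟦ d ⟧ * a ≡ ⟦ d ⟧ * b
⟦⟧*-cong (yes p) eq = cong (1 *_) (eq p)
⟦⟧*-cong (no _)  eq = refl

⟦⟧*-zero : {P : Set} (d : Dec P) {a : ℕ} → (P → a ≡ 0) → ⟦ d ⟧ * a ≡ 0
⟦⟧*-zero d eq = trans (⟦⟧*-cong d eq) (ℕₚ.*-zeroʳ ⟦ d ⟧)

⟦⟧+⟦¬⟧ : {P : Set} (d : Dec P) → ⟦ d ⟧ + ⟦ ¬? d ⟧ ≡ 1
⟦⟧+⟦¬⟧ (yes _) = refl
⟦⟧+⟦¬⟧ (no _)  = refl

-- "Each element once" is phrased as a sum of indicators, so that bijections, products and point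
-- evaluations are handled by rearranging sums, without list membership or permutations of lists.
record Enum (A : Set) : Set where
  field
    elems : List A
    _≟_   : DecidableEquality A
    once  : ∀ y → ∑[ x ∈ elems ] ⟦ x ≟ y ⟧ ≡ 1

  ∑-δ : ∀ y (f : A → ℕ) → ∑[ x ∈ elems ] (⟦ x ≟ y ⟧ * f x) ≡ f y
  ∑-δ y f = begin
    ∑[ x ∈ elems ] (⟦ x ≟ y ⟧ * f x) ≡⟨ ∑-cong elems (λ x → ⟦⟧*-cong (x ≟ y) (cong f)) ⟩
    ∑[ x ∈ elems ] (⟦ x ≟ y ⟧ * f y) ≡⟨ ∑-*ʳ elems (f y) ⟩
    ∑[ x ∈ elems ] ⟦ x ≟ y ⟧ * f y   ≡⟨ cong (_* f y) (once y) ⟩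
    1 * f y                          ≡⟨ ℕₚ.*-identityˡ (f y) ⟩
    f y                              ∎
    where open ≡-Reasoning

-- Double counting of the pairs `(a , b)` with `b` equal to `g a`: the inverse `h` shows that every
-- fibre has one element.
∑-reindex : (E : Enum A) (F : Enum B) (g : A → B) (h : B → A) →
            (∀ b → g (h b) ≡ b) → (∀ a → h (g a) ≡ a) → (f : B → ℕ) →
            ∑[ a ∈ Enum.elems E ] f (g a) ≡ ∑ (Enum.elems F) f
∑-reindex E F g h gh hg f = begin
  ∑[ a ∈ as ] f (g a)                             ≡⟨ ∑-cong as (λ a → Enum.∑-δ F (g a) f) ⟨
  ∑[ a ∈ as ] ∑[ b ∈ bs ] (⟦ b ≟ᴮ g a ⟧ * f b)    ≡⟨ ∑-swap as bs ⟩
  ∑[ b ∈ bs ] ∑[ a ∈ as ] (⟦ b ≟ᴮ g a ⟧ * f b)    ≡⟨ ∑-cong bs (λ b → ∑-*ʳ as (f b)) ⟩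
  ∑[ b ∈ bs ] (∑[ a ∈ as ] ⟦ b ≟ᴮ g a ⟧ * f b)    ≡⟨ ∑-cong bs (λ b → cong (_* f b) (fibre b)) ⟩
  ∑[ b ∈ bs ] (1 * f b)                           ≡⟨ ∑-cong bs (λ b → ℕₚ.*-identityˡ (f b)) ⟩
  ∑ bs f                                          ∎
  where
  open ≡-Reasoning
  as = Enum.elems E
  bs = Enum.elems F
  _≟ᴬ_ = Enum._≟_ E
  _≟ᴮ_ = Enum._≟_ F
  fibre : ∀ b → ∑[ a ∈ as ] ⟦ b ≟ᴮ g a ⟧ ≡ 1
  fibre b = trans
    (∑-cong as λ a → ⟦⟧-⇔ (b ≟ᴮ g a) (a ≟ᴬ h b)
      (λ eq → trans (sym (hg a)) (cong h (sym eq)))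
      (λ eq → trans (sym (gh b)) (cong g (sym eq))))
    (Enum.once E (h b))

tabulate-suc : ∀ n → List.tabulate {n = n} Fin.suc ≡ map suc (allFin n)
tabulate-suc n = sym (Listₚ.map-tabulate id suc)

∑-allFin-suc : (f : Fin (suc n) → ℕ) → ∑ (allFin (suc n)) f ≡ f zero + ∑[ i ∈ allFin n ] f (suc i)
∑-allFin-suc {n} f = cong (f zero +_) (trans (cong (λ is → ∑ is f) (tabulate-suc n)) (∑-map suc (allFin n)))

FinEnum : ∀ n → Enum (Fin n)
FinEnum n = record { elems = allFin n ; _≟_ = Finₚ._≟_ ; once = once n }
  where
  once : ∀ n (j : Fin n) → ∑[ i ∈ allFin n ] ⟦ i Finₚ.≟ j ⟧ ≡ 1
  once (suc n) zero    = trans (∑-allFin-suc {n} (λ i → ⟦ i Finₚ.≟ zero ⟧)) (cong suc (∑-zero (allFin n)))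
  once (suc n) (suc j) = trans (∑-allFin-suc {n} (λ i → ⟦ i Finₚ.≟ suc j ⟧)) (once n j)

∑-allVecs-suc : (F : Vec (Fin n) (suc m) → ℕ) →
                ∑ (allVecs n (suc m)) F ≡ ∑[ v ∈ allVecs n m ] ∑[ x ∈ allFin n ] F (x ∷ v)
∑-allVecs-suc {n} {m} F =
  trans (∑-concatMap _ (allVecs n m)) (∑-cong (allVecs n m) (λ v → ∑-map (_∷ v) (allFin n)))

VecEnum : ∀ n m → Enum (Vec (Fin n) m)
VecEnum n m = record { elems = allVecs n m ; _≟_ = Vecₚ.≡-dec Finₚ._≟_ ; once = once m }
  where
  once : ∀ m (v : Vec (Fin n) m) → ∑[ w ∈ allVecs n m ] ⟦ Vecₚ.≡-dec Finₚ._≟_ w v ⟧ ≡ 1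
  once zero    []      = refl
  once (suc m) (y ∷ v) = begin
    ∑[ w ∈ allVecs n (suc m) ] ⟦ w ≟ (y ∷ v) ⟧
      ≡⟨ ∑-allVecs-suc (λ w → ⟦ w ≟ (y ∷ v) ⟧) ⟩
    ∑[ w ∈ allVecs n m ] ∑[ x ∈ allFin n ] ⟦ (x ∷ w) ≟ (y ∷ v) ⟧
      ≡⟨ ∑-cong (allVecs n m) (λ w → ∑-cong (allFin n) (λ x → ⟦⟧-× (x Finₚ.≟ y) (w ≟ v))) ⟩
    ∑[ w ∈ allVecs n m ] ∑[ x ∈ allFin n ] (⟦ x Finₚ.≟ y ⟧ * ⟦ w ≟ v ⟧)
      ≡⟨ ∑-cong (allVecs n m) (λ w → Enum.∑-δ (FinEnum n) y (λ _ → ⟦ w ≟ v ⟧)) ⟩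
    ∑[ w ∈ allVecs n m ] ⟦ w ≟ v ⟧
      ≡⟨ once m v ⟩
    1 ∎
    where
    open ≡-Reasoning
    _≟_ : ∀ {k} → DecidableEquality (Vec (Fin n) k)
    _≟_ = Vecₚ.≡-dec Finₚ._≟_

_×-Enum_ : Enum A → Enum B → Enum (A × B)
_×-Enum_ {A} {B} E F = record { elems = concatMap (λ a → map (a ,_) bs) as ; _≟_ = _≟_ ; once = once }
  where
  open ≡-Reasoning
  as = Enum.elems E
  bs = Enum.elems F
  _≟ᴬ_ = Enum._≟_ E
  _≟ᴮ_ = Enum._≟_ F
  _≟_ : DecidableEquality (A × B)
  (a , b) ≟ (c , d) = map′ (λ { (refl , refl) → refl }) (λ { refl → refl , refl }) ((a ≟ᴬ c) ×-dec (b ≟ᴮ d))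
  once : ∀ p → ∑[ q ∈ concatMap (λ a → map (a ,_) bs) as ] ⟦ q ≟ p ⟧ ≡ 1
  once (c , d) = begin
    ∑[ q ∈ concatMap (λ a → map (a ,_) bs) as ] ⟦ q ≟ (c , d) ⟧
      ≡⟨ ∑-concatMap _ as ⟩
    ∑[ a ∈ as ] ∑[ q ∈ map (a ,_) bs ] ⟦ q ≟ (c , d) ⟧
      ≡⟨ ∑-cong as (λ a → ∑-map (a ,_) bs) ⟩
    ∑[ a ∈ as ] ∑[ b ∈ bs ] ⟦ (a ≟ᴬ c) ×-dec (b ≟ᴮ d) ⟧
      ≡⟨ ∑-cong as (λ a → trans (∑-cong bs (λ b → ⟦⟧-× (a ≟ᴬ c) (b ≟ᴮ d))) (∑-*ˡ bs ⟦ a ≟ᴬ c ⟧)) ⟩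
    ∑[ a ∈ as ] (⟦ a ≟ᴬ c ⟧ * ∑[ b ∈ bs ] ⟦ b ≟ᴮ d ⟧)
      ≡⟨ Enum.∑-δ E c (λ _ → ∑[ b ∈ bs ] ⟦ b ≟ᴮ d ⟧) ⟩
    ∑[ b ∈ bs ] ⟦ b ≟ᴮ d ⟧
      ≡⟨ Enum.once F d ⟩
    1 ∎

∑-×-Enum : (E : Enum A) (F : Enum B) {f : A × B → ℕ} →
           ∑ (Enum.elems (E ×-Enum F)) f ≡ ∑[ a ∈ Enum.elems E ] ∑[ b ∈ Enum.elems F ] f (a , b)
∑-×-Enum E F = trans (∑-concatMap _ (Enum.elems E)) (∑-cong (Enum.elems E) (λ a → ∑-map (a ,_) (Enum.elems F)))

-- `allVecs` builds vectors by prepending, whereas the tuples below grow at the end, so that symbols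
-- already chosen keep their indices.
∑-allVecs-∷ʳ : (F : Vec (Fin n) (suc m) → ℕ) →
               ∑ (allVecs n (suc m)) F ≡ ∑[ v ∈ allVecs n m ] ∑[ x ∈ allFin n ] F (v ∷ʳ x)
∑-allVecs-∷ʳ {n} {m} F = begin
  ∑ (allVecs n (suc m)) F
    ≡⟨ ∑-reindex (VecEnum n m ×-Enum FinEnum n) (VecEnum n (suc m))
         (λ (v , x) → v ∷ʳ x) (λ w → Vec.init w , Vec.last w)
         (λ w → sym (proj₂ (proj₂ (Vec.initLast w))))
         (λ (v , x) → cong₂ _,_ (Vecₚ.init-∷ʳ x v) (Vecₚ.last-∷ʳ x v)) F ⟨
  ∑[ (v , x) ∈ Enum.elems (VecEnum n m ×-Enum FinEnum n) ] F (v ∷ʳ x)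
    ≡⟨ ∑-×-Enum (VecEnum n m) (FinEnum n) ⟩
  ∑[ v ∈ allVecs n m ] ∑[ x ∈ allFin n ] F (v ∷ʳ x) ∎
  where open ≡-Reasoning

-- Sums over injective tuples

_∈_ : Fin n → Vec (Fin n) m → Set
x ∈ w = ∃ λ i → lookup w i ≡ x

Inj : Vec (Fin n) m → Set
Inj w = ∀ i j → lookup w i ≡ lookup w j → i ≡ j

-- Entries are compared through `toℕ`, so that the resulting Boolean is the one in `distinctℕ`;
-- `does-Inj?` then links `Inj?` with `isPerm`.
_∈?_ : (x : Fin n) (w : Vec (Fin n) m) → Dec (x ∈ w)
x ∈? []      = no λ ()
x ∈? (y ∷ w) = map′
  (λ { (inj₁ eq) → zero , Finₚ.toℕ-injective eq ; (inj₂ (i , eq)) → suc i , eq })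
  (λ { (zero , eq) → inj₁ (cong toℕ eq) ; (suc i , eq) → inj₂ (i , eq) })
  ((toℕ y ℕₚ.≟ toℕ x) ⊎-dec (x ∈? w))

Inj? : (w : Vec (Fin n) m) → Dec (Inj w)
Inj? []      = yes λ ()
Inj? (x ∷ w) = map′ to from (¬? (x ∈? w) ×-dec Inj? w)
  where
  to : ¬ (x ∈ w) × Inj w → Inj (x ∷ w)
  to (x∉w , inj) zero    zero    eq = refl
  to (x∉w , inj) zero    (suc j) eq = contradiction (j , sym eq) x∉w
  to (x∉w , inj) (suc i) zero    eq = contradiction (i , eq) x∉w
  to (x∉w , inj) (suc i) (suc j) eq = cong suc (inj i j eq)
  from : Inj (x ∷ w) → ¬ (x ∈ w) × Inj w
  from inj = (λ (i , eq) → case inj (suc i) zero eq of λ ()) ,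
             (λ i j eq → Finₚ.suc-injective (inj (suc i) (suc j) eq))

does-∈? : (x : Fin n) (w : Vec (Fin n) m) → does (x ∈? w) ≡ any (λ y → y ≡ᵇ toℕ x) (map toℕ (toList w))
does-∈? x []      = refl
does-∈? x (y ∷ w) = cong ((toℕ y ≡ᵇ toℕ x) ∨_) (does-∈? x w)

does-Inj? : (w : Vec (Fin n) m) → does (Inj? w) ≡ distinctℕ (map toℕ (toList w))
does-Inj? []      = refl
does-Inj? (x ∷ w) = cong₂ (λ a b → not a ∧ b) (does-∈? x w) (does-Inj? w)

∑-weighted-+ : (xs : List A) {c f g : A → ℕ} →
               ∑[ x ∈ xs ] (c x * (f x + g x)) ≡ ∑[ x ∈ xs ] (c x * f x) + ∑[ x ∈ xs ] (c x * g x)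
∑-weighted-+ xs {c} {f} {g} = trans (∑-cong xs (λ x → ℕₚ.*-distribˡ-+ (c x) (f x) (g x))) (∑-+ xs)

∑-weighted-*ʳ : (xs : List A) (k : ℕ) {c f : A → ℕ} →
                ∑[ x ∈ xs ] (c x * (f x * k)) ≡ ∑[ x ∈ xs ] (c x * f x) * k
∑-weighted-*ʳ xs k {c} {f} = trans (∑-cong xs (λ x → sym (ℕₚ.*-assoc (c x) (f x) k))) (∑-*ʳ xs k)

opaque
  -- Opaque because the counting uses only the laws of these two sums; they are evaluated outright
  -- only in the finite checks for `u 6 1`.
  ∑Inj : (n m : ℕ) → (Vec (Fin n) m → ℕ) → ℕ
  ∑Inj n m F = ∑[ w ∈ allVecs n m ] (⟦ Inj? w ⟧ * F w)

  ∑∉ : Vec (Fin n) m → (Fin n → ℕ) → ℕ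
  ∑∉ {n} w F = ∑[ x ∈ allFin n ] (⟦ ¬? (x ∈? w) ⟧ * F x)

  ∑Inj-cong : {F G : Vec (Fin n) m → ℕ} → (∀ w → Inj w → F w ≡ G w) → ∑Inj n m F ≡ ∑Inj n m G
  ∑Inj-cong {n} {m} eq = ∑-cong (allVecs n m) (λ w → ⟦⟧*-cong (Inj? w) (eq w))

  ∑Inj-zero : (F : Vec (Fin n) 0 → ℕ) → ∑Inj n 0 F ≡ F []
  ∑Inj-zero F = trans (ℕₚ.+-identityʳ _) (ℕₚ.*-identityˡ _)

  ∑∉-[] : (F : Fin n → ℕ) → ∑∉ [] F ≡ ∑ (allFin n) F
  ∑∉-[] {n} F = ∑-cong (allFin n) (λ x → ℕₚ.*-identityˡ (F x))

  ∑∉-cong : (w : Vec (Fin n) m) {F G : Fin n → ℕ} → (∀ x → ¬ (x ∈ w) → F x ≡ G x) → ∑∉ w F ≡ ∑∉ w G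
  ∑∉-cong {n} w eq = ∑-cong (allFin n) (λ x → ⟦⟧*-cong (¬? (x ∈? w)) (eq x))

  ∑Inj-+ : {F G : Vec (Fin n) m → ℕ} → ∑Inj n m (λ w → F w + G w) ≡ ∑Inj n m F + ∑Inj n m G
  ∑Inj-+ {n} {m} = ∑-weighted-+ (allVecs n m) {λ w → ⟦ Inj? w ⟧}

  ∑Inj-*ʳ : (k : ℕ) {F : Vec (Fin n) m → ℕ} → ∑Inj n m (λ w → F w * k) ≡ ∑Inj n m F * k
  ∑Inj-*ʳ {n} {m} k = ∑-weighted-*ʳ (allVecs n m) k {λ w → ⟦ Inj? w ⟧}

  ∑∉-*ʳ : (w : Vec (Fin n) m) (k : ℕ) {F : Fin n → ℕ} → ∑∉ w (λ x → F x * k) ≡ ∑∉ w F * k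
  ∑∉-*ʳ {n} w k = ∑-weighted-*ʳ (allFin n) k {λ x → ⟦ ¬? (x ∈? w) ⟧}

  ∑∉-*ˡ : (w : Vec (Fin n) m) (k : ℕ) {F : Fin n → ℕ} → ∑∉ w (λ x → k * F x) ≡ k * ∑∉ w F
  ∑∉-*ˡ w k {F} = begin
    ∑∉ w (λ x → k * F x) ≡⟨ ∑∉-cong w (λ x _ → ℕₚ.*-comm k (F x)) ⟩
    ∑∉ w (λ x → F x * k) ≡⟨ ∑∉-*ʳ w k ⟩
    ∑∉ w F * k           ≡⟨ ℕₚ.*-comm _ k ⟩
    k * ∑∉ w F           ∎
    where open ≡-Reasoning

  ∑∉-δ : (w : Vec (Fin n) m) (y : Fin n) (R : Fin n → ℕ) →
         ∑∉ w (λ x → ⟦ y Finₚ.≟ x ⟧ * R x) ≡ ⟦ ¬? (y ∈? w) ⟧ * R y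
  ∑∉-δ {n} w y R = begin
    ∑∉ w (λ x → ⟦ y Finₚ.≟ x ⟧ * R x)
      ≡⟨ ∑-cong (allFin n) (λ x → trans (cong (λ d → ⟦ ¬? (x ∈? w) ⟧ * (d * R x)) (⟦⟧-⇔ (y Finₚ.≟ x) (x Finₚ.≟ y) sym sym))
                                        (x∙yz≈y∙xz ⟦ ¬? (x ∈? w) ⟧ ⟦ x Finₚ.≟ y ⟧ (R x))) ⟩
    ∑[ x ∈ allFin n ] (⟦ x Finₚ.≟ y ⟧ * (⟦ ¬? (x ∈? w) ⟧ * R x))
      ≡⟨ Enum.∑-δ (FinEnum n) y (λ x → ⟦ ¬? (x ∈? w) ⟧ * R x) ⟩
    ⟦ ¬? (y ∈? w) ⟧ * R y ∎
    where
    open ≡-Reasoning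

lookup-∷ʳ-inject₁ : (w : Vec A m) (x : A) (i : Fin m) → lookup (w ∷ʳ x) (inject₁ i) ≡ lookup w i
lookup-∷ʳ-inject₁ (y ∷ w) x zero    = refl
lookup-∷ʳ-inject₁ (y ∷ w) x (suc i) = lookup-∷ʳ-inject₁ w x i

lookup-∷ʳ-fromℕ : (w : Vec A m) (x : A) → lookup (w ∷ʳ x) (fromℕ m) ≡ x
lookup-∷ʳ-fromℕ []      x = refl
lookup-∷ʳ-fromℕ (y ∷ w) x = lookup-∷ʳ-fromℕ w x

Inj-∷ʳ⁺ : (w : Vec (Fin n) m) (x : Fin n) → Inj w → ¬ (x ∈ w) → Inj (w ∷ʳ x)
Inj-∷ʳ⁺ {m = m} w x inj x∉w i j eq with view i | view j
... | ‵fromℕ      | ‵fromℕ      = refl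
... | ‵fromℕ      | ‵inject₁ j = contradiction
      (j , trans (sym (lookup-∷ʳ-inject₁ w x j)) (trans (sym eq) (lookup-∷ʳ-fromℕ w x))) x∉w
... | ‵inject₁ i | ‵fromℕ      = contradiction
      (i , trans (sym (lookup-∷ʳ-inject₁ w x i)) (trans eq (lookup-∷ʳ-fromℕ w x))) x∉w
... | ‵inject₁ i | ‵inject₁ j = cong inject₁
      (inj i j (trans (sym (lookup-∷ʳ-inject₁ w x i)) (trans eq (lookup-∷ʳ-inject₁ w x j))))

Inj-∷ʳ⁻ : (w : Vec (Fin n) m) (x : Fin n) → Inj (w ∷ʳ x) → Inj w × ¬ (x ∈ w)
Inj-∷ʳ⁻ w x inj =
  (λ i j eq → Finₚ.inject₁-injective (inj (inject₁ i) (inject₁ j)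
    (trans (lookup-∷ʳ-inject₁ w x i) (trans eq (sym (lookup-∷ʳ-inject₁ w x j)))))) ,
  (λ (i , eq) → Finₚ.fromℕ≢inject₁ (inj (fromℕ _) (inject₁ i)
    (trans (lookup-∷ʳ-fromℕ w x) (sym (trans (lookup-∷ʳ-inject₁ w x i) eq)))))

opaque
  unfolding ∑Inj ∑∉

  ∑Inj-suc : (F : Vec (Fin n) (suc m) → ℕ) →
             ∑Inj n (suc m) F ≡ ∑Inj n m (λ w → ∑∉ w (λ x → F (w ∷ʳ x)))
  ∑Inj-suc {n} {m} F = begin
    ∑Inj n (suc m) F
      ≡⟨ ∑-allVecs-∷ʳ (λ w → ⟦ Inj? w ⟧ * F w) ⟩
    ∑[ w ∈ allVecs n m ] ∑[ x ∈ allFin n ] (⟦ Inj? (w ∷ʳ x) ⟧ * F (w ∷ʳ x))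
      ≡⟨ ∑-cong (allVecs n m) (λ w → trans (∑-cong (allFin n) (step w)) (∑-*ˡ (allFin n) ⟦ Inj? w ⟧)) ⟩
    ∑Inj n m (λ w → ∑∉ w (λ x → F (w ∷ʳ x))) ∎
    where
    open ≡-Reasoning
    step : ∀ w x → ⟦ Inj? (w ∷ʳ x) ⟧ * F (w ∷ʳ x) ≡ ⟦ Inj? w ⟧ * (⟦ ¬? (x ∈? w) ⟧ * F (w ∷ʳ x))
    step w x = begin
      ⟦ Inj? (w ∷ʳ x) ⟧ * F (w ∷ʳ x)
        ≡⟨ cong (_* F (w ∷ʳ x)) (⟦⟧-⇔ (Inj? (w ∷ʳ x)) (Inj? w ×-dec ¬? (x ∈? w))
             (Inj-∷ʳ⁻ w x) (λ (inj , x∉w) → Inj-∷ʳ⁺ w x inj x∉w)) ⟩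
      ⟦ Inj? w ×-dec ¬? (x ∈? w) ⟧ * F (w ∷ʳ x)
        ≡⟨ cong (_* F (w ∷ʳ x)) (⟦⟧-× (Inj? w) (¬? (x ∈? w))) ⟩
      ⟦ Inj? w ⟧ * ⟦ ¬? (x ∈? w) ⟧ * F (w ∷ʳ x)
        ≡⟨ ℕₚ.*-assoc ⟦ Inj? w ⟧ _ _ ⟩
      ⟦ Inj? w ⟧ * (⟦ ¬? (x ∈? w) ⟧ * F (w ∷ʳ x)) ∎

  ∑-⟦≟lookup⟧ : (w : Vec (Fin n) m) → Inj w → ∀ x → ∑[ i ∈ allFin m ] ⟦ x Finₚ.≟ lookup w i ⟧ ≡ ⟦ x ∈? w ⟧
  ∑-⟦≟lookup⟧ {m = m} w inj x with x ∈? w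
  ... | yes (j , refl) = trans
          (∑-cong (allFin m) (λ i → ⟦⟧-⇔ (lookup w j Finₚ.≟ lookup w i) (i Finₚ.≟ j) (λ eq → inj i j (sym eq)) (λ eq → cong (lookup w) (sym eq))))
          (Enum.once (FinEnum m) j)
  ... | no x∉w = trans
          (∑-cong (allFin m) (λ i → ⟦⟧-no (x Finₚ.≟ lookup w i) (λ eq → x∉w (i , sym eq))))
          (∑-zero (allFin m))

  -- By injectivity the indicators of the entries of `w` add up to the indicator of membership, so
  -- each `x` is either counted at one index or left to `∑∉`.
  ∑-split : (w : Vec (Fin n) m) → Inj w → (F : Fin n → ℕ) →
            ∑ (allFin n) F ≡ ∑[ i ∈ allFin m ] F (lookup w i) + ∑∉ w F
  ∑-split {n} {m} w inj F = begin
    ∑ (allFin n) F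
      ≡⟨ ∑-cong (allFin n) step ⟩
    ∑[ x ∈ allFin n ] (∑[ i ∈ allFin m ] (⟦ x Finₚ.≟ lookup w i ⟧ * F x) + ⟦ ¬? (x ∈? w) ⟧ * F x)
      ≡⟨ ∑-+ (allFin n) ⟩
    ∑[ x ∈ allFin n ] ∑[ i ∈ allFin m ] (⟦ x Finₚ.≟ lookup w i ⟧ * F x) + ∑∉ w F
      ≡⟨ cong (_+ ∑∉ w F) (∑-swap (allFin n) (allFin m)) ⟩
    ∑[ i ∈ allFin m ] ∑[ x ∈ allFin n ] (⟦ x Finₚ.≟ lookup w i ⟧ * F x) + ∑∉ w F
      ≡⟨ cong (_+ ∑∉ w F) (∑-cong (allFin m) (λ i → Enum.∑-δ (FinEnum n) (lookup w i) F)) ⟩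
    ∑[ i ∈ allFin m ] F (lookup w i) + ∑∉ w F ∎
    where
    open ≡-Reasoning
    step : ∀ x → F x ≡ ∑[ i ∈ allFin m ] (⟦ x Finₚ.≟ lookup w i ⟧ * F x) + ⟦ ¬? (x ∈? w) ⟧ * F x
    step x = sym (begin
      ∑[ i ∈ allFin m ] (⟦ x Finₚ.≟ lookup w i ⟧ * F x) + ⟦ ¬? (x ∈? w) ⟧ * F x
        ≡⟨ cong (_+ ⟦ ¬? (x ∈? w) ⟧ * F x) (∑-*ʳ (allFin m) (F x)) ⟩
      ∑[ i ∈ allFin m ] ⟦ x Finₚ.≟ lookup w i ⟧ * F x + ⟦ ¬? (x ∈? w) ⟧ * F x
        ≡⟨ ℕₚ.*-distribʳ-+ (F x) (∑[ i ∈ allFin m ] ⟦ x Finₚ.≟ lookup w i ⟧) _ ⟨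
      (∑[ i ∈ allFin m ] ⟦ x Finₚ.≟ lookup w i ⟧ + ⟦ ¬? (x ∈? w) ⟧) * F x
        ≡⟨ cong (λ k → (k + ⟦ ¬? (x ∈? w) ⟧) * F x) (∑-⟦≟lookup⟧ w inj x) ⟩
      (⟦ x ∈? w ⟧ + ⟦ ¬? (x ∈? w) ⟧) * F x
        ≡⟨ cong (_* F x) (⟦⟧+⟦¬⟧ (x ∈? w)) ⟩
      1 * F x
        ≡⟨ ℕₚ.*-identityˡ (F x) ⟩
      F x ∎)

∑-allFin-1 : ∀ n → ∑[ _ ∈ allFin n ] 1 ≡ n
∑-allFin-1 n = trans (sym (length-∑ (allFin n))) (Listₚ.length-tabulate id)

∑∉-1 : (w : Vec (Fin n) m) → Inj w → m + ∑∉ w (λ _ → 1) ≡ n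
∑∉-1 {n} {m} w inj = begin
  m + ∑∉ w (λ _ → 1)                       ≡⟨ cong (_+ ∑∉ w (λ _ → 1)) (∑-allFin-1 m) ⟨
  ∑[ _ ∈ allFin m ] 1 + ∑∉ w (λ _ → 1)     ≡⟨ ∑-split w inj (λ _ → 1) ⟨
  ∑[ _ ∈ allFin n ] 1                      ≡⟨ ∑-allFin-1 n ⟩
  n                                        ∎
  where open ≡-Reasoning

P-suc : ∀ n k → n P suc k ≡ (n P k) * (n ∸ k)
P-suc n k with ℕₚ.<-cmp k n
-- The library's `P` branches on a Boolean test of `k ≤ n`; the rewrites decide it for both sides.
... | tri< k<n _ _ rewrite dec-true (T? (suc k ≤ᵇ n)) (ℕₚ.≤⇒≤ᵇ k<n) | dec-true (T? (k ≤ᵇ n)) (ℕₚ.≤⇒≤ᵇ (ℕₚ.<⇒≤ k<n)) =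
  ℕₚ.*-comm (n ∸ k) _
... | tri≈ _ refl _ = trans (Comb.k>n⇒nPk≡0 (ℕₚ.n<1+n n)) (sym (trans (cong ((n P n) *_) (ℕₚ.n∸n≡0 n)) (ℕₚ.*-zeroʳ (n P n))))
... | tri> _ _ k>n  = trans (Comb.k>n⇒nPk≡0 (ℕₚ.m<n⇒m<1+n k>n)) (sym (cong (_* (n ∸ k)) (Comb.k>n⇒nPk≡0 k>n)))

∑Inj-1 : ∀ n m → ∑Inj n m (λ _ → 1) ≡ n P m
∑Inj-1 n zero    = ∑Inj-zero _
∑Inj-1 n (suc m) = begin
  ∑Inj n (suc m) (λ _ → 1)
    ≡⟨ ∑Inj-suc (λ _ → 1) ⟩
  ∑Inj n m (λ w → ∑∉ w (λ _ → 1))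
    ≡⟨ ∑Inj-cong (λ w inj → trans (trans (sym (ℕₚ.m+n∸m≡n m _)) (cong (_∸ m) (∑∉-1 w inj))) (sym (ℕₚ.*-identityˡ _))) ⟩
  ∑Inj n m (λ w → 1 * (n ∸ m))
    ≡⟨ ∑Inj-*ʳ (n ∸ m) ⟩
  ∑Inj n m (λ _ → 1) * (n ∸ m)
    ≡⟨ cong (_* (n ∸ m)) (∑Inj-1 n m) ⟩
  (n P m) * (n ∸ m)
    ≡⟨ P-suc n m ⟨
  n P suc m ∎
  where open ≡-Reasoning

permute : Permutation′ m → Vec A m → Vec A m
permute σ w = tabulate (λ i → lookup w (σ ⟨$⟩ʳ i))

permute-inverse : (σ : Permutation′ m) (w : Vec A m) → permute σ (permute (flip σ) w) ≡ w
permute-inverse σ w = trans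
  (Vecₚ.tabulate-cong (λ i → trans (Vecₚ.lookup∘tabulate _ (σ ⟨$⟩ʳ i)) (cong (lookup w) (inverseˡ σ))))
  (Vecₚ.tabulate∘lookup w)

Inj-permute : (σ : Permutation′ m) (w : Vec (Fin n) m) → Inj w → Inj (permute σ w)
Inj-permute σ w inj i j eq = trans (sym (inverseˡ σ)) (trans (cong (σ ⟨$⟩ˡ_) (inj _ _
  (trans (sym (Vecₚ.lookup∘tabulate _ i)) (trans eq (Vecₚ.lookup∘tabulate _ j))))) (inverseˡ σ))

∑-permute : (σ : Permutation′ m) (F : Vec (Fin n) m → ℕ) →
            ∑[ w ∈ allVecs n m ] F (permute σ w) ≡ ∑ (allVecs n m) F
∑-permute {m} {n} σ F = ∑-reindex (VecEnum n m) (VecEnum n m) (permute σ) (permute (flip σ))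
  (permute-inverse σ) (permute-inverse (flip σ)) F

opaque
  unfolding ∑Inj

  ∑Inj-∑ : (xs : List A) {F : A → Vec (Fin n) m → ℕ} →
           ∑Inj n m (λ w → ∑[ x ∈ xs ] F x w) ≡ ∑[ x ∈ xs ] ∑Inj n m (F x)
  ∑Inj-∑ {n = n} {m} xs {F} = trans
    (∑-cong (allVecs n m) (λ w → sym (∑-*ˡ xs ⟦ Inj? w ⟧)))
    (∑-swap (allVecs n m) xs)

  ∑Inj-permute : (σ : Permutation′ m) (F : Vec (Fin n) m → ℕ) →
                 ∑Inj n m (λ w → F (permute σ w)) ≡ ∑Inj n m F
  ∑Inj-permute {m} {n} σ F = trans
    (∑-cong (allVecs n m) (λ w → cong (_* F (permute σ w)) (⟦⟧-⇔ (Inj? w) (Inj? (permute σ w))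
      (Inj-permute σ w) (λ inj → subst Inj (permute-inverse (flip σ) w) (Inj-permute (flip σ) (permute σ w) inj)))))
    (∑-permute σ (λ w → ⟦ Inj? w ⟧ * F w))

-- Partial matches of an injective map

∑Inj-1-suc : (F : Vec (Fin n) 1 → ℕ) → ∑Inj n 1 F ≡ ∑[ a ∈ allFin n ] F (a ∷ [])
∑Inj-1-suc F = trans (∑Inj-suc F) (trans (∑Inj-zero _) (∑∉-[] _))

-- Each injective `m`-tuple has `n - m` extensions; the product with `m` stands on the left to avoid
-- subtraction.
∑Inj-free : (F : Vec (Fin n) m → ℕ) →
            ∑Inj n (suc m) (λ w → F (Vec.init w)) + m * ∑Inj n m F ≡ n * ∑Inj n m F
∑Inj-free {n} {m} F = begin
  ∑Inj n (suc m) (λ w → F (Vec.init w)) + m * ∑Inj n m F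
    ≡⟨ cong₂ _+_ (∑Inj-suc _) (trans (ℕₚ.*-comm m _) (sym (∑Inj-*ʳ m))) ⟩
  ∑Inj n m (λ w → ∑∉ w (λ x → F (Vec.init (w ∷ʳ x)))) + ∑Inj n m (λ w → F w * m)
    ≡⟨ ∑Inj-+ ⟨
  ∑Inj n m (λ w → ∑∉ w (λ x → F (Vec.init (w ∷ʳ x))) + F w * m)
    ≡⟨ ∑Inj-cong step ⟩
  ∑Inj n m (λ w → F w * n)
    ≡⟨ trans (∑Inj-*ʳ n) (ℕₚ.*-comm _ n) ⟩
  n * ∑Inj n m F ∎
  where
  open ≡-Reasoning
  step : ∀ w → Inj w → ∑∉ w (λ x → F (Vec.init (w ∷ʳ x))) + F w * m ≡ F w * n
  step w inj = begin
    ∑∉ w (λ x → F (Vec.init (w ∷ʳ x))) + F w * m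
      ≡⟨ cong (_+ F w * m) (∑∉-cong w (λ x _ → trans (cong F (Vecₚ.init-∷ʳ x w)) (sym (ℕₚ.*-identityʳ (F w))))) ⟩
    ∑∉ w (λ x → F w * 1) + F w * m ≡⟨ cong (_+ F w * m) (∑∉-*ˡ w (F w)) ⟩
    F w * ∑∉ w (λ _ → 1) + F w * m ≡⟨ ℕₚ.*-distribˡ-+ (F w) _ m ⟨
    F w * (∑∉ w (λ _ → 1) + m)     ≡⟨ cong (F w *_) (trans (ℕₚ.+-comm _ m) (∑∉-1 w inj)) ⟩
    F w * n                        ∎

-- ε w s x is the indicator of x being the s-th entry of w; s = 3 stands for all
-- values a₄, a₅, a₆ outside w at once.
ε : Vec (Fin n) 3 → Fin 4 → Fin n → ℕ
ε (a ∷ b ∷ c ∷ []) 0F x = ⟦ x Finₚ.≟ a ⟧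
ε (a ∷ b ∷ c ∷ []) 1F x = ⟦ x Finₚ.≟ b ⟧
ε (a ∷ b ∷ c ∷ []) 2F x = ⟦ x Finₚ.≟ c ⟧
ε (a ∷ b ∷ c ∷ []) 3F x = ⟦ ¬? (x ∈? (a ∷ b ∷ c ∷ [])) ⟧

-- Exchanging two positions also renames them as values; the outside symbol `3F` is unaffected.
swap₀₁ swap₁₂ : Fin 4 → Fin 4
swap₀₁ 0F = 1F
swap₀₁ 1F = 0F
swap₀₁ 2F = 2F
swap₀₁ 3F = 3F
swap₁₂ 0F = 0F
swap₁₂ 1F = 2F
swap₁₂ 2F = 1F
swap₁₂ 3F = 3F

∑-ε : (w : Vec (Fin n) 3) → Inj w → ∀ x → ε w 0F x + (ε w 1F x + (ε w 2F x + ε w 3F x)) ≡ 1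
∑-ε w@(a ∷ b ∷ c ∷ []) inj x = begin
  ⟦ x Finₚ.≟ a ⟧ + (⟦ x Finₚ.≟ b ⟧ + (⟦ x Finₚ.≟ c ⟧ + ⟦ ¬? (x ∈? w) ⟧))
    ≡⟨ assoc ⟦ x Finₚ.≟ a ⟧ ⟦ x Finₚ.≟ b ⟧ ⟦ x Finₚ.≟ c ⟧ ⟦ ¬? (x ∈? w) ⟧ ⟩
  ⟦ x Finₚ.≟ a ⟧ + (⟦ x Finₚ.≟ b ⟧ + (⟦ x Finₚ.≟ c ⟧ + 0)) + ⟦ ¬? (x ∈? w) ⟧
    ≡⟨ cong (_+ ⟦ ¬? (x ∈? w) ⟧) (∑-⟦≟lookup⟧ w inj x) ⟩
  ⟦ x ∈? w ⟧ + ⟦ ¬? (x ∈? w) ⟧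
    ≡⟨ ⟦⟧+⟦¬⟧ (x ∈? w) ⟩
  1 ∎
  where
  open ≡-Reasoning
  assoc : ∀ a b c d → a + (b + (c + d)) ≡ a + (b + (c + 0)) + d
  assoc = ℕ-Solver.solve-∀

≟-disjoint : {x y : Fin n} → x ≢ y → ∀ a → ⟦ x Finₚ.≟ a ⟧ * ⟦ y Finₚ.≟ a ⟧ ≡ 0
≟-disjoint {x = x} {y} x≢y a = ⟦⟧*-zero (x Finₚ.≟ a) (λ { refl → ⟦⟧-no (y Finₚ.≟ a) (x≢y ∘ sym) })

-- A single entry of `w` cannot equal two different values. The symbol `3F` is excluded through
-- `inject₁`, since many values may lie outside `w`.
ε-disjoint : (w : Vec (Fin n) 3) (s : Fin 3) {x y : Fin n} → x ≢ y → ε w (inject₁ s) x * ε w (inject₁ s) y ≡ 0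
ε-disjoint (a ∷ b ∷ c ∷ []) 0F x≢y = ≟-disjoint x≢y a
ε-disjoint (a ∷ b ∷ c ∷ []) 1F x≢y = ≟-disjoint x≢y b
ε-disjoint (a ∷ b ∷ c ∷ []) 2F x≢y = ≟-disjoint x≢y c

ε-swap₀₁ : ∀ (a b c : Fin n) s x → ε (b ∷ a ∷ c ∷ []) s x ≡ ε (a ∷ b ∷ c ∷ []) (swap₀₁ s) x
ε-swap₀₁ a b c 0F x = refl
ε-swap₀₁ a b c 1F x = refl
ε-swap₀₁ a b c 2F x = refl
ε-swap₀₁ a b c 3F x = ⟦⟧-⇔ (¬? (x ∈? (b ∷ a ∷ c ∷ []))) (¬? (x ∈? (a ∷ b ∷ c ∷ [])))
  (λ ∉ → λ { (0F , eq) → ∉ (1F , eq) ; (1F , eq) → ∉ (0F , eq) ; (2F , eq) → ∉ (2F , eq) })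
  (λ ∉ → λ { (0F , eq) → ∉ (1F , eq) ; (1F , eq) → ∉ (0F , eq) ; (2F , eq) → ∉ (2F , eq) })

ε-swap₁₂ : ∀ (a b c : Fin n) s x → ε (a ∷ c ∷ b ∷ []) s x ≡ ε (a ∷ b ∷ c ∷ []) (swap₁₂ s) x
ε-swap₁₂ a b c 0F x = refl
ε-swap₁₂ a b c 1F x = refl
ε-swap₁₂ a b c 2F x = refl
ε-swap₁₂ a b c 3F x = ⟦⟧-⇔ (¬? (x ∈? (a ∷ c ∷ b ∷ []))) (¬? (x ∈? (a ∷ b ∷ c ∷ [])))
  (λ ∉ → λ { (0F , eq) → ∉ (0F , eq) ; (1F , eq) → ∉ (2F , eq) ; (2F , eq) → ∉ (1F , eq) })
  (λ ∉ → λ { (0F , eq) → ∉ (0F , eq) ; (1F , eq) → ∉ (2F , eq) ; (2F , eq) → ∉ (1F , eq) })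

∑-distribʳ-4 : ∀ a b c d x → a + (b + (c + d)) ≡ 1 → a * x + (b * x + (c * x + d * x)) ≡ x
∑-distribʳ-4 a b c d x eq = trans (factor a b c d x) (trans (cong (_* x) eq) (ℕₚ.*-identityˡ x))
  where
  factor : ∀ a b c d x → a * x + (b * x + (c * x + d * x)) ≡ (a + (b + (c + d))) * x
  factor = ℕ-Solver.solve-∀

module PatternCounts {n : ℕ} (f : Fin n → Fin n) (f-inj : ∀ {x y} → f x ≡ f y → x ≡ y) where

  -- `E`, `E₂`, `E₁`, `E₀` constrain the images of three, two, one and none of the entries. As each
  -- image has exactly one of four symbols, each of the last three is a sum of four counts of the
  -- kind before it.
  E : Fin 4 → Fin 4 → Fin 4 → ℕ
  E s t u = ∑Inj n 3 (λ w → ε w s (f (lookup w 0F)) * (ε w t (f (lookup w 1F)) * ε w u (f (lookup w 2F))))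

  E₂ : Fin 4 → Fin 4 → ℕ
  E₂ s t = ∑Inj n 3 (λ w → ε w s (f (lookup w 0F)) * ε w t (f (lookup w 1F)))

  E₁ : Fin 4 → ℕ
  E₁ s = ∑Inj n 3 (λ w → ε w s (f (lookup w 0F)))

  E₀ : ℕ
  E₀ = ∑Inj n 3 (λ _ → 1)

  f-lookup-≢ : (w : Vec (Fin n) m) → Inj w → ∀ i j → i ≢ j → f (lookup w i) ≢ f (lookup w j)
  f-lookup-≢ w inj i j i≢j eq = i≢j (inj i j (f-inj eq))

  ∑Inj-4 : {F G H K R : Vec (Fin n) 3 → ℕ} → (∀ w → Inj w → F w + (G w + (H w + K w)) ≡ R w) →
           ∑Inj n 3 F + (∑Inj n 3 G + (∑Inj n 3 H + ∑Inj n 3 K)) ≡ ∑Inj n 3 R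
  ∑Inj-4 {F} {G} {H} {K} {R} eq = begin
    ∑Inj n 3 F + (∑Inj n 3 G + (∑Inj n 3 H + ∑Inj n 3 K))
      ≡⟨ cong (λ z → ∑Inj n 3 F + (∑Inj n 3 G + z)) ∑Inj-+ ⟨
    ∑Inj n 3 F + (∑Inj n 3 G + ∑Inj n 3 (λ w → H w + K w))
      ≡⟨ cong (∑Inj n 3 F +_) ∑Inj-+ ⟨
    ∑Inj n 3 F + ∑Inj n 3 (λ w → G w + (H w + K w))
      ≡⟨ ∑Inj-+ ⟨
    ∑Inj n 3 (λ w → F w + (G w + (H w + K w)))
      ≡⟨ ∑Inj-cong eq ⟩
    ∑Inj n 3 R ∎
    where open ≡-Reasoning

  ∑-E : ∀ s t → E s t 0F + (E s t 1F + (E s t 2F + E s t 3F)) ≡ E₂ s t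
  ∑-E s t = ∑Inj-4 (λ w inj → let x = f (lookup w 0F) ; y = f (lookup w 1F) ; z = f (lookup w 2F) in
    trans (regroup (ε w s x) (ε w t y) (ε w 0F z) (ε w 1F z) (ε w 2F z) (ε w 3F z))
          (∑-distribʳ-4 (ε w 0F z) (ε w 1F z) (ε w 2F z) (ε w 3F z) (ε w s x * ε w t y) (∑-ε w inj z)))
    where
    regroup : ∀ x y a b c d → x * (y * a) + (x * (y * b) + (x * (y * c) + x * (y * d))) ≡
                              a * (x * y) + (b * (x * y) + (c * (x * y) + d * (x * y)))
    regroup = ℕ-Solver.solve-∀

  ∑-E₂ : ∀ s → E₂ s 0F + (E₂ s 1F + (E₂ s 2F + E₂ s 3F)) ≡ E₁ s
  ∑-E₂ s = ∑Inj-4 (λ w inj → let x = f (lookup w 0F) ; y = f (lookup w 1F) in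
    trans (regroup (ε w s x) (ε w 0F y) (ε w 1F y) (ε w 2F y) (ε w 3F y))
          (∑-distribʳ-4 (ε w 0F y) (ε w 1F y) (ε w 2F y) (ε w 3F y) (ε w s x) (∑-ε w inj y)))
    where
    regroup : ∀ x a b c d → x * a + (x * b + (x * c + x * d)) ≡ a * x + (b * x + (c * x + d * x))
    regroup = ℕ-Solver.solve-∀

  ∑-E₁ : E₁ 0F + (E₁ 1F + (E₁ 2F + E₁ 3F)) ≡ E₀
  ∑-E₁ = ∑Inj-4 (λ w inj → ∑-ε w inj (f (lookup w 0F)))

  ∑Inj-0 : {F : Vec (Fin n) m → ℕ} → (∀ w → Inj w → F w ≡ 0) → ∑Inj n m F ≡ 0
  ∑Inj-0 {m} {F} eq = trans (∑Inj-cong {G = λ _ → 0 * 0} eq) (trans (∑Inj-*ʳ {m = m} 0 {λ _ → 0}) (ℕₚ.*-zeroʳ (∑Inj n m (λ _ → 0))))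

  E-conflict₁₃ : ∀ s t → E (inject₁ s) t (inject₁ s) ≡ 0
  E-conflict₁₃ s t = ∑Inj-0 (λ w inj → let y = f (lookup w 1F) in
    trans (x∙yz≈y∙xz (ε w (inject₁ s) _) (ε w t y) _)
          (trans (cong (ε w t y *_) (ε-disjoint w s (f-lookup-≢ w inj 0F 2F λ ()))) (ℕₚ.*-zeroʳ (ε w t y))))

  E-conflict₂₃ : ∀ s t → E t (inject₁ s) (inject₁ s) ≡ 0
  E-conflict₂₃ s t = ∑Inj-0 (λ w inj → let x = f (lookup w 0F) in
    trans (cong (ε w t x *_) (ε-disjoint w s (f-lookup-≢ w inj 1F 2F λ ()))) (ℕₚ.*-zeroʳ (ε w t x)))

  E₂-conflict : ∀ s → E₂ (inject₁ s) (inject₁ s) ≡ 0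
  E₂-conflict s = ∑Inj-0 (λ w inj → ε-disjoint w s (f-lookup-≢ w inj 0F 1F λ ()))

  -- Summing over the permuted tuple instead of `w` exchanges the first two images and renames the
  -- symbols; this makes the counts constant on orbits of simultaneous relabelling.
  E-swap₀₁ : ∀ s t u → E s t u ≡ E (swap₀₁ t) (swap₀₁ s) (swap₀₁ u)
  E-swap₀₁ s t u = trans (sym (∑Inj-permute (transpose 0F 1F) _)) (∑Inj-cong λ { (a ∷ b ∷ c ∷ []) _ →
    trans (cong₂ _*_ (ε-swap₀₁ a b c s (f b)) (cong₂ _*_ (ε-swap₀₁ a b c t (f a)) (ε-swap₀₁ a b c u (f c))))
          (x∙yz≈y∙xz (ε (a ∷ b ∷ c ∷ []) (swap₀₁ s) (f b)) (ε (a ∷ b ∷ c ∷ []) (swap₀₁ t) (f a)) _) })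

  E-swap₁₂ : ∀ s t u → E s t u ≡ E (swap₁₂ s) (swap₁₂ u) (swap₁₂ t)
  E-swap₁₂ s t u = trans (sym (∑Inj-permute (transpose 1F 2F) _)) (∑Inj-cong λ { (a ∷ b ∷ c ∷ []) _ →
    cong₂ _*_ (ε-swap₁₂ a b c s (f a)) (trans
      (cong₂ _*_ (ε-swap₁₂ a b c t (f c)) (ε-swap₁₂ a b c u (f b)))
      (ℕₚ.*-comm (ε (a ∷ b ∷ c ∷ []) (swap₁₂ t) (f c)) _)) })

  E₁-swap₁₂ : ∀ s → E₁ s ≡ E₁ (swap₁₂ s)
  E₁-swap₁₂ s = trans (sym (∑Inj-permute (transpose 1F 2F) _))
    (∑Inj-cong λ { (a ∷ b ∷ c ∷ []) _ → ε-swap₁₂ a b c s (f a) })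

  fix : Fin n → ℕ
  fix a = ⟦ f a Finₚ.≟ a ⟧

  arr : Fin n → Fin n → ℕ
  arr a b = ⟦ f a Finₚ.≟ b ⟧

  -- Points are counted, not cycles, whence the factors 2 and 3 against `q` and `r`. A point that is
  -- not fixed and returns after three steps lies on a 3-cycle, 3 being prime.
  fixedPoints twoCyclePoints threeCyclePoints : ℕ
  fixedPoints      = ∑ (allFin n) fix
  twoCyclePoints   = ∑[ a ∈ allFin n ] (⟦ ¬? (f a Finₚ.≟ a) ⟧ * ⟦ f (f a) Finₚ.≟ a ⟧)
  threeCyclePoints = ∑[ a ∈ allFin n ] (⟦ ¬? (f a Finₚ.≟ a) ⟧ * ⟦ f (f (f a)) Finₚ.≟ a ⟧)

  pairs₂ : (Fin n → Fin n → ℕ) → ℕ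
  pairs₂ G = ∑Inj n 2 (λ w → G (lookup w 0F) (lookup w 1F))

  pairs₂-nested : ∀ G → pairs₂ G ≡ ∑[ a ∈ allFin n ] ∑∉ (a ∷ []) (G a)
  pairs₂-nested G = trans (∑Inj-suc _) (∑Inj-1-suc _)

  free₃ : (G : Fin n → Fin n → ℕ) →
          ∑Inj n 3 (λ w → G (lookup w 0F) (lookup w 1F)) + 2 * pairs₂ G ≡ n * pairs₂ G
  free₃ G = trans (cong (_+ 2 * pairs₂ G) (∑Inj-cong λ { (a ∷ b ∷ c ∷ []) _ → refl }))
                  (∑Inj-free (λ w → G (lookup w 0F) (lookup w 1F)))

  free₂ : (G : Fin n → ℕ) → pairs₂ (λ a _ → G a) + ∑ (allFin n) G ≡ n * ∑ (allFin n) G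
  free₂ G = trans
    (cong₂ _+_ (∑Inj-cong λ { (a ∷ b ∷ []) _ → refl })
      (trans (sym (∑Inj-1-suc (λ w → G (lookup w 0F)))) (sym (ℕₚ.*-identityˡ _))))
    (trans (∑Inj-free (λ w → G (lookup w 0F))) (cong (n *_) (∑Inj-1-suc (λ w → G (lookup w 0F)))))

  last₃ : (F : Fin n → Fin n → Fin n → ℕ) →
          ∑Inj n 3 (λ w → F (lookup w 0F) (lookup w 1F) (lookup w 2F)) ≡
          ∑Inj n 2 (λ w → ∑∉ w (F (lookup w 0F) (lookup w 1F)))
  last₃ F = trans (∑Inj-suc _) (∑Inj-cong λ { (a ∷ b ∷ []) _ → refl })

  fix∉₁ : ∀ a → fix a + ∑∉ (a ∷ []) fix ≡ fixedPoints
  fix∉₁ a = sym (trans (∑-split (a ∷ []) (λ { 0F 0F _ → refl }) fix) (cong (_+ ∑∉ (a ∷ []) fix) (ℕₚ.+-identityʳ (fix a))))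

  fix∉₂ : ∀ a b → Inj (a ∷ b ∷ []) → fix a + (fix b + 0) + ∑∉ (a ∷ b ∷ []) fix ≡ fixedPoints
  fix∉₂ a b inj = sym (∑-split (a ∷ b ∷ []) inj fix)

  ⟦⟧-idem : {P : Set} (d : Dec P) → ⟦ d ⟧ * ⟦ d ⟧ ≡ ⟦ d ⟧
  ⟦⟧-idem (yes _) = refl
  ⟦⟧-idem (no _)  = refl

  fixedPairs : ℕ
  fixedPairs = pairs₂ (λ a b → fix a * fix b)

  -- This is p(p - 1) without subtraction: `fixedPoints` restores the diagonal pairs.
  fixedPairs-eq : fixedPairs + fixedPoints ≡ fixedPoints * fixedPoints
  fixedPairs-eq = begin
    fixedPairs + fixedPoints
      ≡⟨ cong (_+ fixedPoints) (trans (pairs₂-nested _) (∑-cong (allFin n) (λ a → ∑∉-*ˡ (a ∷ []) (fix a)))) ⟩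
    ∑[ a ∈ allFin n ] (fix a * ∑∉ (a ∷ []) fix) + fixedPoints
      ≡⟨ ∑-+ (allFin n) ⟨
    ∑[ a ∈ allFin n ] (fix a * ∑∉ (a ∷ []) fix + fix a)
      ≡⟨ ∑-cong (allFin n) step ⟩
    ∑[ a ∈ allFin n ] (fix a * fixedPoints)
      ≡⟨ ∑-*ʳ (allFin n) fixedPoints ⟩
    fixedPoints * fixedPoints ∎
    where
    open ≡-Reasoning
    step : ∀ a → fix a * ∑∉ (a ∷ []) fix + fix a ≡ fix a * fixedPoints
    step a = begin
      fix a * ∑∉ (a ∷ []) fix + fix a         ≡⟨ cong (fix a * ∑∉ (a ∷ []) fix +_) (⟦⟧-idem (f a Finₚ.≟ a)) ⟨
      fix a * ∑∉ (a ∷ []) fix + fix a * fix a ≡⟨ ℕₚ.*-distribˡ-+ (fix a) _ (fix a) ⟨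
      fix a * (∑∉ (a ∷ []) fix + fix a)       ≡⟨ cong (fix a *_) (trans (ℕₚ.+-comm _ (fix a)) (fix∉₁ a)) ⟩
      fix a * fixedPoints                     ∎

  pairs₂-*ʳ : ∀ k {F} → pairs₂ (λ a b → F a b * k) ≡ pairs₂ F * k
  pairs₂-*ʳ k = ∑Inj-*ʳ k

  -- The scheme of the corrected counts below: the third entry avoids `a` and `b`, and `G` supplies
  -- what this exclusion loses compared with the unrestricted `K`.
  last₃-eq : (F : Fin n → Fin n → Fin n → ℕ) {G K : Fin n → Fin n → ℕ} →
             (∀ a b → Inj (a ∷ b ∷ []) → ∑∉ (a ∷ b ∷ []) (F a b) + G a b ≡ K a b) →
             ∑Inj n 3 (λ w → F (lookup w 0F) (lookup w 1F) (lookup w 2F)) + pairs₂ G ≡ pairs₂ K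
  last₃-eq F {G} eq = trans (cong (_+ pairs₂ G) (last₃ F))
    (trans (sym ∑Inj-+) (∑Inj-cong λ { (a ∷ b ∷ []) inj → eq a b inj }))

  -- The third fixed point avoids the two already chosen, so each ordered pair of fixed points loses
  -- 2.
  E-012 : E 0F 1F 2F + fixedPairs * 2 ≡ fixedPairs * fixedPoints
  E-012 = trans (cong₂ _+_ (∑Inj-cong λ { (a ∷ b ∷ c ∷ []) _ → refl }) (sym (pairs₂-*ʳ 2 {λ a b → fix a * fix b})))
    (trans (last₃-eq (λ a b c → fix a * (fix b * fix c)) step) (pairs₂-*ʳ fixedPoints {λ a b → fix a * fix b}))
    where
    step : ∀ a b → Inj (a ∷ b ∷ []) → ∑∉ (a ∷ b ∷ []) (λ c → fix a * (fix b * fix c)) + fix a * fix b * 2 ≡ fix a * fix b * fixedPoints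
    step a b inj rewrite ∑∉-*ˡ (a ∷ b ∷ []) (fix a) {λ c → fix b * fix c} | ∑∉-*ˡ (a ∷ b ∷ []) (fix b) {fix}
      with f a Finₚ.≟ a | f b Finₚ.≟ b | fix∉₂ a b inj
    ... | no _  | _     | _  = refl
    ... | yes _ | no _  | _  = refl
    ... | yes _ | yes _ | eq = trans (shift (∑∉ (a ∷ b ∷ []) fix)) (trans eq (sym (ℕₚ.+-identityʳ _)))
      where
      shift : ∀ x → x + 0 + 0 + 2 ≡ 2 + x
      shift = ℕ-Solver.solve-∀

  E₂-01 : E₂ 0F 1F + 2 * fixedPairs ≡ n * fixedPairs
  E₂-01 = trans (cong (_+ 2 * fixedPairs) (∑Inj-cong λ { (a ∷ b ∷ c ∷ []) _ → refl })) (free₃ (λ a b → fix a * fix b))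

  fixedFree : ℕ
  fixedFree = pairs₂ (λ a _ → fix a)

  fixedFree-eq : fixedFree + fixedPoints ≡ n * fixedPoints
  fixedFree-eq = free₂ fix

  E₁-0 : E₁ 0F + 2 * fixedFree ≡ n * fixedFree
  E₁-0 = trans (cong (_+ 2 * fixedFree) (∑Inj-cong λ { (a ∷ b ∷ c ∷ []) _ → refl })) (free₃ (λ a b → fix a))

  arrows : ℕ
  arrows = pairs₂ arr

  ∉-[a] : (a x : Fin n) → ⟦ ¬? (x ∈? (a ∷ [])) ⟧ ≡ ⟦ ¬? (x Finₚ.≟ a) ⟧
  ∉-[a] a x = ⟦⟧-⇔ (¬? (x ∈? (a ∷ []))) (¬? (x Finₚ.≟ a))
    (λ x∉ x≡a → x∉ (0F , sym x≡a)) (λ x≢a → λ { (0F , a≡x) → x≢a (sym a≡x) })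

  ∉-[a,b]ˡ : (a b x : Fin n) → x ≢ a → ⟦ ¬? (x ∈? (a ∷ b ∷ [])) ⟧ ≡ ⟦ ¬? (x Finₚ.≟ b) ⟧
  ∉-[a,b]ˡ a b x x≢a = ⟦⟧-⇔ (¬? (x ∈? (a ∷ b ∷ []))) (¬? (x Finₚ.≟ b))
    (λ x∉ x≡b → x∉ (1F , sym x≡b)) (λ x≢b → λ { (0F , a≡x) → x≢a (sym a≡x) ; (1F , b≡x) → x≢b (sym b≡x) })

  ∉-[a,b]ʳ : (a b x : Fin n) → x ≢ b → ⟦ ¬? (x ∈? (a ∷ b ∷ [])) ⟧ ≡ ⟦ ¬? (x Finₚ.≟ a) ⟧
  ∉-[a,b]ʳ a b x x≢b = ⟦⟧-⇔ (¬? (x ∈? (a ∷ b ∷ []))) (¬? (x Finₚ.≟ a))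
    (λ x∉ x≡a → x∉ (0F , sym x≡a)) (λ x≢a → λ { (0F , a≡x) → x≢a (sym a≡x) ; (1F , b≡x) → x≢b (sym b≡x) })

  arrows-eq : arrows + fixedPoints ≡ n
  arrows-eq = begin
    arrows + fixedPoints
      ≡⟨ cong (_+ fixedPoints) (trans (pairs₂-nested _) (∑-cong (allFin n) step)) ⟩
    ∑[ a ∈ allFin n ] ⟦ ¬? (f a Finₚ.≟ a) ⟧ + fixedPoints
      ≡⟨ ∑-+ (allFin n) ⟨
    ∑[ a ∈ allFin n ] (⟦ ¬? (f a Finₚ.≟ a) ⟧ + fix a)
      ≡⟨ ∑-cong (allFin n) (λ a → trans (ℕₚ.+-comm _ (fix a)) (⟦⟧+⟦¬⟧ (f a Finₚ.≟ a))) ⟩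
    ∑[ _ ∈ allFin n ] 1
      ≡⟨ ∑-allFin-1 n ⟩
    n ∎
    where
    open ≡-Reasoning
    step : ∀ a → ∑∉ (a ∷ []) (arr a) ≡ ⟦ ¬? (f a Finₚ.≟ a) ⟧
    step a = begin
      ∑∉ (a ∷ []) (arr a)                ≡⟨ ∑∉-cong (a ∷ []) (λ x _ → ℕₚ.*-identityʳ (arr a x)) ⟨
      ∑∉ (a ∷ []) (λ x → arr a x * 1)    ≡⟨ ∑∉-δ (a ∷ []) (f a) (λ _ → 1) ⟩
      ⟦ ¬? (f a ∈? (a ∷ [])) ⟧ * 1       ≡⟨ ℕₚ.*-identityʳ _ ⟩
      ⟦ ¬? (f a ∈? (a ∷ [])) ⟧           ≡⟨ ∉-[a] a (f a) ⟩
      ⟦ ¬? (f a Finₚ.≟ a) ⟧              ∎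

  E₁-1 : E₁ 1F + 2 * arrows ≡ n * arrows
  E₁-1 = trans (cong (_+ 2 * arrows) (∑Inj-cong λ { (a ∷ b ∷ c ∷ []) _ → refl })) (free₃ arr)

  mutual₂ : pairs₂ (λ a b → arr a b * arr b a) ≡ twoCyclePoints
  mutual₂ = trans (pairs₂-nested _) (∑-cong (allFin n) λ a →
    trans (∑∉-δ (a ∷ []) (f a) (λ b → arr b a)) (cong (_* arr (f a) a) (∉-[a] a (f a))))

  E₂-10 : E₂ 1F 0F + 2 * twoCyclePoints ≡ n * twoCyclePoints
  E₂-10 = trans (cong₂ (λ x y → x + 2 * y) (∑Inj-cong λ { (a ∷ b ∷ c ∷ []) _ → refl }) (sym mutual₂))
    (trans (free₃ (λ a b → arr a b * arr b a)) (cong (n *_) mutual₂))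

  ∑∉-arr : (w : Vec (Fin n) m) (k : ℕ) (b : Fin n) → ∑∉ w (λ c → k * arr b c) ≡ k * ⟦ ¬? (f b ∈? w) ⟧
  ∑∉-arr w k b = begin
    ∑∉ w (λ c → k * arr b c)       ≡⟨ ∑∉-*ˡ w k ⟩
    k * ∑∉ w (arr b)               ≡⟨ cong (k *_) (∑∉-cong w (λ x _ → ℕₚ.*-identityʳ (arr b x))) ⟨
    k * ∑∉ w (λ c → arr b c * 1)   ≡⟨ cong (k *_) (∑∉-δ w (f b) (λ _ → 1)) ⟩
    k * (⟦ ¬? (f b ∈? w) ⟧ * 1)    ≡⟨ cong (k *_) (ℕₚ.*-identityʳ _) ⟩
    k * ⟦ ¬? (f b ∈? w) ⟧          ∎
    where open ≡-Reasoning

  -- The third entry must be `f b`, which is admissible unless it is `b`; it cannot be `a`, the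
  -- image of `a` itself.
  E₂-02 : E₂ 0F 2F + fixedPairs ≡ fixedFree
  E₂-02 = trans (cong (_+ fixedPairs) (∑Inj-cong λ { (a ∷ b ∷ c ∷ []) _ → refl }))
                (last₃-eq (λ a b c → fix a * arr b c) step)
    where
    step : ∀ a b → Inj (a ∷ b ∷ []) → ∑∉ (a ∷ b ∷ []) (λ c → fix a * arr b c) + fix a * fix b ≡ fix a
    step a b inj = begin
      ∑∉ (a ∷ b ∷ []) (λ c → fix a * arr b c) + fix a * fix b
        ≡⟨ cong (_+ fix a * fix b) (∑∉-arr (a ∷ b ∷ []) (fix a) b) ⟩
      fix a * ⟦ ¬? (f b ∈? (a ∷ b ∷ [])) ⟧ + fix a * fix b
        ≡⟨ ℕₚ.*-distribˡ-+ (fix a) _ (fix b) ⟨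
      fix a * (⟦ ¬? (f b ∈? (a ∷ b ∷ [])) ⟧ + fix b)
        ≡⟨ ⟦⟧*-cong (f a Finₚ.≟ a) (λ fa≡a → trans
             (cong (_+ fix b) (∉-[a,b]ˡ a b (f b) (λ fb≡a → f-lookup-≢ (a ∷ b ∷ []) inj 0F 1F (λ ()) (trans fa≡a (sym fb≡a)))))
             (trans (ℕₚ.+-comm _ (fix b)) (⟦⟧+⟦¬⟧ (f b Finₚ.≟ b)))) ⟩
      fix a * 1
        ≡⟨ ℕₚ.*-identityʳ (fix a) ⟩
      fix a ∎
      where open ≡-Reasoning

  -- The third entry must be `f b`. It differs from `b`, already the image of `a`, so the only
  -- failure is `f b` equal to `a`, a 2-cycle.
  E₂-12 : E₂ 1F 2F + twoCyclePoints ≡ arrows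
  E₂-12 = trans (cong₂ _+_ (∑Inj-cong λ { (a ∷ b ∷ c ∷ []) _ → refl }) (sym mutual₂))
                (last₃-eq (λ a b c → arr a b * arr b c) step)
    where
    step : ∀ a b → Inj (a ∷ b ∷ []) → ∑∉ (a ∷ b ∷ []) (λ c → arr a b * arr b c) + arr a b * arr b a ≡ arr a b
    step a b inj = begin
      ∑∉ (a ∷ b ∷ []) (λ c → arr a b * arr b c) + arr a b * arr b a
        ≡⟨ cong (_+ arr a b * arr b a) (∑∉-arr (a ∷ b ∷ []) (arr a b) b) ⟩
      arr a b * ⟦ ¬? (f b ∈? (a ∷ b ∷ [])) ⟧ + arr a b * arr b a
        ≡⟨ ℕₚ.*-distribˡ-+ (arr a b) _ (arr b a) ⟨
      arr a b * (⟦ ¬? (f b ∈? (a ∷ b ∷ [])) ⟧ + arr b a)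
        ≡⟨ ⟦⟧*-cong (f a Finₚ.≟ b) (λ fa≡b → trans
             (cong (_+ arr b a) (∉-[a,b]ʳ a b (f b) (λ fb≡b → f-lookup-≢ (a ∷ b ∷ []) inj 0F 1F (λ ()) (trans fa≡b (sym fb≡b)))))
             (trans (ℕₚ.+-comm _ (arr b a)) (⟦⟧+⟦¬⟧ (f b Finₚ.≟ a)))) ⟩
      arr a b * 1
        ≡⟨ ℕₚ.*-identityʳ (arr a b) ⟩
      arr a b ∎
      where open ≡-Reasoning

  -- No correction term arises: neither point of a 2-cycle is fixed, so every fixed point is
  -- available as third entry.
  E-102 : E 1F 0F 2F ≡ twoCyclePoints * fixedPoints
  E-102 = begin
    E 1F 0F 2F
      ≡⟨ ∑Inj-cong (λ { (a ∷ b ∷ c ∷ []) _ → refl }) ⟩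
    ∑Inj n 3 (λ w → F (lookup w 0F) (lookup w 1F) (lookup w 2F))
      ≡⟨ last₃ F ⟩
    ∑Inj n 2 (λ w → ∑∉ w (F (lookup w 0F) (lookup w 1F)))
      ≡⟨ ∑Inj-cong (λ { (a ∷ b ∷ []) inj → step a b inj }) ⟩
    pairs₂ (λ a b → arr a b * arr b a * fixedPoints)
      ≡⟨ pairs₂-*ʳ fixedPoints {λ a b → arr a b * arr b a} ⟩
    pairs₂ (λ a b → arr a b * arr b a) * fixedPoints
      ≡⟨ cong (_* fixedPoints) mutual₂ ⟩
    twoCyclePoints * fixedPoints ∎
    where
    open ≡-Reasoning
    F : Fin n → Fin n → Fin n → ℕ
    F a b c = arr a b * (arr b a * fix c)
    step : ∀ a b → Inj (a ∷ b ∷ []) → ∑∉ (a ∷ b ∷ []) (F a b) ≡ arr a b * arr b a * fixedPoints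
    step a b inj = begin
      ∑∉ (a ∷ b ∷ []) (F a b)
        ≡⟨ trans (∑∉-*ˡ (a ∷ b ∷ []) (arr a b)) (cong (arr a b *_) (∑∉-*ˡ (a ∷ b ∷ []) (arr b a))) ⟩
      arr a b * (arr b a * ∑∉ (a ∷ b ∷ []) fix)
        ≡⟨ ⟦⟧*-cong (f a Finₚ.≟ b) (λ fa≡b → ⟦⟧*-cong (f b Finₚ.≟ a) (λ fb≡a → trans
             (cong₂ (λ x y → x + (y + 0) + ∑∉ (a ∷ b ∷ []) fix)
               (sym (⟦⟧-no (f a Finₚ.≟ a) (λ fa≡a → case inj 0F 1F (trans (sym fa≡a) fa≡b) of λ ())))
               (sym (⟦⟧-no (f b Finₚ.≟ b) (λ fb≡b → case inj 0F 1F (trans (sym fb≡a) fb≡b) of λ ()))))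
             (fix∉₂ a b inj))) ⟩
      arr a b * (arr b a * fixedPoints)
        ≡⟨ ℕₚ.*-assoc (arr a b) (arr b a) fixedPoints ⟨
      arr a b * arr b a * fixedPoints ∎

  -- The whole triple is determined by `a`, as `b` and `c` are its first two iterates.
  E-120 : E 1F 2F 0F ≡ threeCyclePoints
  E-120 = begin
    E 1F 2F 0F
      ≡⟨ ∑Inj-cong (λ { (a ∷ b ∷ c ∷ []) _ → refl }) ⟩
    ∑Inj n 3 (λ w → F (lookup w 0F) (lookup w 1F) (lookup w 2F))
      ≡⟨ last₃ F ⟩
    ∑Inj n 2 (λ w → ∑∉ w (F (lookup w 0F) (lookup w 1F)))
      ≡⟨ ∑Inj-cong (λ { (a ∷ b ∷ []) inj → trans (∑∉-*ˡ (a ∷ b ∷ []) (arr a b))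
           (cong (arr a b *_) (∑∉-δ (a ∷ b ∷ []) (f b) (λ c → arr c a))) }) ⟩
    pairs₂ (λ a b → arr a b * (⟦ ¬? (f b ∈? (a ∷ b ∷ [])) ⟧ * arr (f b) a))
      ≡⟨ pairs₂-nested _ ⟩
    ∑[ a ∈ allFin n ] ∑∉ (a ∷ []) (λ b → arr a b * (⟦ ¬? (f b ∈? (a ∷ b ∷ [])) ⟧ * arr (f b) a))
      ≡⟨ ∑-cong (allFin n) (λ a → trans
           (∑∉-δ (a ∷ []) (f a) (λ b → ⟦ ¬? (f b ∈? (a ∷ b ∷ [])) ⟧ * arr (f b) a))
           (cong (_* (⟦ ¬? (f (f a) ∈? (a ∷ f a ∷ [])) ⟧ * ⟦ f (f (f a)) Finₚ.≟ a ⟧)) (∉-[a] a (f a)))) ⟩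
    ∑[ a ∈ allFin n ] (⟦ ¬? (f a Finₚ.≟ a) ⟧ * (⟦ ¬? (f (f a) ∈? (a ∷ f a ∷ [])) ⟧ * ⟦ f (f (f a)) Finₚ.≟ a ⟧))
      ≡⟨ ∑-cong (allFin n) (λ a → ⟦⟧*-cong (¬? (f a Finₚ.≟ a)) (step a)) ⟩
    threeCyclePoints ∎
    where
    open ≡-Reasoning
    F : Fin n → Fin n → Fin n → ℕ
    F a b c = arr a b * (arr b c * arr c a)
    step : ∀ a → f a ≢ a → ⟦ ¬? (f (f a) ∈? (a ∷ f a ∷ [])) ⟧ * ⟦ f (f (f a)) Finₚ.≟ a ⟧ ≡ ⟦ f (f (f a)) Finₚ.≟ a ⟧
    step a fa≢a = begin
      ⟦ ¬? (f (f a) ∈? (a ∷ f a ∷ [])) ⟧ * ⟦ f (f (f a)) Finₚ.≟ a ⟧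
        ≡⟨ ℕₚ.*-comm _ ⟦ f (f (f a)) Finₚ.≟ a ⟧ ⟩
      ⟦ f (f (f a)) Finₚ.≟ a ⟧ * ⟦ ¬? (f (f a) ∈? (a ∷ f a ∷ [])) ⟧
        -- If `f (f a)` were `a` or `f a`, the return after three steps or injectivity would make
        -- `a` fixed, so distinctness costs nothing.
        ≡⟨ ⟦⟧*-cong (f (f (f a)) Finₚ.≟ a) (λ fffa≡a → ⟦⟧-yes (¬? (f (f a) ∈? (a ∷ f a ∷ [])))
             λ { (0F , a≡ffa)  → fa≢a (trans (cong f a≡ffa) fffa≡a)
               ; (1F , fa≡ffa) → fa≢a (f-inj (sym fa≡ffa)) }) ⟩
      ⟦ f (f (f a)) Finₚ.≟ a ⟧ * 1
        ≡⟨ ℕₚ.*-identityʳ _ ⟩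
      ⟦ f (f (f a)) Finₚ.≟ a ⟧ ∎

  freePairs : ℕ
  freePairs = pairs₂ (λ _ _ → 1)

  freePairs-eq : freePairs + n ≡ n * n
  freePairs-eq = subst (λ k → freePairs + k ≡ n * k) (∑-allFin-1 n) (free₂ (λ _ → 1))

  E₀-eq : E₀ + 2 * freePairs ≡ n * freePairs
  E₀-eq = free₃ (λ _ _ → 1)

-- Evaluation of the counts as integer polynomials

toℤ : ℕ → ℤ
toℤ k = ℤ.+ k

ℤ-sub : ∀ {a b c : ℕ} {B C : ℤ} → a + b ≡ c → ℤ.+ b ≡ B → ℤ.+ c ≡ C → ℤ.+ a ≡ C ℤ.- B
ℤ-sub {a} {b} refl refl refl = sym (trans (cong (ℤ._- ℤ.+ b) (ℤₚ.pos-+ a b)) (cancel (ℤ.+ a) (ℤ.+ b)))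
  where
  cancel : ∀ x y → (x ℤ.+ y) ℤ.- y ≡ x
  cancel = ℤ-Solver.solve-∀

ℤ-* : ∀ a b {A B : ℤ} → ℤ.+ a ≡ A → ℤ.+ b ≡ B → ℤ.+ (a * b) ≡ A ℤ.* B
ℤ-* a b refl refl = ℤₚ.pos-* a b

-- The inclusion-exclusion step: the cases with the outside symbol are the total minus those with
-- the three inner symbols.
ℤ-last : ∀ {a b c d e : ℕ} {A B C E : ℤ} → a + (b + (c + d)) ≡ e →
         ℤ.+ a ≡ A → ℤ.+ b ≡ B → ℤ.+ c ≡ C → ℤ.+ e ≡ E → ℤ.+ d ≡ E ℤ.- A ℤ.- B ℤ.- C
ℤ-last {a} {b} {c} {d} refl refl refl refl refl = sym (begin
  ℤ.+ (a + (b + (c + d))) ℤ.- ℤ.+ a ℤ.- ℤ.+ b ℤ.- ℤ.+ c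
    ≡⟨ cong (λ z → z ℤ.- ℤ.+ a ℤ.- ℤ.+ b ℤ.- ℤ.+ c) (trans (ℤₚ.pos-+ a _) (cong (λ z → ℤ.+ a ℤ.+ z)
         (trans (ℤₚ.pos-+ b _) (cong (λ z → ℤ.+ b ℤ.+ z) (ℤₚ.pos-+ c d))))) ⟩
  (ℤ.+ a ℤ.+ (ℤ.+ b ℤ.+ (ℤ.+ c ℤ.+ ℤ.+ d))) ℤ.- ℤ.+ a ℤ.- ℤ.+ b ℤ.- ℤ.+ c
    ≡⟨ cancel (ℤ.+ a) (ℤ.+ b) (ℤ.+ c) (ℤ.+ d) ⟩
  ℤ.+ d ∎)
  where
  open ≡-Reasoning
  cancel : ∀ a b c d → (a ℤ.+ (b ℤ.+ (c ℤ.+ d))) ℤ.- a ℤ.- b ℤ.- c ≡ d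
  cancel = ℤ-Solver.solve-∀

module PatternValues {n : ℕ} (f : Fin n → Fin n) (f-inj : ∀ {x y} → f x ≡ f y → x ≡ y) (q r : ℕ)
  (two : PatternCounts.twoCyclePoints f f-inj ≡ 2 * q)
  (three : PatternCounts.threeCyclePoints f f-inj ≡ 3 * r) where

  open PatternCounts f f-inj
  open Data.Integer using (+_; -_) renaming (_+_ to _⊕_; _-_ to _⊖_; _*_ to _·_)

  𝑛 𝑝 𝑞 𝑟 : ℤ
  𝑛 = + n
  𝑝 = + fixedPoints
  𝑞 = + q
  𝑟 = + r

  -- The two transpositions generate all relabellings, so a word in them carries any triple to the
  -- representative of its class that is evaluated directly.
  swapᵗ : Bool → Fin 4 × Fin 4 × Fin 4 → Fin 4 × Fin 4 × Fin 4
  swapᵗ false (s , t , u) = swap₀₁ t , swap₀₁ s , swap₀₁ u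
  swapᵗ true  (s , t , u) = swap₁₂ s , swap₁₂ u , swap₁₂ t

  actᵗ : List Bool → Fin 4 × Fin 4 × Fin 4 → Fin 4 × Fin 4 × Fin 4
  actᵗ []       t = t
  actᵗ (x ∷ xs) t = actᵗ xs (swapᵗ x t)

  Eᵗ : Fin 4 × Fin 4 × Fin 4 → ℕ
  Eᵗ (s , t , u) = E s t u

  E-act : ∀ xs s t u → E s t u ≡ Eᵗ (actᵗ xs (s , t , u))
  E-act []           s t u = refl
  E-act (false ∷ xs) s t u = trans (E-swap₀₁ s t u) (E-act xs _ _ _)
  E-act (true ∷ xs)  s t u = trans (E-swap₁₂ s t u) (E-act xs _ _ _)

  0ᶻ : {a : ℕ} → a ≡ 0 → + a ≡ + 0
  0ᶻ = cong toℤ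

  V-two : + twoCyclePoints ≡ + 2 · 𝑞
  V-two = trans (cong toℤ two) (ℤ-* 2 q refl refl)

  V-three : + threeCyclePoints ≡ + 3 · 𝑟
  V-three = trans (cong toℤ three) (ℤ-* 3 r refl refl)

  V-fixedPairs : + fixedPairs ≡ 𝑝 · 𝑝 ⊖ 𝑝
  V-fixedPairs = ℤ-sub fixedPairs-eq refl (ℤ-* fixedPoints fixedPoints refl refl)

  V-fixedFree : + fixedFree ≡ 𝑛 · 𝑝 ⊖ 𝑝
  V-fixedFree = ℤ-sub fixedFree-eq refl (ℤ-* n fixedPoints refl refl)

  V-arrows : + arrows ≡ 𝑛 ⊖ 𝑝
  V-arrows = ℤ-sub arrows-eq refl refl

  V-freePairs : + freePairs ≡ 𝑛 · 𝑛 ⊖ 𝑛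
  V-freePairs = ℤ-sub freePairs-eq refl (ℤ-* n n refl refl)

  V₂-01 : + E₂ 0F 1F ≡ 𝑛 · (𝑝 · 𝑝 ⊖ 𝑝) ⊖ + 2 · (𝑝 · 𝑝 ⊖ 𝑝)
  V₂-01 = ℤ-sub E₂-01 (ℤ-* 2 fixedPairs refl V-fixedPairs) (ℤ-* n fixedPairs refl V-fixedPairs)

  V₂-10 : + E₂ 1F 0F ≡ 𝑛 · (+ 2 · 𝑞) ⊖ + 2 · (+ 2 · 𝑞)
  V₂-10 = ℤ-sub E₂-10 (ℤ-* 2 twoCyclePoints refl V-two) (ℤ-* n twoCyclePoints refl V-two)

  V₂-02 : + E₂ 0F 2F ≡ (𝑛 · 𝑝 ⊖ 𝑝) ⊖ (𝑝 · 𝑝 ⊖ 𝑝)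
  V₂-02 = ℤ-sub E₂-02 V-fixedPairs V-fixedFree

  V₂-12 : + E₂ 1F 2F ≡ (𝑛 ⊖ 𝑝) ⊖ + 2 · 𝑞
  V₂-12 = ℤ-sub E₂-12 V-two V-arrows

  V₁-0 : + E₁ 0F ≡ 𝑛 · (𝑛 · 𝑝 ⊖ 𝑝) ⊖ + 2 · (𝑛 · 𝑝 ⊖ 𝑝)
  V₁-0 = ℤ-sub E₁-0 (ℤ-* 2 fixedFree refl V-fixedFree) (ℤ-* n fixedFree refl V-fixedFree)

  V₁-1 : + E₁ 1F ≡ 𝑛 · (𝑛 ⊖ 𝑝) ⊖ + 2 · (𝑛 ⊖ 𝑝)
  V₁-1 = ℤ-sub E₁-1 (ℤ-* 2 arrows refl V-arrows) (ℤ-* n arrows refl V-arrows)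

  V₁-2 : + E₁ 2F ≡ 𝑛 · (𝑛 ⊖ 𝑝) ⊖ + 2 · (𝑛 ⊖ 𝑝)
  V₁-2 = trans (cong toℤ (E₁-swap₁₂ 2F)) V₁-1

  V₀ : + E₀ ≡ 𝑛 · (𝑛 · 𝑛 ⊖ 𝑛) ⊖ + 2 · (𝑛 · 𝑛 ⊖ 𝑛)
  V₀ = ℤ-sub E₀-eq (ℤ-* 2 freePairs refl V-freePairs) (ℤ-* n freePairs refl V-freePairs)

  V-012 : + E 0F 1F 2F ≡ H 3 1 𝑛 𝑝 𝑞 𝑟
  V-012 = trans (ℤ-sub E-012 (ℤ-* fixedPairs 2 V-fixedPairs refl) (ℤ-* fixedPairs fixedPoints V-fixedPairs refl)) (ring 𝑛 𝑝 𝑞 𝑟)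
    where
    ring : ∀ n p q r → (p · p ⊖ p) · p ⊖ (p · p ⊖ p) · + 2 ≡ (p · (p ⊕ - + 1) · (p ⊕ - + 2))
    ring = ℤ-Solver.solve-∀

  V-102 : + E 1F 0F 2F ≡ H 3 2 𝑛 𝑝 𝑞 𝑟
  V-102 = trans (cong toℤ E-102) (trans (ℤ-* twoCyclePoints fixedPoints V-two refl) (ring 𝑛 𝑝 𝑞 𝑟))
    where
    ring : ∀ n p q r → + 2 · q · p ≡ (+ 2 · p · q)
    ring = ℤ-Solver.solve-∀

  V-021 : + E 0F 2F 1F ≡ H 3 2 𝑛 𝑝 𝑞 𝑟
  V-021 = trans (cong toℤ (E-act (false ∷ true ∷ []) 0F 2F 1F)) V-102

  V-210 : + E 2F 1F 0F ≡ H 3 2 𝑛 𝑝 𝑞 𝑟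
  V-210 = trans (cong toℤ (E-act (true ∷ []) 2F 1F 0F)) V-102

  V-120 : + E 1F 2F 0F ≡ H 3 3 𝑛 𝑝 𝑞 𝑟
  V-120 = trans (cong toℤ E-120) V-three

  V-201 : + E 2F 0F 1F ≡ H 3 3 𝑛 𝑝 𝑞 𝑟
  V-201 = trans (cong toℤ (E-act (false ∷ []) 2F 0F 1F)) V-120

  -- For the last value the symbols `0F` and `1F` are already used and `2F` gives `V-012`; the rest
  -- of `E₂ 0F 1F` is the outside case. The other representatives with outside values are obtained
  -- alike.
  V-013 : + E 0F 1F 3F ≡ H 4 1 𝑛 𝑝 𝑞 𝑟
  V-013 = trans (ℤ-last (∑-E 0F 1F) (0ᶻ (E-conflict₁₃ 0F 1F)) (0ᶻ (E-conflict₂₃ 1F 0F)) V-012 V₂-01) (ring 𝑛 𝑝 𝑞 𝑟)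
    where
    ring : ∀ n p q r → n · (p · p ⊖ p) ⊖ + 2 · (p · p ⊖ p) ⊖ + 0 ⊖ + 0 ⊖ (p · (p ⊕ - + 1) · (p
         ⊕ - + 2)) ≡ (p · (p ⊕ - + 1) · (n ⊕ - p))
    ring = ℤ-Solver.solve-∀

  V-032 : + E 0F 3F 2F ≡ H 4 1 𝑛 𝑝 𝑞 𝑟
  V-032 = trans (cong toℤ (E-act (true ∷ []) 0F 3F 2F)) V-013

  V-312 : + E 3F 1F 2F ≡ H 4 1 𝑛 𝑝 𝑞 𝑟
  V-312 = trans (cong toℤ (E-act (false ∷ true ∷ []) 3F 1F 2F)) V-013

  V-103 : + E 1F 0F 3F ≡ H 4 2 𝑛 𝑝 𝑞 𝑟
  V-103 = trans (ℤ-last (∑-E 1F 0F) (0ᶻ (E-conflict₂₃ 0F 1F)) (0ᶻ (E-conflict₁₃ 1F 0F)) V-102 V₂-10) (ring 𝑛 𝑝 𝑞 𝑟)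
    where
    ring : ∀ n p q r → n · (+ 2 · q) ⊖ + 2 · (+ 2 · q) ⊖ + 0 ⊖ + 0 ⊖ (+ 2 · p · q) ≡ (+ 2 · q · (n ⊕ - p ⊕ - + 2))
    ring = ℤ-Solver.solve-∀

  V-230 : + E 2F 3F 0F ≡ H 4 2 𝑛 𝑝 𝑞 𝑟
  V-230 = trans (cong toℤ (E-act (true ∷ []) 2F 3F 0F)) V-103

  V-321 : + E 3F 2F 1F ≡ H 4 2 𝑛 𝑝 𝑞 𝑟
  V-321 = trans (cong toℤ (E-act (false ∷ true ∷ []) 3F 2F 1F)) V-103

  V-023 : + E 0F 2F 3F ≡ H 4 3 𝑛 𝑝 𝑞 𝑟
  V-023 = trans (ℤ-last (∑-E 0F 2F) (0ᶻ (E-conflict₁₃ 0F 2F)) V-021 (0ᶻ (E-conflict₂₃ 2F 0F)) V₂-02) (ring 𝑛 𝑝 𝑞 𝑟)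
    where
    ring : ∀ n p q r → (n · p ⊖ p) ⊖ (p · p ⊖ p) ⊖ + 0 ⊖ (+ 2 · p · q) ⊖ + 0 ≡ (p · (n ⊕ - p ⊕ - (+ 2 · q)))
    ring = ℤ-Solver.solve-∀

  V-031 : + E 0F 3F 1F ≡ H 4 3 𝑛 𝑝 𝑞 𝑟
  V-031 = trans (cong toℤ (E-act (true ∷ []) 0F 3F 1F)) V-023

  V-213 : + E 2F 1F 3F ≡ H 4 3 𝑛 𝑝 𝑞 𝑟
  V-213 = trans (cong toℤ (E-act (false ∷ []) 2F 1F 3F)) V-023

  V-310 : + E 3F 1F 0F ≡ H 4 3 𝑛 𝑝 𝑞 𝑟
  V-310 = trans (cong toℤ (E-act (false ∷ true ∷ []) 3F 1F 0F)) V-023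

  V-132 : + E 1F 3F 2F ≡ H 4 3 𝑛 𝑝 𝑞 𝑟
  V-132 = trans (cong toℤ (E-act (true ∷ false ∷ []) 1F 3F 2F)) V-023

  V-302 : + E 3F 0F 2F ≡ H 4 3 𝑛 𝑝 𝑞 𝑟
  V-302 = trans (cong toℤ (E-act (false ∷ true ∷ false ∷ []) 3F 0F 2F)) V-023

  V-123 : + E 1F 2F 3F ≡ H 4 4 𝑛 𝑝 𝑞 𝑟
  V-123 = trans (ℤ-last (∑-E 1F 2F) V-120 (0ᶻ (E-conflict₁₃ 1F 2F)) (0ᶻ (E-conflict₂₃ 2F 1F)) V₂-12) (ring 𝑛 𝑝 𝑞 𝑟)
    where
    ring : ∀ n p q r → (n ⊖ p) ⊖ + 2 · q ⊖ (+ 3 · r) ⊖ + 0 ⊖ + 0 ≡ (n ⊕ - p ⊕ - (+ 2 · q) ⊕ - (+ 3 · r))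
    ring = ℤ-Solver.solve-∀

  V-231 : + E 2F 3F 1F ≡ H 4 4 𝑛 𝑝 𝑞 𝑟
  V-231 = trans (cong toℤ (E-act (true ∷ []) 2F 3F 1F)) V-123

  V-203 : + E 2F 0F 3F ≡ H 4 4 𝑛 𝑝 𝑞 𝑟
  V-203 = trans (cong toℤ (E-act (false ∷ []) 2F 0F 3F)) V-123

  V-320 : + E 3F 2F 0F ≡ H 4 4 𝑛 𝑝 𝑞 𝑟
  V-320 = trans (cong toℤ (E-act (false ∷ true ∷ []) 3F 2F 0F)) V-123

  V-130 : + E 1F 3F 0F ≡ H 4 4 𝑛 𝑝 𝑞 𝑟
  V-130 = trans (cong toℤ (E-act (true ∷ false ∷ []) 1F 3F 0F)) V-123

  V-301 : + E 3F 0F 1F ≡ H 4 4 𝑛 𝑝 𝑞 𝑟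
  V-301 = trans (cong toℤ (E-act (false ∷ true ∷ false ∷ []) 3F 0F 1F)) V-123

  V₂-03 : + E₂ 0F 3F ≡ (𝑛 · (𝑛 · 𝑝 ⊖ 𝑝) ⊖ + 2 · (𝑛 · 𝑝 ⊖ 𝑝)) ⊖ + 0
            ⊖ (𝑛 · (𝑝 · 𝑝 ⊖ 𝑝) ⊖ + 2 · (𝑝 · 𝑝 ⊖ 𝑝)) ⊖ ((𝑛 · 𝑝 ⊖ 𝑝) ⊖ (𝑝 · 𝑝 ⊖ 𝑝))
  V₂-03 = ℤ-last (∑-E₂ 0F) (0ᶻ (E₂-conflict 0F)) V₂-01 V₂-02 V₁-0

  V-033 : + E 0F 3F 3F ≡ H 5 1 𝑛 𝑝 𝑞 𝑟
  V-033 = trans (ℤ-last (∑-E 0F 3F) (0ᶻ (E-conflict₁₃ 0F 3F)) V-031 V-032 V₂-03) (ring 𝑛 𝑝 𝑞 𝑟)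
    where
    ring : ∀ n p q r → (n · (n · p ⊖ p) ⊖ + 2 · (n · p ⊖ p)) ⊖ + 0
             ⊖ (n · (p · p ⊖ p) ⊖ + 2 · (p · p ⊖ p)) ⊖ ((n · p ⊖ p) ⊖ (p · p ⊖ p))
             ⊖ + 0 ⊖ (p · (n ⊕ - p ⊕ - (+ 2 · q))) ⊖ (p · (p ⊕ - + 1) · (n ⊕ - p)) ≡ (p · p · p ⊕ + 3 · p · p
             ⊕ + 2 · p · q ⊕ - (n · (+ 2 · p · p ⊕ + 3 · p)) ⊕ n · n · p)
    ring = ℤ-Solver.solve-∀

  V-313 : + E 3F 1F 3F ≡ H 5 1 𝑛 𝑝 𝑞 𝑟
  V-313 = trans (cong toℤ (E-act (false ∷ []) 3F 1F 3F)) V-033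

  V-332 : + E 3F 3F 2F ≡ H 5 1 𝑛 𝑝 𝑞 𝑟
  V-332 = trans (cong toℤ (E-act (true ∷ false ∷ []) 3F 3F 2F)) V-033

  V₂-13 : + E₂ 1F 3F ≡ (𝑛 · (𝑛 ⊖ 𝑝) ⊖ + 2 · (𝑛 ⊖ 𝑝)) ⊖ (𝑛 · (+ 2 · 𝑞) ⊖ + 2 · (+ 2 · 𝑞))
            ⊖ + 0 ⊖ ((𝑛 ⊖ 𝑝) ⊖ + 2 · 𝑞)
  V₂-13 = ℤ-last (∑-E₂ 1F) V₂-10 (0ᶻ (E₂-conflict 1F)) V₂-12 V₁-1

  V-133 : + E 1F 3F 3F ≡ H 5 2 𝑛 𝑝 𝑞 𝑟
  V-133 = trans (ℤ-last (∑-E 1F 3F) V-130 (0ᶻ (E-conflict₁₃ 1F 3F)) V-132 V₂-13) (ring 𝑛 𝑝 𝑞 𝑟)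
    where
    ring : ∀ n p q r → (n · (n ⊖ p) ⊖ + 2 · (n ⊖ p)) ⊖ (n · (+ 2 · q) ⊖ + 2 · (+ 2 · q))
             ⊖ + 0 ⊖ ((n ⊖ p) ⊖ + 2 · q)
             ⊖ (n ⊕ - p ⊕ - (+ 2 · q) ⊕ - (+ 3 · r)) ⊖ + 0 ⊖ (p · (n ⊕ - p ⊕ - (+ 2 · q))) ≡ (p · p ⊕ + 4 · p
             ⊕ + 2 · p · q ⊕ + 8 · q ⊕ + 3 · r ⊕ - (n · (+ 2 · p ⊕ + 2 · q ⊕ + 4)) ⊕ n · n)
    ring = ℤ-Solver.solve-∀

  V-233 : + E 2F 3F 3F ≡ H 5 2 𝑛 𝑝 𝑞 𝑟
  V-233 = trans (cong toℤ (E-act (true ∷ []) 2F 3F 3F)) V-133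

  V-303 : + E 3F 0F 3F ≡ H 5 2 𝑛 𝑝 𝑞 𝑟
  V-303 = trans (cong toℤ (E-act (false ∷ []) 3F 0F 3F)) V-133

  V-323 : + E 3F 2F 3F ≡ H 5 2 𝑛 𝑝 𝑞 𝑟
  V-323 = trans (cong toℤ (E-act (false ∷ true ∷ []) 3F 2F 3F)) V-133

  V-330 : + E 3F 3F 0F ≡ H 5 2 𝑛 𝑝 𝑞 𝑟
  V-330 = trans (cong toℤ (E-act (true ∷ false ∷ []) 3F 3F 0F)) V-133

  V-331 : + E 3F 3F 1F ≡ H 5 2 𝑛 𝑝 𝑞 𝑟
  V-331 = trans (cong toℤ (E-act (false ∷ true ∷ false ∷ []) 3F 3F 1F)) V-133

  -- With the first value outside, `E₂ 3F s` has no direct count; it is reassembled from the four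
  -- entries `E 3F s u`, known already by relabelling.
  V₂-3 : ∀ {s a b c d A B C D} → E 3F s 0F ≡ a → E 3F s 1F ≡ b → E 3F s 2F ≡ c → E 3F s 3F ≡ d →
         + a ≡ A → + b ≡ B → + c ≡ C → + d ≡ D → + E₂ 3F s ≡ A ⊕ (B ⊕ (C ⊕ D))
  V₂-3 {s} {a} {b} {c} {d} refl refl refl refl refl refl refl refl = trans (cong toℤ (sym (∑-E 3F s)))
    (trans (ℤₚ.pos-+ a _) (cong (λ z → + a ⊕ z) (trans (ℤₚ.pos-+ b _) (cong (λ z → + b ⊕ z) (ℤₚ.pos-+ c d)))))

  V-333 : + E 3F 3F 3F ≡ H 6 1 𝑛 𝑝 𝑞 𝑟
  -- Three nested remainders: `E₁ 3F` from `E₀`, then `E₂ 3F 3F` from `E₁ 3F`, then `E 3F 3F 3F`.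
  V-333 = trans (ℤ-last (∑-E 3F 3F) V-330 V-331 V-332
      (ℤ-last (∑-E₂ 3F)
        (V₂-3 refl refl refl refl (0ᶻ (E-conflict₂₃ 0F 3F)) V-301 V-302 V-303)
        (V₂-3 refl refl refl refl V-310 (0ᶻ (E-conflict₂₃ 1F 3F)) V-312 V-313)
        (V₂-3 refl refl refl refl V-320 V-321 (0ᶻ (E-conflict₂₃ 2F 3F)) V-323)
        (ℤ-last ∑-E₁ V₁-0 V₁-1 V₁-2 V₀))) (ring 𝑛 𝑝 𝑞 𝑟)
    where
    ring : ∀ n p q r →
      (n · (n · n ⊖ n) ⊖ + 2 · (n · n ⊖ n))
        ⊖ (n · (n · p ⊖ p) ⊖ + 2 · (n · p ⊖ p))
        ⊖ (n · (n ⊖ p) ⊖ + 2 · (n ⊖ p)) ⊖ (n · (n ⊖ p) ⊖ + 2 · (n ⊖ p))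
        ⊖ (+ 0 ⊕ ((n ⊕ - p ⊕ - (+ 2 · q) ⊕ - (+ 3 · r)) ⊕ ((p · (n ⊕ - p ⊕ - (+ 2 · q))) ⊕ (p · p ⊕ + 4 · p
         ⊕ + 2 · p · q ⊕ + 8 · q ⊕ + 3 · r ⊕ - (n · (+ 2 · p ⊕ + 2 · q ⊕ + 4)) ⊕ n · n))))
        ⊖ ((p · (n ⊕ - p ⊕ - (+ 2 · q))) ⊕ (+ 0 ⊕ ((p · (p ⊕ - + 1) · (n ⊕ - p)) ⊕ (p · p · p ⊕ + 3 · p · p
         ⊕ + 2 · p · q ⊕ - (n · (+ 2 · p · p ⊕ + 3 · p)) ⊕ n · n · p))))
        ⊖ ((n ⊕ - p ⊕ - (+ 2 · q) ⊕ - (+ 3 · r)) ⊕ ((+ 2 · q · (n ⊕ - p ⊕ - + 2)) ⊕ (+ 0 ⊕ (p · p ⊕ + 4 · p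
         ⊕ + 2 · p · q ⊕ + 8 · q ⊕ + 3 · r ⊕ - (n · (+ 2 · p ⊕ + 2 · q ⊕ + 4)) ⊕ n · n))))
        ⊖ (p · p ⊕ + 4 · p ⊕ + 2 · p · q ⊕ + 8 · q ⊕ + 3 · r ⊕ - (n · (+ 2 · p ⊕ + 2 · q ⊕ + 4)) ⊕ n · n)
         ⊖ (p · p ⊕ + 4 · p ⊕ + 2 · p · q ⊕ + 8 · q ⊕ + 3 · r ⊕ - (n · (+ 2 · p ⊕ + 2 · q ⊕ + 4)) ⊕ n · n)
         ⊖ (p · p · p ⊕ + 3 · p · p ⊕ + 2 · p · q ⊕ - (n · (+ 2 · p · p ⊕ + 3 · p))
         ⊕ n · n · p) ≡ (- (p · p · p) ⊕ - (+ 9 · p · p) ⊕ - (+ 20 · p) ⊕ - (+ 6 · p · q) ⊕ - (+ 24 · q)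
         ⊕ - (+ 6 · r) ⊕ n · (+ 3 · p · p ⊕ + 18 · p ⊕ + 6 · q ⊕ + 20) ⊕ - (n · n · (+ 3 · p ⊕ + 9)) ⊕ n · n · n)
    ring = ℤ-Solver.solve-∀

-- The classes of triples

-- Indexed by plain numbers, as `rank` and `triClass` are; beyond the length it returns 0, a default
-- that `WellFormed` excludes.
at : Vec (Fin n) m → ℕ → ℕ
at w s = nth (map toℕ (toList w)) s

at-lookup : (w : Vec (Fin n) m) (i : Fin m) → at w (toℕ i) ≡ toℕ (lookup w i)
at-lookup (x ∷ w) zero    = refl
at-lookup (x ∷ w) (suc i) = at-lookup w i

Triple : Set
Triple = ℕ × ℕ × ℕ

hits : (X Y Z : ℕ) → Vec (Fin n) m → Triple → ℕ
hits X Y Z w (x , y , z) = ⟦ X ℕₚ.≟ at w x ⟧ * (⟦ Y ℕₚ.≟ at w y ⟧ * ⟦ Z ℕₚ.≟ at w z ⟧)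

-- The indicator of π_{i₁} = x, π_{i₂} = y, π_{i₃} = z, where w lists the values of i₁, i₂, i₃, a₄, …
match : Vec (Fin n) n → Vec (Fin n) m → Triple → ℕ
match π w = hits (at π (at w 0)) (at π (at w 1)) (at π (at w 2)) w

sizes : List ℕ
sizes = 3 ∷ 4 ∷ 5 ∷ 6 ∷ []

labels : ℕ → List ℕ
labels j = map suc (upTo (L j))

-- Nested in the same way as `∑class`, so that the 34 triples can be treated one by one and then
-- summed.
AllClass : (ℕ → ℕ → Triple → Set) → Set
AllClass P = All (λ j → All (λ ℓ → All (P j ℓ) (triClass j ℓ)) (labels j)) sizes

mapClass : {P R : ℕ → ℕ → Triple → Set} → (∀ {j ℓ t} → P j ℓ t → R j ℓ t) → AllClass P → AllClass R
mapClass f = All.map (All.map (All.map f))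

zipClass : {P Q R : ℕ → ℕ → Triple → Set} → (∀ {j ℓ t} → P j ℓ t → Q j ℓ t → R j ℓ t) →
           AllClass P → AllClass Q → AllClass R
zipClass f ps qs = All.zipWith (λ (ps , qs) → All.zipWith (λ (ps , qs) → All.zipWith (λ (p , q) → f p q)
  (ps , qs)) (ps , qs)) (ps , qs)

universalClass : {P : ℕ → ℕ → Triple → Set} → (∀ {j ℓ} t → P j ℓ t) → AllClass P
universalClass p = All.universal (λ j → All.universal (λ ℓ → All.universal p _) _) _

∑-cong-All : {xs : List A} {f g : A → ℕ} → All (λ x → f x ≡ g x) xs → ∑ xs f ≡ ∑ xs g
∑-cong-All []         = refl
∑-cong-All (eq ∷ eqs) = cong₂ _+_ eq (∑-cong-All eqs)

opaque
  ∑class : (ℕ → ℕ → Triple → ℕ) → ℕ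
  ∑class f = ∑[ j ∈ sizes ] ∑[ ℓ ∈ labels j ] ∑[ t ∈ triClass j ℓ ] f j ℓ t

  ∑class-def : ∀ f → ∑class f ≡ ∑[ j ∈ sizes ] ∑[ ℓ ∈ labels j ] ∑[ t ∈ triClass j ℓ ] f j ℓ t
  ∑class-def f = refl

  ∑class-cong : {f g : ℕ → ℕ → Triple → ℕ} → AllClass (λ j ℓ t → f j ℓ t ≡ g j ℓ t) → ∑class f ≡ ∑class g
  ∑class-cong eqs = ∑-cong-All (All.map (λ eqs → ∑-cong-All (All.map ∑-cong-All eqs)) eqs)

  ∑class-∑ : (xs : List A) {f : ℕ → ℕ → Triple → A → ℕ} →
             ∑[ x ∈ xs ] ∑class (λ j ℓ t → f j ℓ t x) ≡ ∑class (λ j ℓ t → ∑ xs (f j ℓ t))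
  ∑class-∑ xs {f} = begin
    ∑[ x ∈ xs ] ∑[ j ∈ sizes ] ∑[ ℓ ∈ labels j ] ∑[ t ∈ triClass j ℓ ] f j ℓ t x
      ≡⟨ ∑-swap xs sizes {λ x j → ∑[ ℓ ∈ labels j ] ∑[ t ∈ triClass j ℓ ] f j ℓ t x} ⟩
    ∑[ j ∈ sizes ] ∑[ x ∈ xs ] ∑[ ℓ ∈ labels j ] ∑[ t ∈ triClass j ℓ ] f j ℓ t x
      ≡⟨ ∑-cong sizes (λ j → ∑-swap xs (labels j) {λ x ℓ → ∑[ t ∈ triClass j ℓ ] f j ℓ t x}) ⟩
    ∑[ j ∈ sizes ] ∑[ ℓ ∈ labels j ] ∑[ x ∈ xs ] ∑[ t ∈ triClass j ℓ ] f j ℓ t x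
      ≡⟨ ∑-cong sizes (λ j → ∑-cong (labels j) (λ ℓ → ∑-swap xs (triClass j ℓ) {λ x t → f j ℓ t x})) ⟩
    ∑[ j ∈ sizes ] ∑[ ℓ ∈ labels j ] ∑[ t ∈ triClass j ℓ ] ∑[ x ∈ xs ] f j ℓ t x ∎
    where open ≡-Reasoning

  ∑class-*ʳ : (k : ℕ) {f : ℕ → ℕ → Triple → ℕ} → ∑class (λ j ℓ t → f j ℓ t * k) ≡ ∑class f * k
  ∑class-*ʳ k {f} = begin
    ∑[ j ∈ sizes ] ∑[ ℓ ∈ labels j ] ∑[ t ∈ triClass j ℓ ] (f j ℓ t * k)
      ≡⟨ ∑-cong sizes (λ j → ∑-cong (labels j) (λ ℓ → ∑-*ʳ (triClass j ℓ) k {f j ℓ})) ⟩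
    ∑[ j ∈ sizes ] ∑[ ℓ ∈ labels j ] (∑[ t ∈ triClass j ℓ ] f j ℓ t * k)
      ≡⟨ ∑-cong sizes (λ j → ∑-*ʳ (labels j) k {λ ℓ → ∑[ t ∈ triClass j ℓ ] f j ℓ t}) ⟩
    ∑[ j ∈ sizes ] (∑[ ℓ ∈ labels j ] ∑[ t ∈ triClass j ℓ ] f j ℓ t * k)
      ≡⟨ ∑-*ʳ sizes k {λ j → ∑[ ℓ ∈ labels j ] ∑[ t ∈ triClass j ℓ ] f j ℓ t} ⟩
    ∑class f * k ∎
    where open ≡-Reasoning

  ∑class-*ˡ : (k : ℕ) {f : ℕ → ℕ → Triple → ℕ} → ∑class (λ j ℓ t → k * f j ℓ t) ≡ k * ∑class f
  ∑class-*ˡ k {f} = trans (∑class-cong (universalClass (λ {j} {ℓ} t → ℕₚ.*-comm k (f j ℓ t))))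
    (trans (∑class-*ʳ k {f}) (ℕₚ.*-comm _ k))

  ∑Inj-∑class : {F : ℕ → ℕ → Triple → Vec (Fin n) m → ℕ} →
                ∑Inj n m (λ w → ∑class (λ j ℓ t → F j ℓ t w)) ≡ ∑class (λ j ℓ t → ∑Inj n m (F j ℓ t))
  ∑Inj-∑class {n} {m} {F} = begin
    ∑Inj n m (λ w → ∑[ j ∈ sizes ] ∑[ ℓ ∈ labels j ] ∑[ t ∈ triClass j ℓ ] F j ℓ t w)
      ≡⟨ ∑Inj-∑ sizes {λ j w → ∑[ ℓ ∈ labels j ] ∑[ t ∈ triClass j ℓ ] F j ℓ t w} ⟩
    ∑[ j ∈ sizes ] ∑Inj n m (λ w → ∑[ ℓ ∈ labels j ] ∑[ t ∈ triClass j ℓ ] F j ℓ t w)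
      ≡⟨ ∑-cong sizes (λ j → ∑Inj-∑ (labels j) {λ ℓ w → ∑[ t ∈ triClass j ℓ ] F j ℓ t w}) ⟩
    ∑[ j ∈ sizes ] ∑[ ℓ ∈ labels j ] ∑Inj n m (λ w → ∑[ t ∈ triClass j ℓ ] F j ℓ t w)
      ≡⟨ ∑-cong sizes (λ j → ∑-cong (labels j) (λ ℓ → ∑Inj-∑ (triClass j ℓ) {F j ℓ})) ⟩
    ∑class (λ j ℓ t → ∑Inj n m (F j ℓ t)) ∎
    where open ≡-Reasoning

-- The sum over the j − 3 further distinct entries (junk for j ∉ {3,…,6}).
∑Rest : (j : ℕ) → Vec (Fin n) 3 → (Vec (Fin n) j → ℕ) → ℕ
∑Rest 3 w F = F w
∑Rest 4 w F = ∑∉ w (λ d → F (w ∷ʳ d))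
∑Rest 5 w F = ∑∉ w (λ d → ∑∉ (w ∷ʳ d) (λ e → F (w ∷ʳ d ∷ʳ e)))
∑Rest 6 w F = ∑∉ w (λ d → ∑∉ (w ∷ʳ d) (λ e → ∑∉ (w ∷ʳ d ∷ʳ e) (λ g → F (w ∷ʳ d ∷ʳ e ∷ʳ g))))
∑Rest _ w F = 0

∑Inj-Rest : All (λ j → (F : Vec (Fin n) j → ℕ) → ∑Inj n j F ≡ ∑Inj n 3 (λ w → ∑Rest j w F)) sizes
∑Inj-Rest =
  (λ F → refl) ∷
  (λ F → ∑Inj-suc F) ∷
  (λ F → trans (∑Inj-suc F) (∑Inj-suc _)) ∷
  (λ F → trans (∑Inj-suc F) (trans (∑Inj-suc _) (∑Inj-suc _))) ∷ []

∑Inj-Rest-class : AllClass (λ j ℓ t → (F : Vec (Fin n) j → ℕ) → ∑Inj n j F ≡ ∑Inj n 3 (λ w → ∑Rest j w F))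
∑Inj-Rest-class = All.map (λ eq → All.universal (λ _ → All.universal (λ _ → eq) _) _) ∑Inj-Rest

-- The symbols `3`, `4`, `5` all stand for a value outside i₁, i₂, i₃; that these values are
-- distinct is automatic under an injection.
symbol : ℕ → Fin 4
symbol 0 = 0F
symbol 1 = 1F
symbol 2 = 2F
symbol _ = 3F

symbols : Triple → Fin 4 × Fin 4 × Fin 4
symbols (x , y , z) = symbol x , symbol y , symbol z

≟-toℕ : (x y : Fin n) → ⟦ toℕ x ℕₚ.≟ toℕ y ⟧ ≡ ⟦ x Finₚ.≟ y ⟧
≟-toℕ x y = ⟦⟧-⇔ (toℕ x ℕₚ.≟ toℕ y) (x Finₚ.≟ y) Finₚ.toℕ-injective (cong toℕ)

∉-∷ʳ : (w : Vec (Fin n) m) {x y : Fin n} → y ≢ x → ⟦ ¬? (y ∈? (w ∷ʳ x)) ⟧ ≡ ⟦ ¬? (y ∈? w) ⟧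
∉-∷ʳ {m = m} w {x} {y} y≢x = ⟦⟧-⇔ (¬? (y ∈? (w ∷ʳ x))) (¬? (y ∈? w))
  (λ ∉wx (i , eq) → ∉wx (inject₁ i , trans (lookup-∷ʳ-inject₁ w x i) eq))
  (λ ∉w (i , eq) → not-in ∉w i eq)
  where
  not-in : ¬ (y ∈ w) → (i : Fin (suc m)) → lookup (w ∷ʳ x) i ≢ y
  not-in ∉w i eq with view i
  ... | ‵fromℕ     = y≢x (trans (sym eq) (lookup-∷ʳ-fromℕ w x))
  ... | ‵inject₁ i = ∉w (i , trans (sym (lookup-∷ʳ-inject₁ w x i)) eq)

-- For fixed positions `a`, `b`, `c` and values `x`, `y`, `z`, summing over the additional entries
-- leaves at most one choice for each. In the names a filled circle marks a value among the
-- positions, an empty one a value outside.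
module Leaves {n : ℕ} (a b c x y z : Fin n) (y≢x : y ≢ x) (z≢x : z ≢ x) (z≢y : z ≢ y) where

  W : Vec (Fin n) 3
  W = a ∷ b ∷ c ∷ []

  εᵗ : Fin 4 × Fin 4 × Fin 4 → ℕ
  εᵗ (s , t , u) = ε W s x * (ε W t y * ε W u z)

  old : (v : Fin n) (ds : Vec (Fin n) m) (s : Fin 3) →
        ⟦ toℕ v ℕₚ.≟ at (a ∷ b ∷ c ∷ ds) (toℕ s) ⟧ ≡ ε W (inject₁ s) v
  old v ds 0F = ≟-toℕ v a
  old v ds 1F = ≟-toℕ v b
  old v ds 2F = ≟-toℕ v c

  new : (w : Vec (Fin n) m) (v : Fin n) (R : Fin n → ℕ) →
        ∑∉ w (λ d → ⟦ toℕ v ℕₚ.≟ toℕ d ⟧ * R d) ≡ ⟦ ¬? (v ∈? w) ⟧ * R v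
  new w v R = trans (∑∉-cong w (λ d _ → cong (_* R d) (≟-toℕ v d))) (∑∉-δ w v R)

  new₂ : (w : Vec (Fin n) m) (v : Fin n) (k : ℕ) (R : Fin n → ℕ) →
         ∑∉ w (λ d → k * (⟦ toℕ v ℕₚ.≟ toℕ d ⟧ * R d)) ≡ k * (⟦ ¬? (v ∈? w) ⟧ * R v)
  new₂ w v k R = trans (∑∉-*ˡ w k) (cong (k *_) (new w v R))

  new₃ : (w : Vec (Fin n) m) (v : Fin n) (k l : ℕ) →
         ∑∉ w (λ d → k * (l * ⟦ toℕ v ℕₚ.≟ toℕ d ⟧)) ≡ k * (l * ⟦ ¬? (v ∈? w) ⟧)
  new₃ w v k l = trans
    (∑∉-cong w (λ d _ → cong (λ e → k * (l * e)) (sym (ℕₚ.*-identityʳ ⟦ toℕ v ℕₚ.≟ toℕ d ⟧))))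
    (trans (∑∉-*ˡ w k) (cong (k *_) (trans (new₂ w v l (λ _ → 1)) (cong (l *_) (ℕₚ.*-identityʳ _)))))

  hit : Triple → Vec (Fin n) m → ℕ
  hit t w = hits (toℕ x) (toℕ y) (toℕ z) w t

  hits●●● : (s t u : Fin 3) → ∑Rest 3 W (hit (toℕ s , toℕ t , toℕ u)) ≡ εᵗ (inject₁ s , inject₁ t , inject₁ u)
  hits●●● s t u = cong₂ _*_ (old x [] s) (cong₂ _*_ (old y [] t) (old z [] u))

  hits○●● : (t u : Fin 3) → ∑Rest 4 W (hit (3 , toℕ t , toℕ u)) ≡ εᵗ (3F , inject₁ t , inject₁ u)
  hits○●● t u = trans (new W x _) (cong (ε W 3F x *_) (cong₂ _*_ (old y (x ∷ []) t) (old z (x ∷ []) u)))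

  hits●○● : (s u : Fin 3) → ∑Rest 4 W (hit (toℕ s , 3 , toℕ u)) ≡ εᵗ (inject₁ s , 3F , inject₁ u)
  hits●○● s u = trans (∑∉-cong W (λ d _ → cong₂ (λ k l → k * (⟦ toℕ y ℕₚ.≟ toℕ d ⟧ * l)) (old x (d ∷ []) s) (old z (d ∷ []) u)))
    (new₂ W y (ε W (inject₁ s) x) (λ _ → ε W (inject₁ u) z))

  hits●●○ : (s t : Fin 3) → ∑Rest 4 W (hit (toℕ s , toℕ t , 3)) ≡ εᵗ (inject₁ s , inject₁ t , 3F)
  hits●●○ s t = trans (∑∉-cong W (λ d _ → cong₂ (λ k l → k * (l * ⟦ toℕ z ℕₚ.≟ toℕ d ⟧)) (old x (d ∷ []) s) (old y (d ∷ []) t)))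
    (new₃ W z (ε W (inject₁ s) x) (ε W (inject₁ t) y))

  hits●○○ : (s : Fin 3) → ∑Rest 5 W (hit (toℕ s , 3 , 4)) ≡ εᵗ (inject₁ s , 3F , 3F)
  hits●○○ s = begin
    ∑Rest 5 W (hit (toℕ s , 3 , 4))
      ≡⟨ ∑∉-cong W (λ d _ → trans (∑∉-cong (W ∷ʳ d) (λ e _ → cong (_* (⟦ toℕ y ℕₚ.≟ toℕ d ⟧ * ⟦ toℕ z ℕₚ.≟ toℕ e ⟧)) (old x (d ∷ e ∷ []) s)))
           (new₃ (W ∷ʳ d) z (ε W (inject₁ s) x) ⟦ toℕ y ℕₚ.≟ toℕ d ⟧)) ⟩
    ∑∉ W (λ d → ε W (inject₁ s) x * (⟦ toℕ y ℕₚ.≟ toℕ d ⟧ * ⟦ ¬? (z ∈? (W ∷ʳ d)) ⟧))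
      ≡⟨ new₂ W y (ε W (inject₁ s) x) (λ d → ⟦ ¬? (z ∈? (W ∷ʳ d)) ⟧) ⟩
    ε W (inject₁ s) x * (ε W 3F y * ⟦ ¬? (z ∈? (W ∷ʳ y)) ⟧)
      -- As `z` differs from `y`, avoiding `W ∷ʳ y` means no more than avoiding `W`; thus the
      -- symbols `3` and `4` merge.
      ≡⟨ cong (λ k → ε W (inject₁ s) x * (ε W 3F y * k)) (∉-∷ʳ W z≢y) ⟩
    εᵗ (inject₁ s , 3F , 3F) ∎
    where open ≡-Reasoning

  hits○●○ : (t : Fin 3) → ∑Rest 5 W (hit (3 , toℕ t , 4)) ≡ εᵗ (3F , inject₁ t , 3F)
  hits○●○ t = begin
    ∑Rest 5 W (hit (3 , toℕ t , 4))
      ≡⟨ ∑∉-cong W (λ d _ → trans (∑∉-cong (W ∷ʳ d) (λ e _ → cong (λ k → ⟦ toℕ x ℕₚ.≟ toℕ d ⟧ * (k * ⟦ toℕ z ℕₚ.≟ toℕ e ⟧)) (old y (d ∷ e ∷ []) t)))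
           (new₃ (W ∷ʳ d) z ⟦ toℕ x ℕₚ.≟ toℕ d ⟧ (ε W (inject₁ t) y))) ⟩
    ∑∉ W (λ d → ⟦ toℕ x ℕₚ.≟ toℕ d ⟧ * (ε W (inject₁ t) y * ⟦ ¬? (z ∈? (W ∷ʳ d)) ⟧))
      ≡⟨ new W x (λ d → ε W (inject₁ t) y * ⟦ ¬? (z ∈? (W ∷ʳ d)) ⟧) ⟩
    ε W 3F x * (ε W (inject₁ t) y * ⟦ ¬? (z ∈? (W ∷ʳ x)) ⟧)
      ≡⟨ cong (λ k → ε W 3F x * (ε W (inject₁ t) y * k)) (∉-∷ʳ W z≢x) ⟩
    εᵗ (3F , inject₁ t , 3F) ∎
    where open ≡-Reasoning

  hits○○● : (u : Fin 3) → ∑Rest 5 W (hit (3 , 4 , toℕ u)) ≡ εᵗ (3F , 3F , inject₁ u)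
  hits○○● u = begin
    ∑Rest 5 W (hit (3 , 4 , toℕ u))
      ≡⟨ ∑∉-cong W (λ d _ → trans (∑∉-cong (W ∷ʳ d) (λ e _ → cong (λ k → ⟦ toℕ x ℕₚ.≟ toℕ d ⟧ * (⟦ toℕ y ℕₚ.≟ toℕ e ⟧ * k)) (old z (d ∷ e ∷ []) u)))
           (new₂ (W ∷ʳ d) y ⟦ toℕ x ℕₚ.≟ toℕ d ⟧ (λ _ → ε W (inject₁ u) z))) ⟩
    ∑∉ W (λ d → ⟦ toℕ x ℕₚ.≟ toℕ d ⟧ * (⟦ ¬? (y ∈? (W ∷ʳ d)) ⟧ * ε W (inject₁ u) z))
      ≡⟨ new W x (λ d → ⟦ ¬? (y ∈? (W ∷ʳ d)) ⟧ * ε W (inject₁ u) z) ⟩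
    ε W 3F x * (⟦ ¬? (y ∈? (W ∷ʳ x)) ⟧ * ε W (inject₁ u) z)
      ≡⟨ cong (λ k → ε W 3F x * (k * ε W (inject₁ u) z)) (∉-∷ʳ W y≢x) ⟩
    εᵗ (3F , 3F , inject₁ u) ∎
    where open ≡-Reasoning

  hits○○○ : ∑Rest 6 W (hit (3 , 4 , 5)) ≡ εᵗ (3F , 3F , 3F)
  hits○○○ = begin
    ∑Rest 6 W (hit (3 , 4 , 5))
      ≡⟨ ∑∉-cong W (λ d _ → trans
           (∑∉-cong (W ∷ʳ d) (λ e _ → new₃ (W ∷ʳ d ∷ʳ e) z ⟦ toℕ x ℕₚ.≟ toℕ d ⟧ ⟦ toℕ y ℕₚ.≟ toℕ e ⟧))
           (new₂ (W ∷ʳ d) y ⟦ toℕ x ℕₚ.≟ toℕ d ⟧ (λ e → ⟦ ¬? (z ∈? (W ∷ʳ d ∷ʳ e)) ⟧))) ⟩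
    ∑∉ W (λ d → ⟦ toℕ x ℕₚ.≟ toℕ d ⟧ * (⟦ ¬? (y ∈? (W ∷ʳ d)) ⟧ * ⟦ ¬? (z ∈? (W ∷ʳ d ∷ʳ y)) ⟧))
      ≡⟨ new W x (λ d → ⟦ ¬? (y ∈? (W ∷ʳ d)) ⟧ * ⟦ ¬? (z ∈? (W ∷ʳ d ∷ʳ y)) ⟧) ⟩
    ε W 3F x * (⟦ ¬? (y ∈? (W ∷ʳ x)) ⟧ * ⟦ ¬? (z ∈? (W ∷ʳ x ∷ʳ y)) ⟧)
      ≡⟨ cong (ε W 3F x *_) (cong₂ _*_ (∉-∷ʳ W y≢x) (trans (∉-∷ʳ (W ∷ʳ x) z≢y) (∉-∷ʳ W z≢x))) ⟩
    εᵗ (3F , 3F , 3F) ∎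
    where open ≡-Reasoning

  leaves : AllClass (λ j ℓ t → ∑Rest j W (hit t) ≡ εᵗ (symbols t))
  leaves =
    ((hits●●● 0F 1F 2F ∷ []) ∷
     (hits●●● 0F 2F 1F ∷ hits●●● 2F 1F 0F ∷ hits●●● 1F 0F 2F ∷ []) ∷
     (hits●●● 1F 2F 0F ∷ hits●●● 2F 0F 1F ∷ []) ∷
     []) ∷
    ((hits●●○ 0F 1F ∷ hits●○● 0F 2F ∷ hits○●● 1F 2F ∷ []) ∷
     (hits●●○ 1F 0F ∷ hits●○● 2F 0F ∷ hits○●● 2F 1F ∷ []) ∷
     (hits●●○ 0F 2F ∷ hits●○● 0F 1F ∷ hits●●○ 2F 1F ∷ hits○●● 1F 0F ∷ hits●○● 1F 2F ∷ hits○●● 0F 2F ∷ []) ∷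
     (hits●●○ 1F 2F ∷ hits●○● 2F 1F ∷ hits●●○ 2F 0F ∷ hits○●● 2F 0F ∷ hits●○● 1F 0F ∷ hits○●● 0F 1F ∷ []) ∷
     []) ∷
    ((hits●○○ 0F ∷ hits○●○ 1F ∷ hits○○● 2F ∷ []) ∷
     (hits●○○ 1F ∷ hits●○○ 2F ∷ hits○●○ 0F ∷ hits○●○ 2F ∷ hits○○● 0F ∷ hits○○● 1F ∷ []) ∷
     []) ∷
    ((hits○○○ ∷ []) ∷
     []) ∷
    []

  -- The sum factors into three, one for each value, and each factor is 1 by `∑-ε`.
  ∑-box : Inj W → ∑ (Enum.elems (FinEnum 4 ×-Enum (FinEnum 4 ×-Enum FinEnum 4))) εᵗ ≡ 1
  ∑-box inj = begin
    ∑ (Enum.elems (FinEnum 4 ×-Enum (FinEnum 4 ×-Enum FinEnum 4))) εᵗ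
      ≡⟨ ∑-×-Enum (FinEnum 4) (FinEnum 4 ×-Enum FinEnum 4) {εᵗ} ⟩
    ∑[ s ∈ allFin 4 ] ∑[ p ∈ Enum.elems (FinEnum 4 ×-Enum FinEnum 4) ] εᵗ (s , p)
      ≡⟨ ∑-cong (allFin 4) (λ s → trans (∑-*ˡ (Enum.elems (FinEnum 4 ×-Enum FinEnum 4)) (ε W s x) {λ (t , u) → ε W t y * ε W u z})
           (cong (ε W s x *_) (trans (∑-×-Enum (FinEnum 4) (FinEnum 4) {λ (t , u) → ε W t y * ε W u z})
             (product (λ t → ε W t y) (λ u → ε W u z) (total y) (total z))))) ⟩
    ∑[ s ∈ allFin 4 ] (ε W s x * 1)
      ≡⟨ ∑-cong (allFin 4) (λ s → ℕₚ.*-identityʳ (ε W s x)) ⟩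
    ∑[ s ∈ allFin 4 ] ε W s x
      ≡⟨ total x ⟩
    1 ∎
    where
    open ≡-Reasoning
    total : ∀ v → ∑[ s ∈ allFin 4 ] ε W s v ≡ 1
    total v = trans (cong (λ k → ε W 0F v + (ε W 1F v + (ε W 2F v + k))) (ℕₚ.+-identityʳ _)) (∑-ε W inj v)
    product : (g h : Fin 4 → ℕ) → ∑ (allFin 4) g ≡ 1 → ∑ (allFin 4) h ≡ 1 →
              ∑[ t ∈ allFin 4 ] ∑[ u ∈ allFin 4 ] (g t * h u) ≡ 1
    product g h g≡1 h≡1 = begin
      ∑[ t ∈ allFin 4 ] ∑[ u ∈ allFin 4 ] (g t * h u)
        ≡⟨ ∑-cong (allFin 4) (λ t → trans (∑-*ˡ (allFin 4) (g t) {h}) (trans (cong (g t *_) h≡1) (ℕₚ.*-identityʳ (g t)))) ⟩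
      ∑ (allFin 4) g
        ≡⟨ g≡1 ⟩
      1 ∎

tripleEnum : Enum (Fin 4 × Fin 4 × Fin 4)
tripleEnum = FinEnum 4 ×-Enum (FinEnum 4 ×-Enum FinEnum 4)

open Enum tripleEnum using () renaming (_≟_ to _≟ᵗ_)

Conflict : Fin 4 → Fin 4 → Set
Conflict s t = s ≡ t × s ≢ 3F

opaque
  unfolding ∑class

  multiplicity : Fin 4 × Fin 4 × Fin 4 → ℕ
  multiplicity b = ∑class (λ j ℓ t → ⟦ b ≟ᵗ symbols t ⟧)

  -- The triple classes list exactly the conflict-free triples, each of them once.
  classified : ∀ s t u → multiplicity (s , t , u) ≡ 1 ⊎ Conflict s t ⊎ Conflict s u ⊎ Conflict t u
  classified = from-yes (Finₚ.all? λ s → Finₚ.all? λ t → Finₚ.all? λ u →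
    (multiplicity (s , t , u) ℕₚ.≟ 1) ⊎-dec (conflict? s t ⊎-dec (conflict? s u ⊎-dec conflict? t u)))
    where
    conflict? : ∀ s t → Dec (Conflict s t)
    conflict? s t = (s Finₚ.≟ t) ×-dec ¬? (s Finₚ.≟ 3F)

  multiplicity-def : ∀ b → ∑class (λ j ℓ t → ⟦ b ≟ᵗ symbols t ⟧) ≡ multiplicity b
  multiplicity-def b = refl

ε-conflict : (w : Vec (Fin n) 3) {s t : Fin 4} {x y : Fin n} → Conflict s t → x ≢ y → ε w s x * ε w t y ≡ 0
ε-conflict w {0F} (refl , _)   x≢y = ε-disjoint w 0F x≢y
ε-conflict w {1F} (refl , _)   x≢y = ε-disjoint w 1F x≢y
ε-conflict w {2F} (refl , _)   x≢y = ε-disjoint w 2F x≢y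
ε-conflict w {3F} (refl , 3≢3) x≢y = contradiction refl 3≢3

-- Every triple of symbols is counted with its `multiplicity`, which is 1 unless the triple has a
-- conflict, and then `εᵗ` vanishes because the values are distinct.
∑class-εᵗ : {a b c x y z : Fin n} (y≢x : y ≢ x) (z≢x : z ≢ x) (z≢y : z ≢ y) → Inj (a ∷ b ∷ c ∷ []) →
            ∑class (λ j ℓ t → Leaves.εᵗ a b c x y z y≢x z≢x z≢y (symbols t)) ≡ 1
∑class-εᵗ {n} {a} {b} {c} {x} {y} {z} y≢x z≢x z≢y inj = begin
  ∑class (λ j ℓ t → εᵗ (symbols t))
    ≡⟨ ∑class-cong (universalClass (λ t → sym (∑-δ (symbols t) εᵗ))) ⟩
  ∑class (λ j ℓ t → ∑[ b ∈ elems ] (⟦ b ≟ᵗ symbols t ⟧ * εᵗ b))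
    ≡⟨ ∑class-∑ elems {λ j ℓ t b → ⟦ b ≟ᵗ symbols t ⟧ * εᵗ b} ⟨
  ∑[ b ∈ elems ] ∑class (λ j ℓ t → ⟦ b ≟ᵗ symbols t ⟧ * εᵗ b)
    ≡⟨ ∑-cong elems (λ b → trans (∑class-*ʳ (εᵗ b) {λ j ℓ t → ⟦ b ≟ᵗ symbols t ⟧}) (cong (_* εᵗ b) (multiplicity-def b))) ⟩
  ∑[ b ∈ elems ] (multiplicity b * εᵗ b)
    ≡⟨ ∑-cong elems once-or-zero ⟩
  ∑ elems εᵗ
    ≡⟨ ∑-box inj ⟩
  1 ∎
  where
  open ≡-Reasoning
  open Enum tripleEnum using (elems; ∑-δ)
  open Leaves a b c x y z y≢x z≢x z≢y
  zero-case : ∀ {k e} → e ≡ 0 → k * e ≡ e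
  zero-case {k} refl = ℕₚ.*-zeroʳ k
  once-or-zero : ∀ b → multiplicity b * εᵗ b ≡ εᵗ b
  once-or-zero (s , t , u) with classified s t u
  ... | inj₁ eq = trans (cong (_* εᵗ (s , t , u)) eq) (ℕₚ.*-identityˡ _)
  ... | inj₂ (inj₁ conflict) = zero-case {multiplicity (s , t , u)}
          (trans (sym (ℕₚ.*-assoc (ε W s x) _ _)) (cong (_* ε W u z) (ε-conflict W conflict (y≢x ∘ sym))))
  ... | inj₂ (inj₂ (inj₁ conflict)) = zero-case {multiplicity (s , t , u)}
          (trans (x∙yz≈y∙xz (ε W s x) (ε W t y) (ε W u z))
                 (trans (cong (ε W t y *_) (ε-conflict W conflict (z≢x ∘ sym))) (ℕₚ.*-zeroʳ (ε W t y))))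
  ... | inj₂ (inj₂ (inj₂ conflict)) = zero-case {multiplicity (s , t , u)}
          (trans (cong (ε W s x *_) (ε-conflict W conflict (z≢y ∘ sym))) (ℕₚ.*-zeroʳ (ε W s x)))

-- Under the indicator the entries named by `t` are the values `X`, `Y`, `Z`; after the replacement
-- the order condition no longer refers to the extra entries and can leave the sum.
hits-subst : (X Y Z : ℕ) (w : Vec (Fin n) m) (t : Triple) (O : ℕ → ℕ → ℕ → ℕ) (k : ℕ) →
             let (x , y , z) = t in
             hits X Y Z w t * (k * O (at w x) (at w y) (at w z)) ≡ hits X Y Z w t * (k * O X Y Z)
hits-subst X Y Z w (x , y , z) O k = begin
  ⟦ X≟ ⟧ * (⟦ Y≟ ⟧ * ⟦ Z≟ ⟧) * (k * O (at w x) (at w y) (at w z))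
    ≡⟨ assoc ⟦ X≟ ⟧ ⟦ Y≟ ⟧ ⟦ Z≟ ⟧ _ ⟩
  ⟦ X≟ ⟧ * (⟦ Y≟ ⟧ * (⟦ Z≟ ⟧ * (k * O (at w x) (at w y) (at w z))))
    ≡⟨ ⟦⟧*-cong X≟ (λ X≡ → ⟦⟧*-cong Y≟ (λ Y≡ → ⟦⟧*-cong Z≟ (λ Z≡ → cong (k *_)
         (trans (cong₂ (λ X Y → O X Y _) (sym X≡) (sym Y≡)) (cong (O X Y) (sym Z≡)))))) ⟩
  ⟦ X≟ ⟧ * (⟦ Y≟ ⟧ * (⟦ Z≟ ⟧ * (k * O X Y Z)))
    ≡⟨ assoc ⟦ X≟ ⟧ ⟦ Y≟ ⟧ ⟦ Z≟ ⟧ _ ⟨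
  ⟦ X≟ ⟧ * (⟦ Y≟ ⟧ * ⟦ Z≟ ⟧) * (k * O X Y Z) ∎
  where
  open ≡-Reasoning
  X≟ = X ℕₚ.≟ at w x
  Y≟ = Y ℕₚ.≟ at w y
  Z≟ = Z ℕₚ.≟ at w z
  assoc : ∀ a b c d → a * (b * c) * d ≡ a * (b * (c * d))
  assoc = ℕ-Solver.solve-∀

module Decomposition {n : ℕ} (π : Vec (Fin n) n) (π-inj : Inj π) where

  f : Fin n → Fin n
  f = lookup π

  f-inj : ∀ {x y} → f x ≡ f y → x ≡ y
  f-inj = π-inj _ _

  -- `K` tests positions and `O` tests values; here the values are read off the formal triple
  -- instead of `π`.
  weight : (K O : ℕ → ℕ → ℕ → ℕ) → Vec (Fin n) m → Triple → ℕ
  weight K O w (x , y , z) = K (at w 0) (at w 1) (at w 2) * O (at w x) (at w y) (at w z)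

  factor : (K O : ℕ → ℕ → ℕ → ℕ) (a b c : Fin n) → let w₀ = a ∷ b ∷ c ∷ [] in
           All (λ j → ∀ t → ∑Rest j w₀ (λ w → match π w t * weight K O w t) ≡
             ∑Rest j w₀ (λ w → match π w t) *
               (K (toℕ a) (toℕ b) (toℕ c) * O (at π (toℕ a)) (at π (toℕ b)) (at π (toℕ c)))) sizes
  factor K O a b c =
    (λ t → substitute (a ∷ b ∷ c ∷ []) t) ∷
    (λ t → trans (∑∉-cong w₀ λ d _ → substitute (a ∷ b ∷ c ∷ d ∷ []) t) (∑∉-*ʳ w₀ k)) ∷
    (λ t → trans (∑∉-cong w₀ λ d _ → trans (∑∉-cong (w₀ ∷ʳ d) λ e _ → substitute (a ∷ b ∷ c ∷ d ∷ e ∷ []) t)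
      (∑∉-*ʳ (w₀ ∷ʳ d) k)) (∑∉-*ʳ w₀ k)) ∷
    (λ t → trans (∑∉-cong w₀ λ d _ → trans (∑∉-cong (w₀ ∷ʳ d) λ e _ →
      trans (∑∉-cong (w₀ ∷ʳ d ∷ʳ e) λ g _ → substitute (a ∷ b ∷ c ∷ d ∷ e ∷ g ∷ []) t)
        (∑∉-*ʳ (w₀ ∷ʳ d ∷ʳ e) k)) (∑∉-*ʳ (w₀ ∷ʳ d) k)) (∑∉-*ʳ w₀ k)) ∷ []
    where
    w₀ = a ∷ b ∷ c ∷ []
    k = K (toℕ a) (toℕ b) (toℕ c) * O (at π (toℕ a)) (at π (toℕ b)) (at π (toℕ c))
    substitute : (w : Vec (Fin n) m) (t : Triple) → match π w t * weight K O w t ≡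
      match π w t * (K (at w 0) (at w 1) (at w 2) * O (at π (at w 0)) (at π (at w 1)) (at π (at w 2)))
    substitute w t = hits-subst (at π (at w 0)) (at π (at w 1)) (at π (at w 2)) w t O (K (at w 0) (at w 1) (at w 2))

  module _ (a b c : Fin n) (inj : Inj (a ∷ b ∷ c ∷ [])) where
    private
      fb≢fa : f b ≢ f a
      fb≢fa eq = case inj 1F 0F (f-inj eq) of λ ()
      fc≢fa : f c ≢ f a
      fc≢fa eq = case inj 2F 0F (f-inj eq) of λ ()
      fc≢fb : f c ≢ f b
      fc≢fb eq = case inj 2F 1F (f-inj eq) of λ ()
    open Leaves a b c (f a) (f b) (f c) fb≢fa fc≢fa fc≢fb

    ∑Rest-hits : (X Y Z : ℕ) → X ≡ at π (toℕ a) → Y ≡ at π (toℕ b) → Z ≡ at π (toℕ c) →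
      All (λ j → ∀ t → ∑Rest j W (λ w → match π w t) ≡ ∑Rest j W (λ w → hits X Y Z w t)) sizes
    ∑Rest-hits X Y Z refl refl refl = (λ t → refl) ∷ (λ t → refl) ∷ (λ t → refl) ∷ (λ t → refl) ∷ []

    ∑Rest-match : AllClass (λ j ℓ t → ∑Rest j W (λ w → match π w t) ≡ εᵗ (symbols t))
    ∑Rest-match = zipClass (λ {j} {ℓ} {t} eq₁ eq₂ → trans (eq₁ t) eq₂)
      (All.map (λ eq → All.universal (λ _ → All.universal (λ _ → eq) _) _)
        (∑Rest-hits _ _ _ (sym (at-lookup π a)) (sym (at-lookup π b)) (sym (at-lookup π c))))
      leaves

    -- For given positions exactly one formal triple, with one choice of its extra entries, matches
    -- `π`, so the sum over all classes has a single surviving term.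
    pointwise : (K O : ℕ → ℕ → ℕ → ℕ) →
      K (toℕ a) (toℕ b) (toℕ c) * O (at π (toℕ a)) (at π (toℕ b)) (at π (toℕ c)) ≡
      ∑class (λ j ℓ t → ∑Rest j W (λ w → match π w t * weight K O w t))
    pointwise K O = sym (begin
      ∑class (λ j ℓ t → ∑Rest j W (λ w → match π w t * weight K O w t))
        ≡⟨ ∑class-cong (zipClass (λ {j} {ℓ} {t} eq₁ eq₂ → trans (eq₁ t) (cong (_* k) eq₂))
             (All.map (λ eq → All.universal (λ _ → All.universal (λ _ → eq) _) _) (factor K O a b c)) ∑Rest-match) ⟩
      ∑class (λ j ℓ t → εᵗ (symbols t) * k)
        ≡⟨ ∑class-*ʳ k ⟩
      ∑class (λ j ℓ t → εᵗ (symbols t)) * k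
        ≡⟨ cong (_* k) (∑class-εᵗ fb≢fa fc≢fa fc≢fb inj) ⟩
      1 * k
        ≡⟨ ℕₚ.*-identityˡ k ⟩
      k ∎)
      where
      open ≡-Reasoning
      k = K (toℕ a) (toℕ b) (toℕ c) * O (at π (toℕ a)) (at π (toℕ b)) (at π (toℕ c))

  decomposition : (K O : ℕ → ℕ → ℕ → ℕ) →
    ∑Inj n 3 (λ w → K (at w 0) (at w 1) (at w 2) * O (at π (at w 0)) (at π (at w 1)) (at π (at w 2))) ≡
    ∑class (λ j ℓ t → ∑Inj n j (λ w → match π w t * weight K O w t))
  decomposition K O = begin
    ∑Inj n 3 (λ w → K (at w 0) (at w 1) (at w 2) * O (at π (at w 0)) (at π (at w 1)) (at π (at w 2)))
      ≡⟨ ∑Inj-cong (λ { (a ∷ b ∷ c ∷ []) inj → pointwise a b c inj K O }) ⟩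
    ∑Inj n 3 (λ v → ∑class (λ j ℓ t → ∑Rest j v (λ w → match π w t * weight K O w t)))
      ≡⟨ ∑Inj-∑class ⟩
    ∑class (λ j ℓ t → ∑Inj n 3 (λ v → ∑Rest j v (λ w → match π w t * weight K O w t)))
      ≡⟨ ∑class-cong (mapClass (λ eq → sym (eq _)) ∑Inj-Rest-class) ⟩
    ∑class (λ j ℓ t → ∑Inj n j (λ w → match π w t * weight K O w t)) ∎
    where open ≡-Reasoning

  open PatternCounts f f-inj public

  match-count : AllClass (λ j ℓ t → let (s , t′ , u) = symbols t in ∑Inj n j (λ w → match π w t) ≡ E s t′ u)
  match-count = All.tabulate λ j∈ → All.tabulate λ ℓ∈ → All.tabulate λ t∈ →
    trans (All.lookup (All.lookup (All.lookup ∑Inj-Rest-class j∈) ℓ∈) t∈ _)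
          (∑Inj-cong λ { (a ∷ b ∷ c ∷ []) inj → All.lookup (All.lookup (All.lookup (∑Rest-match a b c inj) j∈) ℓ∈) t∈ })

  match-value : (q r : ℕ) → twoCyclePoints ≡ 2 * q → threeCyclePoints ≡ 3 * r →
    AllClass (λ j ℓ t → ℤ.+ ∑Inj n j (λ w → match π w t) ≡ H j ℓ (ℤ.+ n) (ℤ.+ fixedPoints) (ℤ.+ q) (ℤ.+ r))
  match-value q r two three = zipClass (λ eq v → trans (cong toℤ eq) v) match-count values
    where
    open PatternValues f f-inj q r two three
    values : AllClass (λ j ℓ t → let (s , t′ , u) = symbols t in ℤ.+ E s t′ u ≡ H j ℓ (ℤ.+ n) (ℤ.+ fixedPoints) (ℤ.+ q) (ℤ.+ r))
    values =
      ((V-012 ∷ []) ∷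
       (V-021 ∷ V-210 ∷ V-102 ∷ []) ∷
       (V-120 ∷ V-201 ∷ []) ∷
       []) ∷
      ((V-013 ∷ V-032 ∷ V-312 ∷ []) ∷
       (V-103 ∷ V-230 ∷ V-321 ∷ []) ∷
       (V-023 ∷ V-031 ∷ V-213 ∷ V-310 ∷ V-132 ∷ V-302 ∷ []) ∷
       (V-123 ∷ V-231 ∷ V-203 ∷ V-320 ∷ V-130 ∷ V-301 ∷ []) ∷
       []) ∷
      ((V-033 ∷ V-313 ∷ V-332 ∷ []) ∷
       (V-133 ∷ V-233 ∷ V-303 ∷ V-323 ∷ V-330 ∷ V-331 ∷ []) ∷
       []) ∷
      ((V-333 ∷ []) ∷
       []) ∷
      []

-- Cycle structure

≡ᵇ⇒≡ : ∀ x y → (x ≡ᵇ y) ≡ true → x ≡ y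
≡ᵇ⇒≡ x y eq = ℕₚ.≡ᵇ⇒≡ x y (subst T (sym eq) tt)

≡⇒≡ᵇ : ∀ {x y} → x ≡ y → (x ≡ᵇ y) ≡ true
≡⇒≡ᵇ {x} {y} eq = dec-true (x ℕₚ.≟ y) eq

Bool-⇔ : ∀ {a b} → (a ≡ true → b ≡ true) → (b ≡ true → a ≡ true) → a ≡ b
Bool-⇔ {true}  {true}  f g = refl
Bool-⇔ {true}  {false} f g = sym (f refl)
Bool-⇔ {false} {true}  f g = g refl
Bool-⇔ {false} {false} f g = refl

∧-true : ∀ {a b} → a ∧ b ≡ true → a ≡ true × b ≡ true
∧-true {true} {true} eq = refl , refl

all-++ : (p : A → Bool) (xs ys : List A) → all p (xs ++ ys) ≡ true → all p xs ≡ true × all p ys ≡ true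
all-++ p []       ys eq = refl , eq
all-++ p (x ∷ xs) ys eq with p x
... | true = all-++ p xs ys eq

all-universal : {p : A → Bool} (xs : List A) → (∀ x → p x ≡ true) → all p xs ≡ true
all-universal []       eq = refl
all-universal {p = p} (x ∷ xs) eq = cong₂ _∧_ (eq x) (all-universal xs eq)

all-applyUpTo⁻ : (p : A → Bool) (g : ℕ → A) (n : ℕ) → all p (applyUpTo g n) ≡ true → ∀ k → k < n → p (g k) ≡ true
all-applyUpTo⁻ p g (suc n) eq zero    _         = proj₁ (∧-true eq)
all-applyUpTo⁻ p g (suc n) eq (suc k) (s≤s k<n) = all-applyUpTo⁻ p (g ∘ suc) n (proj₂ (∧-true {p (g 0)} eq)) k k<n

all-count : (p : ℕ → Bool) (m : ℕ) (xs : List ℕ) → all p xs ≡ true → count m xs ≢ 0 → p m ≡ true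
all-count p m []       eq ≢0 = contradiction refl ≢0
all-count p m (x ∷ xs) eq ≢0 with x ≡ᵇ m in x≡ᵇm
... | true  = subst (λ k → p k ≡ true) (≡ᵇ⇒≡ x m x≡ᵇm) (proj₁ (∧-true eq))
... | false = all-count p m xs (proj₂ (∧-true {p x} eq)) ≢0

-- `sameMultiset` tests only numbers that occur in one of the lists; any other number has count 0 in
-- both.
sameMultiset⁻ : (xs ys : List ℕ) → sameMultiset xs ys ≡ true → ∀ m → count m xs ≡ count m ys
sameMultiset⁻ xs ys eq m with all-++ (λ m → count m xs ≡ᵇ count m ys) xs ys eq | count m xs in eqx | count m ys in eqy
... | eq₁ , eq₂ | zero  | zero  = refl
... | eq₁ , eq₂ | suc k | l     = trans (sym eqx) (trans (≡ᵇ⇒≡ _ _ (all-count _ m xs eq₁ (λ z → case trans (sym z) eqx of λ ()))) eqy)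
... | eq₁ , eq₂ | zero  | suc l = trans (sym eqx) (trans (≡ᵇ⇒≡ _ _ (all-count _ m ys eq₂ (λ z → case trans (sym z) eqy of λ ()))) eqy)

sameMultiset⁺ : (xs ys : List ℕ) → (∀ m → count m xs ≡ count m ys) → sameMultiset xs ys ≡ true
sameMultiset⁺ xs ys eq = all-universal (xs ++ ys) (λ m → ≡⇒≡ᵇ (eq m))

-- The witness `k` guarantees that the search succeeds, so the result is a genuine first hit and not
-- the default 0.
firstOr0-filterᵇ : (p : ℕ → Bool) (g : ℕ → ℕ) (n : ℕ) {k : ℕ} → k < n → p (g k) ≡ true →
  ∃ λ l → l < n × firstOr0 (filterᵇ p (applyUpTo g n)) ≡ g l × p (g l) ≡ true × (∀ i → i < l → p (g i) ≡ false)
firstOr0-filterᵇ p g (suc n) {k} k<n pk with p (g 0) in p0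
... | true = 0 , s≤s z≤n , refl , p0 , λ i ()
firstOr0-filterᵇ p g (suc n) {zero}  k<n       pk | false = case trans (sym p0) pk of λ ()
firstOr0-filterᵇ p g (suc n) {suc k} (s≤s k<n) pk | false
  with l , l<n , eq , pl , first ← firstOr0-filterᵇ p (g ∘ suc) n k<n pk
  = suc l , s≤s l<n , eq , pl , λ { zero _ → p0 ; (suc i) (s≤s i<l) → first i i<l }

argmin : (g : ℕ → ℕ) (m : ℕ) → ∃ λ k → k ≤ m × ∀ l → l ≤ m → g k ≤ g l
argmin g zero = 0 , z≤n , λ { .0 z≤n → ℕₚ.≤-refl }
argmin g (suc m) with argmin g m
... | k , k≤m , min with ℕₚ.≤-total (g k) (g (suc m))
...   | inj₁ gk≤ = k , ℕₚ.m≤n⇒m≤1+n k≤m , λ l l≤ → case ℕₚ.m≤n⇒m<n∨m≡n l≤ of λ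
          { (inj₁ (s≤s l≤m)) → min l l≤m ; (inj₂ refl) → gk≤ }
...   | inj₂ ≤gk = suc m , ℕₚ.≤-refl , λ l l≤ → case ℕₚ.m≤n⇒m<n∨m≡n l≤ of λ
          { (inj₁ (s≤s l≤m)) → ℕₚ.≤-trans ≤gk (min l l≤m) ; (inj₂ refl) → ℕₚ.≤-refl }

iter-+ : (π : Vec (Fin n) n) (a b : ℕ) (i : Fin n) → iter π (a + b) i ≡ iter π a (iter π b i)
iter-+ π zero    b i = refl
iter-+ π (suc a) b i = cong (lookup π) (iter-+ π a b i)

iter-comm : (π : Vec (Fin n) n) (a b : ℕ) (i : Fin n) → iter π a (iter π b i) ≡ iter π b (iter π a i)
iter-comm π a b i = trans (sym (iter-+ π a b i)) (trans (cong (λ k → iter π k i) (ℕₚ.+-comm a b)) (iter-+ π b a i))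

iter-* : (π : Vec (Fin n) n) (k : ℕ) {c : ℕ} {i : Fin n} → iter π c i ≡ i → iter π (k * c) i ≡ i
iter-* π zero    eq = refl
iter-* π (suc k) {c} {i} eq = trans (iter-+ π c (k * c) i) (trans (cong (iter π c) (iter-* π k eq)) eq)

-- `cycleLen` is a bounded search; this specification determines its value and, unlike the search,
-- transfers along equivariant maps.
record IsCycleLength (π : Vec (Fin n) n) (i : Fin n) (m : ℕ) : Set where
  constructor cycleLength
  field
    nonzero : 1 ≤ m
    returns : iter π m i ≡ i
    first   : ∀ k → 1 ≤ k → k < m → iter π k i ≢ i

open IsCycleLength

IsCycleLength-unique : {π : Vec (Fin n) n} {i : Fin n} {m l : ℕ} → IsCycleLength π i m → IsCycleLength π i l → m ≡ l
IsCycleLength-unique {m = m} {l} p q with ℕₚ.<-cmp m l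
... | tri< m<l _ _ = contradiction (returns p) (first q m (nonzero p) m<l)
... | tri≈ _ m≡l _ = m≡l
... | tri> _ _ l<m = contradiction (returns q) (first p l (nonzero q) l<m)

module Cycles {n : ℕ} (π : Vec (Fin n) n) (π-inj : Inj π) where

  iter-injective : ∀ k {i j} → iter π k i ≡ iter π k j → i ≡ j
  iter-injective zero    eq = eq
  iter-injective (suc k) eq = iter-injective k (π-inj _ _ eq)

  iter-cancel : ∀ {a b i} → a ≤ b → iter π a i ≡ iter π b i → iter π (b ∸ a) i ≡ i
  iter-cancel {a} {b} {i} a≤b eq = iter-injective a (trans
    (sym (iter-+ π a (b ∸ a) i)) (trans (cong (λ k → iter π k i) (ℕₚ.m+[n∸m]≡n a≤b)) (sym eq)))

  -- Among the iterates with exponents 0 to `n` two agree, and injectivity cancels the smaller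
  -- exponent.
  returns-within : ∀ i → ∃ λ k → k < n × iter π (suc k) i ≡ i
  returns-within i with Finₚ.pigeonhole (ℕₚ.n<1+n n) (λ j → iter π (toℕ j) i)
  ... | a , b , a<b , eq with toℕ b ∸ toℕ a in d | iter-cancel (ℕₚ.<⇒≤ a<b) eq
  ...   | zero  | _  = contradiction d (ℕₚ.m>n⇒m∸n≢0 a<b)
  ...   | suc k | eq = k , ℕₚ.≤-trans (subst (_≤ toℕ b) d (ℕₚ.m∸n≤m (toℕ b) (toℕ a))) (ℕₚ.≤-pred (Finₚ.toℕ<n b)) , eq

  -- The bound by `n` is recorded because `isCycleMin` inspects only exponents below `n`.
  cycleLen-bounded-spec : ∀ i → cycleLen π i ≤ n × IsCycleLength π i (cycleLen π i)
  cycleLen-bounded-spec i with k , k<n , eq ← returns-within i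
    with l , l<n , eq , pl , first ← firstOr0-filterᵇ (λ k → toℕ (iter π k i) ≡ᵇ toℕ i) suc n k<n (≡⇒≡ᵇ (cong toℕ eq))
    = subst (λ c → c ≤ n × IsCycleLength π i c) (sym (trans (cong (λ xs → firstOr0 (filterᵇ (λ k → toℕ (iter π k i) ≡ᵇ toℕ i) xs)) (Listₚ.map-upTo suc n)) eq))
        (l<n , cycleLength (s≤s z≤n) (Finₚ.toℕ-injective (≡ᵇ⇒≡ _ _ pl))
           λ { (suc k) _ (s≤s k<l) eq → case trans (sym (first k k<l)) (≡⇒≡ᵇ (cong toℕ eq)) of λ () })

  cycleLen-spec : ∀ i → IsCycleLength π i (cycleLen π i)
  cycleLen-spec i = proj₂ (cycleLen-bounded-spec i)

  cycleLen-≟ : ∀ i m {P : Set} (d : Dec P) → (IsCycleLength π i m → P) → (P → IsCycleLength π i m) →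
               ⟦ cycleLen π i ℕₚ.≟ m ⟧ ≡ ⟦ d ⟧
  cycleLen-≟ i m d to from = ⟦⟧-⇔ (cycleLen π i ℕₚ.≟ m) d
    (λ eq → to (subst (IsCycleLength π i) eq (cycleLen-spec i)))
    (λ p → IsCycleLength-unique (cycleLen-spec i) (from p))

  IsCycleLength-iter : ∀ k {i m} → IsCycleLength π i m → IsCycleLength π (iter π k i) m
  IsCycleLength-iter k {i} {m} c = cycleLength (nonzero c)
    (trans (iter-comm π m k i) (cong (iter π k) (returns c)))
    (λ l 1≤l l<m eq → first c l 1≤l l<m (iter-injective k (trans (iter-comm π k l i) eq)))

  cycleLen-iter : ∀ k i → cycleLen π (iter π k i) ≡ cycleLen π i
  cycleLen-iter k i = IsCycleLength-unique (cycleLen-spec (iter π k i)) (IsCycleLength-iter k (cycleLen-spec i))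

  -- The inverse is a power of `π`: one step short of closing the cycle.
  f⁻¹ : Fin n → Fin n
  f⁻¹ i = iter π (cycleLen π i ∸ 1) i

  f-f⁻¹ : ∀ i → lookup π (f⁻¹ i) ≡ i
  f-f⁻¹ i with cycleLen π i | cycleLen-spec i
  ... | suc c | spec = returns spec

  f⁻¹-f : ∀ i → f⁻¹ (lookup π i) ≡ i
  f⁻¹-f i = π-inj _ _ (f-f⁻¹ (lookup π i))

  asPermutation : Permutation′ n
  asPermutation = Perm.permutation (lookup π) f⁻¹ f-f⁻¹ f⁻¹-f

  ∑-iter : ∀ k (F : Fin n → ℕ) → ∑[ i ∈ allFin n ] F (iter π k i) ≡ ∑ (allFin n) F
  ∑-iter zero    F = refl
  ∑-iter (suc k) F = trans (∑-iter k (F ∘ lookup π))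
    (∑-reindex (FinEnum n) (FinEnum n) (lookup π) f⁻¹ f-f⁻¹ f⁻¹-f F)

  iter-% : ∀ k c {i} .{{_ : NonZero c}} → iter π c i ≡ i → iter π k i ≡ iter π (k % c) i
  iter-% k c {i} eq = trans (cong (λ l → iter π l i) (DivMod.m≡m%n+[m/n]*n k c))
    (trans (iter-+ π (k % c) ((k / c) * c) i) (cong (iter π (k % c)) (iter-* π (k / c) eq)))

  -- Exponents matter only modulo the cycle length, which is at most `n`, so the finite test covers
  -- all `k`.
  isCycleMin⁻ : ∀ i → isCycleMin π i ≡ true → ∀ k → toℕ i ≤ toℕ (iter π k i)
  isCycleMin⁻ i eq k with cycleLen π i | cycleLen-bounded-spec i
  ... | c@(suc _) | c≤n , spec = subst (λ j → toℕ i ≤ toℕ j) (sym (iter-% k c (returns spec)))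
    (ℕₚ.≤ᵇ⇒≤ _ _ (subst T (sym (all-applyUpTo⁻ _ id n eq (k % c) (ℕₚ.<-≤-trans (DivMod.m%n<n k c) c≤n))) tt))

  isCycleMin⁺ : ∀ i → (∀ k → toℕ i ≤ toℕ (iter π k i)) → isCycleMin π i ≡ true
  isCycleMin⁺ i min = all-universal (upTo n) (λ k → dec-true (T? _) (ℕₚ.≤⇒≤ᵇ (min k)))

  iter-distinct : ∀ {i m k l} → IsCycleLength π i m → k < m → l < m → iter π k i ≡ iter π l i → k ≡ l
  iter-distinct {i} {m} {k} {l} c k<m l<m eq with ℕₚ.<-cmp k l
  ... | tri< k<l _ _ = contradiction (iter-cancel (ℕₚ.<⇒≤ k<l) eq)
          (first c (l ∸ k) (ℕₚ.m<n⇒0<n∸m k<l) (ℕₚ.≤-<-trans (ℕₚ.m∸n≤m l k) l<m))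
  ... | tri≈ _ k≡l _ = k≡l
  ... | tri> _ _ l<k = contradiction (iter-cancel (ℕₚ.<⇒≤ l<k) (sym eq))
          (first c (k ∸ l) (ℕₚ.m<n⇒0<n∸m l<k) (ℕₚ.≤-<-trans (ℕₚ.m∸n≤m k l) k<m))

  -- One full turn meets each point of the cycle once, so only the exponent `k₀` that minimizes the
  -- label hits the cycle minimum.
  ∑-isCycleMin : ∀ i → ∑[ k ∈ allFin (cycleLen π i) ] b2n (isCycleMin π (iter π (toℕ k) i)) ≡ 1
  ∑-isCycleMin i with cycleLen π i | cycleLen-spec i
  ... | c@(suc c-1) | spec with k₀ , k₀≤ , least ← argmin (λ k → toℕ (iter π k i)) c-1 =
    trans (∑-cong (allFin c) only) (Enum.once (FinEnum c) j₀)
    where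
    k₀<c : k₀ < c
    k₀<c = s≤s k₀≤
    j₀ : Fin c
    j₀ = fromℕ< k₀<c
    least-min : ∀ l → toℕ (iter π k₀ i) ≤ toℕ (iter π l (iter π k₀ i))
    least-min l = subst (λ j → toℕ (iter π k₀ i) ≤ toℕ j)
      (trans (sym (iter-% (l + k₀) c (returns spec))) (iter-+ π l k₀ i))
      (least _ (ℕₚ.≤-pred (DivMod.m%n<n (l + k₀) c)))
    -- From exponent `k`, `c - k` steps close the cycle and `k₀` more reach the minimum; this
    -- compares any other cycle minimum with it.
    back : ∀ {k} → k < c → iter π (k₀ + (c ∸ k)) (iter π k i) ≡ iter π k₀ i
    back {k} k<c = trans (iter-+ π k₀ (c ∸ k) (iter π k i)) (cong (iter π k₀)
      (trans (sym (iter-+ π (c ∸ k) k i)) (trans (cong (λ l → iter π l i) (ℕₚ.m∸n+n≡m (ℕₚ.<⇒≤ k<c))) (returns spec))))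
    only : ∀ k → b2n (isCycleMin π (iter π (toℕ k) i)) ≡ ⟦ k Finₚ.≟ j₀ ⟧
    only k = cong b2n (Bool-⇔ {isCycleMin π (iter π (toℕ k) i)} {does (k Finₚ.≟ j₀)}
      (λ min → dec-true (k Finₚ.≟ j₀) (Finₚ.toℕ-injective (trans
        (iter-distinct spec (Finₚ.toℕ<n k) k₀<c (Finₚ.toℕ-injective (ℕₚ.≤-antisym
          (subst (λ j → toℕ (iter π (toℕ k) i) ≤ toℕ j) (back (Finₚ.toℕ<n k)) (isCycleMin⁻ _ min (k₀ + (c ∸ toℕ k))))
          (least (toℕ k) (ℕₚ.≤-pred (Finₚ.toℕ<n k))))))
        (sym (Finₚ.toℕ-fromℕ< k₀<c)))))
      (λ eq → case k Finₚ.≟ j₀ of λ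
        { (yes refl) → isCycleMin⁺ _ (subst (λ l → ∀ k → toℕ (iter π l i) ≤ toℕ (iter π k (iter π l i)))
                         (sym (Finₚ.toℕ-fromℕ< k₀<c)) least-min)
        ; (no k≢) → case trans (sym eq) (dec-false (k Finₚ.≟ j₀) k≢) of λ () }))

  lengthCount : ℕ → ℕ
  lengthCount m = ∑[ i ∈ allFin n ] ⟦ cycleLen π i ℕₚ.≟ m ⟧

  count-cycleType : ∀ m → count m (cycleType π) ≡ ∑[ i ∈ allFin n ] (b2n (isCycleMin π i) * ⟦ cycleLen π i ℕₚ.≟ m ⟧)
  count-cycleType m = trans (length-filterᵇ (λ x → x ≡ᵇ m) (cycleType π))
    (trans (∑-map (cycleLen π) (filterᵇ (isCycleMin π) (allFin n))) (∑-filterᵇ (isCycleMin π) (allFin n)))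

  count-cycleType-0 : count 0 (cycleType π) ≡ 0
  count-cycleType-0 = trans (count-cycleType 0) (trans
    (∑-cong (allFin n) (λ i → trans (cong (b2n (isCycleMin π i) *_)
      (⟦⟧-no (cycleLen π i ℕₚ.≟ 0) (λ eq → case subst (1 ≤_) eq (nonzero (cycleLen-spec i)) of λ ()))) (ℕₚ.*-zeroʳ (b2n (isCycleMin π i)))))
    (∑-zero (allFin n)))

  -- Each point of a cycle of length m reaches the minimum of the cycle in exactly one of the steps 0, …, m - 1.
  lengthCount-cycleType : ∀ m → lengthCount m ≡ m * count m (cycleType π)
  lengthCount-cycleType m = begin
    lengthCount m
      ≡⟨ ∑-cong (allFin n) (λ i → sym (trans (⟦⟧*-cong (cycleLen π i ℕₚ.≟ m) (λ { refl → ∑-isCycleMin i })) (ℕₚ.*-identityʳ _))) ⟩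
    ∑[ i ∈ allFin n ] (⟦ cycleLen π i ℕₚ.≟ m ⟧ * ∑[ k ∈ allFin m ] b2n (isCycleMin π (iter π (toℕ k) i)))
      ≡⟨ ∑-cong (allFin n) (λ i → trans (sym (∑-*ˡ (allFin m) ⟦ cycleLen π i ℕₚ.≟ m ⟧))
           (∑-cong (allFin m) (λ k → trans (ℕₚ.*-comm ⟦ cycleLen π i ℕₚ.≟ m ⟧ _)
             (cong (λ c → b2n (isCycleMin π (iter π (toℕ k) i)) * ⟦ c ℕₚ.≟ m ⟧) (sym (cycleLen-iter (toℕ k) i)))))) ⟩
    ∑[ i ∈ allFin n ] ∑[ k ∈ allFin m ] F (iter π (toℕ k) i)
      ≡⟨ ∑-swap (allFin n) (allFin m) ⟩
    ∑[ k ∈ allFin m ] ∑[ i ∈ allFin n ] F (iter π (toℕ k) i)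
      ≡⟨ ∑-cong (allFin m) (λ k → ∑-iter (toℕ k) F) ⟩
    ∑[ k ∈ allFin m ] ∑ (allFin n) F
      ≡⟨ ∑-const (allFin m) _ ⟩
    length (allFin m) * ∑ (allFin n) F
      ≡⟨ cong₂ _*_ (Listₚ.length-tabulate {n = m} id) (sym (count-cycleType m)) ⟩
    m * count m (cycleType π) ∎
    where
    open ≡-Reasoning
    F : Fin n → ℕ
    F i = b2n (isCycleMin π i) * ⟦ cycleLen π i ℕₚ.≟ m ⟧

  open PatternCounts (lookup π) (π-inj _ _) using (fixedPoints; twoCyclePoints; threeCyclePoints)

  fixedPoints-cycleType : fixedPoints ≡ count 1 (cycleType π)
  fixedPoints-cycleType = trans
    (∑-cong (allFin n) (λ a → sym (cycleLen-≟ a 1 (lookup π a Finₚ.≟ a)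
      returns (λ eq → cycleLength (s≤s z≤n) eq λ { (suc k) _ (s≤s ()) }))))
    (trans (lengthCount-cycleType 1) (ℕₚ.*-identityˡ _))

  twoCyclePoints-cycleType : twoCyclePoints ≡ 2 * count 2 (cycleType π)
  twoCyclePoints-cycleType = trans
    (∑-cong (allFin n) (λ a → trans
      (sym (⟦⟧-× (¬? (lookup π a Finₚ.≟ a)) (lookup π (lookup π a) Finₚ.≟ a)))
      (sym (cycleLen-≟ a 2 (¬? (lookup π a Finₚ.≟ a) ×-dec (lookup π (lookup π a) Finₚ.≟ a))
        (λ c → first c 1 (s≤s z≤n) (s≤s (s≤s z≤n)) , returns c)
        (λ (≢ , eq) → cycleLength (s≤s z≤n) eq λ { 1 _ _ → ≢ ; (suc (suc _)) _ (s≤s (s≤s ())) })))))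
    (lengthCount-cycleType 2)

  threeCyclePoints-cycleType : threeCyclePoints ≡ 3 * count 3 (cycleType π)
  threeCyclePoints-cycleType = trans
    (∑-cong (allFin n) (λ a → trans
      (sym (⟦⟧-× (¬? (lookup π a Finₚ.≟ a)) (lookup π (lookup π (lookup π a)) Finₚ.≟ a)))
      (sym (cycleLen-≟ a 3 (¬? (lookup π a Finₚ.≟ a) ×-dec (lookup π (lookup π (lookup π a)) Finₚ.≟ a))
        (λ c → first c 1 (s≤s z≤n) (s≤s (s≤s z≤n)) , returns c)
        (λ (≢ , eq) → cycleLength (s≤s z≤n) eq
          -- A return after two steps is impossible: with the return after three it would make `a` a
          -- fixed point.
          λ { 1 _ _ → ≢ ; 2 _ _ ffa≡a → ≢ (trans (cong (lookup π) (sym ffa≡a)) eq) ; (suc (suc (suc _))) _ (s≤s (s≤s (s≤s ()))) })))))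
    (lengthCount-cycleType 3)

-- Conjugation invariance

Inj-tabulate : (f : Fin m → Fin n) → (∀ {i j} → f i ≡ f j → i ≡ j) → Inj (tabulate f)
Inj-tabulate f inj i j eq = inj (trans (sym (Vecₚ.lookup∘tabulate f i)) (trans eq (Vecₚ.lookup∘tabulate f j)))

⟨$⟩ʳ-injective : (τ : Permutation′ n) {i j : Fin n} → τ ⟨$⟩ʳ i ≡ τ ⟨$⟩ʳ j → i ≡ j
⟨$⟩ʳ-injective τ eq = trans (sym (inverseˡ τ)) (trans (cong (τ ⟨$⟩ˡ_) eq) (inverseˡ τ))

conj : Permutation′ n → Vec (Fin n) n → Vec (Fin n) n
conj τ π = tabulate (λ i → τ ⟨$⟩ʳ lookup π (τ ⟨$⟩ˡ i))

lookup-conj : (τ : Permutation′ n) (π : Vec (Fin n) n) (i : Fin n) →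
              lookup (conj τ π) (τ ⟨$⟩ʳ i) ≡ τ ⟨$⟩ʳ lookup π i
lookup-conj τ π i = trans (Vecₚ.lookup∘tabulate _ (τ ⟨$⟩ʳ i)) (cong (λ j → τ ⟨$⟩ʳ lookup π j) (inverseˡ τ))

conj-inverse : (τ : Permutation′ n) (π : Vec (Fin n) n) → conj τ (conj (flip τ) π) ≡ π
conj-inverse τ π = trans
  (Vecₚ.tabulate-cong (λ i → trans (cong (τ ⟨$⟩ʳ_) (Vecₚ.lookup∘tabulate _ (τ ⟨$⟩ˡ i)))
    (trans (inverseʳ τ) (cong (lookup π) (inverseʳ τ)))))
  (Vecₚ.tabulate∘lookup π)

Inj-conj : (τ : Permutation′ n) (π : Vec (Fin n) n) → Inj π → Inj (conj τ π)
Inj-conj τ π inj = Inj-tabulate _ (λ eq → ⟨$⟩ʳ-injective (flip τ) (inj _ _ (⟨$⟩ʳ-injective τ eq)))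

module _ (h : Fin n → Fin m) (h-inj : ∀ {i j} → h i ≡ h j → i ≡ j) (π : Vec (Fin n) n) (ρ : Vec (Fin m) m)
         (equivariant : ∀ i → lookup ρ (h i) ≡ h (lookup π i)) where

  iter-map : ∀ k i → iter ρ k (h i) ≡ h (iter π k i)
  iter-map zero    i = refl
  iter-map (suc k) i = trans (cong (lookup ρ) (iter-map k i)) (equivariant (iter π k i))

  -- Injectivity of `h` excludes earlier returns in the image. Applied to a conjugating bijection
  -- and to the two block inclusions in `addCycle`.
  IsCycleLength-map : ∀ {i c} → IsCycleLength π i c → IsCycleLength ρ (h i) c
  IsCycleLength-map {i} {c} (cycleLength nz ret fst) = cycleLength nz
    (trans (iter-map c i) (cong h ret))
    (λ k 1≤k k<c eq → fst k 1≤k k<c (h-inj (trans (sym (iter-map k i)) eq)))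

-- Multiplicities are recovered from numbers of points by cancelling the length, which is possible
-- for positive lengths only; length 0 never occurs.
cycleType-conj : (τ : Permutation′ n) (π : Vec (Fin n) n) → Inj π →
                 ∀ m → count m (cycleType (conj τ π)) ≡ count m (cycleType π)
cycleType-conj {n} τ π inj zero = trans (Cycles.count-cycleType-0 (conj τ π) (Inj-conj τ π inj)) (sym (Cycles.count-cycleType-0 π inj))
cycleType-conj {n} τ π inj (suc m) = ℕₚ.*-cancelˡ-≡ _ _ (suc m) (begin
  suc m * count (suc m) (cycleType (conj τ π))
    ≡⟨ C′.lengthCount-cycleType (suc m) ⟨
  ∑[ i ∈ allFin n ] ⟦ cycleLen (conj τ π) i ℕₚ.≟ suc m ⟧
    ≡⟨ ∑-reindex (FinEnum n) (FinEnum n) (τ ⟨$⟩ʳ_) (τ ⟨$⟩ˡ_) (λ _ → inverseʳ τ) (λ _ → inverseˡ τ)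
         (λ i → ⟦ cycleLen (conj τ π) i ℕₚ.≟ suc m ⟧) ⟨
  ∑[ i ∈ allFin n ] ⟦ cycleLen (conj τ π) (τ ⟨$⟩ʳ i) ℕₚ.≟ suc m ⟧
    ≡⟨ ∑-cong (allFin n) (λ i → cong (λ c → ⟦ c ℕₚ.≟ suc m ⟧)
         (IsCycleLength-unique (C′.cycleLen-spec (τ ⟨$⟩ʳ i)) (IsCycleLength-map (τ ⟨$⟩ʳ_) (⟨$⟩ʳ-injective τ) π (conj τ π) (lookup-conj τ π) (C.cycleLen-spec i)))) ⟩
  ∑[ i ∈ allFin n ] ⟦ cycleLen π i ℕₚ.≟ suc m ⟧
    ≡⟨ C.lengthCount-cycleType (suc m) ⟩
  suc m * count (suc m) (cycleType π) ∎)
  where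
  open ≡-Reasoning
  module C = Cycles π inj
  module C′ = Cycles (conj τ π) (Inj-conj τ π inj)

-- Membership as a weight on all vectors, rather than as a filtered list, lets conjugation reindex
-- sums over the class.
inClass : List ℕ → Vec (Fin n) n → ℕ
inClass ps π = ⟦ Inj? π ⟧ * b2n (sameMultiset (cycleType π) ps)

inClass-conj : (ps : List ℕ) (τ : Permutation′ n) (π : Vec (Fin n) n) → inClass ps (conj τ π) ≡ inClass ps π
inClass-conj ps τ π = trans
  (cong (_* b2n (sameMultiset (cycleType (conj τ π)) ps)) (⟦⟧-⇔ (Inj? (conj τ π)) (Inj? π)
    (λ inj → subst Inj (conj-inverse (flip τ) π) (Inj-conj (flip τ) (conj τ π) inj)) (Inj-conj τ π)))
  (⟦⟧*-cong (Inj? π) (λ inj → cong b2n (Bool-⇔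
    (λ eq → sameMultiset⁺ (cycleType π) ps (λ m → trans (sym (cycleType-conj τ π inj m)) (sameMultiset⁻ (cycleType (conj τ π)) ps eq m)))
    (λ eq → sameMultiset⁺ (cycleType (conj τ π)) ps (λ m → trans (cycleType-conj τ π inj m) (sameMultiset⁻ (cycleType π) ps eq m))))))

∑-ConjClass : (μ : Partition n) (F : Vec (Fin n) n → ℕ) →
              ∑ (ConjClass n μ) F ≡ ∑[ π ∈ allVecs n n ] (inClass (parts μ) π * F π)
∑-ConjClass {n} μ F = trans (∑-filterᵇ _ (Sym n)) (trans (∑-filterᵇ isPerm (allVecs n n))
  (∑-cong (allVecs n n) (λ π → trans (sym (ℕₚ.*-assoc (b2n (isPerm π)) _ (F π)))
    (cong (λ b → b2n b * b2n (sameMultiset (cycleType π) (parts μ)) * F π) (sym (does-Inj? π))))))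

transpose-left : (i j : Fin n) → transpose i j ⟨$⟩ʳ i ≡ j
transpose-left i j rewrite dec-true (i Finₚ.≟ i) refl = refl

transpose-other : (i j k : Fin n) → k ≢ i → k ≢ j → transpose i j ⟨$⟩ʳ k ≡ k
transpose-other i j k k≢i k≢j rewrite dec-false (k Finₚ.≟ i) k≢i | dec-false (k Finₚ.≟ j) k≢j = refl

Inj-∷⁻ : (x : Fin n) (w : Vec (Fin n) m) → Inj (x ∷ w) → Inj w × (∀ i → lookup w i ≢ x)
Inj-∷⁻ x w inj = (λ i j eq → Finₚ.suc-injective (inj (suc i) (suc j) eq)) , (λ i eq → case inj (suc i) zero eq of λ ())

-- Induction on the length: once `τ` is right on the tails, composing with the transposition of the
-- image of `x` and `y` corrects the head and moves no entry of the tail `w`.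
transitive : (v w : Vec (Fin n) m) → Inj v → Inj w → ∃ λ τ → ∀ i → τ ⟨$⟩ʳ lookup v i ≡ lookup w i
transitive []      []      _ _ = Perm.id , λ ()
transitive (x ∷ v) (y ∷ w) inj-xv inj-yw
  with inj-v , x∉v ← Inj-∷⁻ x v inj-xv | inj-w , y∉w ← Inj-∷⁻ y w inj-yw
  with τ , τv≡w ← transitive v w inj-v inj-w
  = τ ∘ₚ transpose (τ ⟨$⟩ʳ x) y , λ
    { zero    → transpose-left (τ ⟨$⟩ʳ x) y
    ; (suc i) → trans (transpose-other (τ ⟨$⟩ʳ x) y (τ ⟨$⟩ʳ lookup v i)
                  (λ eq → x∉v i (⟨$⟩ʳ-injective τ eq)) (λ eq → y∉w i (trans (sym (τv≡w i)) eq))) (τv≡w i) }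

WellFormed : ℕ → Triple → Set
WellFormed j (x , y , z) = 3 ≤ j × x < j × y < j × z < j

opaque
  wellFormed : AllClass (λ j ℓ t → WellFormed j t)
  wellFormed = from-yes (All.all? (λ j → All.all? (λ ℓ → All.all? (λ (x , y , z) →
    (3 ℕₚ.≤? j) ×-dec (x ℕₚ.<? j) ×-dec (y ℕₚ.<? j) ×-dec (z ℕₚ.<? j)) (triClass j ℓ)) (labels j)) sizes)

at-fromℕ< : (w : Vec (Fin n) m) {s : ℕ} (s<m : s < m) → at w s ≡ toℕ (lookup w (fromℕ< s<m))
at-fromℕ< w s<m = trans (cong (at w) (sym (Finₚ.toℕ-fromℕ< s<m))) (at-lookup w (fromℕ< s<m))

module _ {n m : ℕ} (τ : Permutation′ n) (v w : Vec (Fin n) m) (τv≡w : ∀ i → τ ⟨$⟩ʳ lookup v i ≡ lookup w i)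
         (π : Vec (Fin n) n) where

  hit-conj : {s x : ℕ} (s<m : s < m) (x<m : x < m) →
             ⟦ at (conj τ π) (at w s) ℕₚ.≟ at w x ⟧ ≡ ⟦ at π (at v s) ℕₚ.≟ at v x ⟧
  hit-conj {s} {x} s<m x<m = begin
    ⟦ at (conj τ π) (at w s) ℕₚ.≟ at w x ⟧
      ≡⟨ cong₂ (λ a b → ⟦ a ℕₚ.≟ b ⟧) (two-step (conj τ π) w) (at-fromℕ< w x<m) ⟩
    ⟦ toℕ (lookup (conj τ π) (lookup w i)) ℕₚ.≟ toℕ (lookup w j) ⟧
      ≡⟨ cong₂ (λ a b → ⟦ toℕ (lookup (conj τ π) a) ℕₚ.≟ toℕ b ⟧) (sym (τv≡w i)) (sym (τv≡w j)) ⟩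
    ⟦ toℕ (lookup (conj τ π) (τ ⟨$⟩ʳ lookup v i)) ℕₚ.≟ toℕ (τ ⟨$⟩ʳ lookup v j) ⟧
      ≡⟨ cong (λ a → ⟦ toℕ a ℕₚ.≟ toℕ (τ ⟨$⟩ʳ lookup v j) ⟧) (lookup-conj τ π (lookup v i)) ⟩
    ⟦ toℕ (τ ⟨$⟩ʳ lookup π (lookup v i)) ℕₚ.≟ toℕ (τ ⟨$⟩ʳ lookup v j) ⟧
      ≡⟨ ⟦⟧-⇔ (_ ℕₚ.≟ _) (_ ℕₚ.≟ _) (λ eq → cong toℕ (⟨$⟩ʳ-injective τ (Finₚ.toℕ-injective eq)))
           (λ eq → cong (λ a → toℕ (τ ⟨$⟩ʳ a)) (Finₚ.toℕ-injective eq)) ⟩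
    ⟦ toℕ (lookup π (lookup v i)) ℕₚ.≟ toℕ (lookup v j) ⟧
      ≡⟨ cong₂ (λ a b → ⟦ a ℕₚ.≟ b ⟧) (two-step π v) (at-fromℕ< v x<m) ⟨
    ⟦ at π (at v s) ℕₚ.≟ at v x ⟧ ∎
    where
    open ≡-Reasoning
    i = fromℕ< s<m
    j = fromℕ< x<m
    two-step : (ρ : Vec (Fin n) n) (u : Vec (Fin n) m) → at ρ (at u s) ≡ toℕ (lookup ρ (lookup u i))
    two-step ρ u = trans (cong (at ρ) (at-fromℕ< u s<m)) (at-lookup ρ (lookup u i))

  match-conj : (t : Triple) → WellFormed m t → match (conj τ π) w t ≡ match π v t
  match-conj (x , y , z) (3≤m , x<m , y<m , z<m) = cong₂ _*_
    (hit-conj (ℕₚ.≤-trans (s≤s z≤n) 3≤m) x<m)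
    (cong₂ _*_ (hit-conj (ℕₚ.≤-trans (s≤s (s≤s z≤n)) 3≤m) y<m) (hit-conj 3≤m z<m))

classMatches : (n : ℕ) → List ℕ → Vec (Fin n) m → Triple → ℕ
classMatches n ps w t = ∑[ π ∈ allVecs n n ] (inClass ps π * match π w t)

-- S_n acts transitively on injective tuples and preserves the class by conjugation.
classMatches-constant : (ps : List ℕ) (t : Triple) → WellFormed m t → (v w : Vec (Fin n) m) → Inj v → Inj w →
                        classMatches n ps v t ≡ classMatches n ps w t
classMatches-constant {n = n} ps t wf v w inj-v inj-w with τ , τv≡w ← transitive v w inj-v inj-w = begin
  ∑[ π ∈ allVecs n n ] (inClass ps π * match π v t)
    ≡⟨ ∑-cong (allVecs n n) (λ π → cong₂ _*_ (inClass-conj ps τ π) (match-conj τ v w τv≡w π t wf)) ⟨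
  ∑[ π ∈ allVecs n n ] (inClass ps (conj τ π) * match (conj τ π) w t)
    ≡⟨ ∑-reindex (VecEnum n n) (VecEnum n n) (conj τ) (conj (flip τ)) (conj-inverse τ) (conj-inverse (flip τ))
         (λ π → inClass ps π * match π w t) ⟩
  ∑[ π ∈ allVecs n n ] (inClass ps π * match π w t) ∎
  where open ≡-Reasoning

-- Double counting over the conjugacy class

∑Inj-*ˡ : (k : ℕ) {F : Vec (Fin n) m → ℕ} → ∑Inj n m (λ w → k * F w) ≡ k * ∑Inj n m F
∑Inj-*ˡ k {F} = trans (∑Inj-cong (λ w _ → ℕₚ.*-comm k (F w))) (trans (∑Inj-*ʳ k) (ℕₚ.*-comm _ k))

-- The constant value of `F` is never named: it is absorbed by summing over a second tuple `v`,
-- which stays valid when there is no injective tuple at all.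
∑Inj-constant-* : (F G : Vec (Fin n) m → ℕ) → (∀ v w → Inj v → Inj w → F v ≡ F w) →
                  (n P m) * ∑Inj n m (λ w → F w * G w) ≡ ∑Inj n m F * ∑Inj n m G
∑Inj-constant-* {n} {m} F G const = begin
  (n P m) * ∑Inj n m (λ w → F w * G w)
    ≡⟨ cong (_* ∑Inj n m (λ w → F w * G w)) (∑Inj-1 n m) ⟨
  ∑Inj n m (λ _ → 1) * ∑Inj n m (λ w → F w * G w)
    ≡⟨ ∑Inj-*ˡ (∑Inj n m (λ _ → 1)) ⟨
  ∑Inj n m (λ w → ∑Inj n m (λ _ → 1) * (F w * G w))
    ≡⟨ ∑Inj-cong (λ w inj-w → trans (sym (ℕₚ.*-assoc (∑Inj n m (λ _ → 1)) (F w) (G w))) (cong (_* G w)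
         (trans (sym (∑Inj-*ʳ (F w) {λ _ → 1})) (∑Inj-cong (λ v inj-v → trans (ℕₚ.*-identityˡ (F w)) (const w v inj-w inj-v)))))) ⟩
  ∑Inj n m (λ w → ∑Inj n m F * G w)
    ≡⟨ ∑Inj-*ˡ (∑Inj n m F) ⟩
  ∑Inj n m F * ∑Inj n m G ∎
  where open ≡-Reasoning

K-φ : VPattern → ℕ → ℕ → ℕ → ℕ → ℕ
K-φ φ n a b c = b2n (CI φ n a b c)

O-φ : VPattern → ℕ → ℕ → ℕ → ℕ
O-φ φ x y z = b2n (sameOrder (x , y , z) (φcTriple φ))

weight-φ : VPattern → Vec (Fin n) m → Triple → ℕ
weight-φ {n} φ w (x , y , z) = K-φ φ n (at w 0) (at w 1) (at w 2) * O-φ φ (at w x) (at w y) (at w z)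

∑-triplesFin : (F : Fin n × Fin n × Fin n → ℕ) →
               ∑ (triplesFin n) F ≡ ∑[ w ∈ allVecs n 3 ] F (lookup w 0F , lookup w 1F , lookup w 2F)
∑-triplesFin {n} F = begin
  ∑ (triplesFin n) F
    ≡⟨ trans (∑-concatMap _ (allFin n)) (∑-cong (allFin n) λ a → trans (∑-concatMap _ (allFin n)) (∑-cong (allFin n) λ b → ∑-map _ (allFin n))) ⟩
  ∑[ a ∈ allFin n ] ∑[ b ∈ allFin n ] ∑[ c ∈ allFin n ] F (a , b , c)
    ≡⟨ trans (∑-allVecs-∷ʳ G) (trans (∑-allVecs-∷ʳ (λ v → ∑[ x ∈ allFin n ] G (v ∷ʳ x)))
         (trans (∑-allVecs-∷ʳ (λ v → ∑[ y ∈ allFin n ] ∑[ x ∈ allFin n ] G (v ∷ʳ y ∷ʳ x))) (ℕₚ.+-identityʳ _))) ⟨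
  ∑ (allVecs n 3) G ∎
  where
  open ≡-Reasoning
  G : Vec (Fin n) 3 → ℕ
  G w = F (lookup w 0F , lookup w 1F , lookup w 2F)

CI-increasing : (φ : VPattern) (m a b c : ℕ) → CI φ m a b c ≡ true → a < b × b < c
CI-increasing φ m a b c eq = ℕₚ.<ᵇ⇒< a b (subst T (sym (proj₁ (∧-true eq))) tt) ,
  ℕₚ.<ᵇ⇒< b c (subst T (sym (proj₁ (∧-true {b <ᵇ c} (proj₂ (∧-true {a <ᵇ b} eq))))) tt)

increasing⇒Inj : (a b c : Fin n) → toℕ a < toℕ b → toℕ b < toℕ c → Inj (a ∷ b ∷ c ∷ [])
increasing⇒Inj a b c a<b b<c 0F 0F eq   = refl
increasing⇒Inj a b c a<b b<c 0F 1F refl = contradiction a<b (ℕₚ.<-irrefl refl)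
increasing⇒Inj a b c a<b b<c 0F 2F refl = contradiction (ℕₚ.<-trans a<b b<c) (ℕₚ.<-irrefl refl)
increasing⇒Inj a b c a<b b<c 1F 0F refl = contradiction a<b (ℕₚ.<-irrefl refl)
increasing⇒Inj a b c a<b b<c 1F 1F eq   = refl
increasing⇒Inj a b c a<b b<c 1F 2F refl = contradiction b<c (ℕₚ.<-irrefl refl)
increasing⇒Inj a b c a<b b<c 2F 0F refl = contradiction (ℕₚ.<-trans a<b b<c) (ℕₚ.<-irrefl refl)
increasing⇒Inj a b c a<b b<c 2F 1F refl = contradiction b<c (ℕₚ.<-irrefl refl)
increasing⇒Inj a b c a<b b<c 2F 2F eq   = refl

opaque
  unfolding ∑Inj

  -- `CI` forces increasing positions, hence distinct ones, so restricting to injective triples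
  -- loses nothing.
  pat-∑Inj : (φ : VPattern) (π : Vec (Fin n) n) → pat φ π ≡
    ∑Inj n 3 (λ w → K-φ φ n (at w 0) (at w 1) (at w 2) * O-φ φ (at π (at w 0)) (at π (at w 1)) (at π (at w 2)))
  pat-∑Inj {n} φ π = trans (length-filterᵇ _ (triplesFin n)) (trans (∑-triplesFin occurs) (∑-cong (allVecs n 3) step))
    where
    occurs : Fin n × Fin n × Fin n → ℕ
    occurs (a , b , c) = b2n (CI φ n (toℕ a) (toℕ b) (toℕ c) ∧
      sameOrder (toℕ (lookup π a) , toℕ (lookup π b) , toℕ (lookup π c)) (φcTriple φ))
    step : (w : Vec (Fin n) 3) → occurs (lookup w 0F , lookup w 1F , lookup w 2F)
               ≡ ⟦ Inj? w ⟧ * (K-φ φ n (at w 0) (at w 1) (at w 2) * O-φ φ (at π (at w 0)) (at π (at w 1)) (at π (at w 2)))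
    step w@(a ∷ b ∷ c ∷ []) rewrite at-lookup π a | at-lookup π b | at-lookup π c
      with CI φ n (toℕ a) (toℕ b) (toℕ c) in eq
    ... | false = sym (ℕₚ.*-zeroʳ ⟦ Inj? w ⟧)
    ... | true  = sym (trans (cong₂ _*_ (⟦⟧-yes (Inj? w)
            (let a<b , b<c = CI-increasing φ n (toℕ a) (toℕ b) (toℕ c) eq in increasing⇒Inj a b c a<b b<c))
            (ℕₚ.*-identityˡ _)) (ℕₚ.*-identityˡ _))

∑-∑Inj : (xs : List A) (c : A → ℕ) {F : A → Vec (Fin n) m → ℕ} →
         ∑[ x ∈ xs ] (c x * ∑Inj n m (F x)) ≡ ∑Inj n m (λ w → ∑[ x ∈ xs ] (c x * F x w))
∑-∑Inj {n = n} {m} xs c {F} = trans (∑-cong xs (λ x → sym (∑Inj-*ˡ (c x)))) (sym (∑Inj-∑ xs))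

∑-pat : (φ : VPattern) (ps : List ℕ) →
        ∑[ π ∈ allVecs n n ] (inClass ps π * pat φ π) ≡
        ∑class (λ j ℓ t → ∑Inj n j (λ w → classMatches n ps w t * weight-φ φ w t))
∑-pat {n} φ ps = begin
  ∑[ π ∈ allVecs n n ] (inClass ps π * pat φ π)
    ≡⟨ ∑-cong (allVecs n n) (λ π → trans (ℕₚ.*-assoc ⟦ Inj? π ⟧ _ _) (trans
         (⟦⟧*-cong (Inj? π) (λ inj → cong (b2n (sameMultiset (cycleType π) ps) *_)
           (trans (pat-∑Inj φ π) (Decomposition.decomposition π inj (K-φ φ n) (O-φ φ)))))
         (sym (ℕₚ.*-assoc ⟦ Inj? π ⟧ _ _)))) ⟩
  ∑[ π ∈ allVecs n n ] (inClass ps π * ∑class (λ j ℓ t → ∑Inj n j (λ w → match π w t * weight-φ φ w t)))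
    ≡⟨ ∑-cong (allVecs n n) (λ π → sym (∑class-*ˡ (inClass ps π))) ⟩
  ∑[ π ∈ allVecs n n ] ∑class (λ j ℓ t → inClass ps π * ∑Inj n j (λ w → match π w t * weight-φ φ w t))
    ≡⟨ ∑class-∑ (allVecs n n) ⟩
  ∑class (λ j ℓ t → ∑[ π ∈ allVecs n n ] (inClass ps π * ∑Inj n j (λ w → match π w t * weight-φ φ w t)))
    ≡⟨ ∑class-cong (universalClass (λ {j} t → trans (∑-∑Inj (allVecs n n) (inClass ps))
         (∑Inj-cong (λ w _ → trans (∑-cong (allVecs n n) (λ π → sym (ℕₚ.*-assoc (inClass ps π) _ _)))
           (∑-*ʳ (allVecs n n) (weight-φ φ w t)))))) ⟩
  ∑class (λ j ℓ t → ∑Inj n j (λ w → classMatches n ps w t * weight-φ φ w t)) ∎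
  where open ≡-Reasoning

-- Every `π` in the class has the same numbers of cycles of lengths 1, 2, 3, hence the same number
-- of matching tuples, given by `H`; the signs in `H` are the reason for stating this in ℤ.
∑Inj-classMatches : (μ : Partition n) → AllClass (λ j ℓ t →
  ℤ.+ ∑Inj n j (λ w → classMatches n (parts μ) w t) ≡
  ℤ.+ length (ConjClass n μ) ℤ.* H j ℓ (ℤ.+ n) (ℤ.+ pp μ) (ℤ.+ qq μ) (ℤ.+ rr μ))
∑Inj-classMatches {n} μ = All.tabulate λ {j} j∈ → All.tabulate λ {ℓ} ℓ∈ → All.tabulate λ {t} t∈ → begin
  ℤ.+ ∑Inj n j (λ w → classMatches n (parts μ) w t)
    ≡⟨ cong toℤ (∑-∑Inj (allVecs n n) (inClass (parts μ)) {λ π w → match π w t}) ⟨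
  ℤ.+ ∑[ π ∈ allVecs n n ] (inClass (parts μ) π * ∑Inj n j (λ w → match π w t))
    ≡⟨ ℤ-∑ (allVecs n n) (inClass (parts μ)) (λ π → ∑Inj n j (λ w → match π w t)) (H j ℓ (ℤ.+ n) (ℤ.+ pp μ) (ℤ.+ qq μ) (ℤ.+ rr μ))
         (λ π → value j∈ ℓ∈ t∈ π) ⟩
  ℤ.+ ∑[ π ∈ allVecs n n ] (inClass (parts μ) π * 1) ℤ.* H j ℓ (ℤ.+ n) (ℤ.+ pp μ) (ℤ.+ qq μ) (ℤ.+ rr μ)
    ≡⟨ cong (λ k → ℤ.+ k ℤ.* H j ℓ (ℤ.+ n) (ℤ.+ pp μ) (ℤ.+ qq μ) (ℤ.+ rr μ))
         (trans (sym (∑-ConjClass μ (λ _ → 1))) (sym (length-∑ (ConjClass n μ)))) ⟩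
  ℤ.+ length (ConjClass n μ) ℤ.* H j ℓ (ℤ.+ n) (ℤ.+ pp μ) (ℤ.+ qq μ) (ℤ.+ rr μ) ∎
  where
  open ≡-Reasoning
  open import Data.List.Membership.Propositional using () renaming (_∈_ to _∈ₗ_)
  ℤ-∑ : (xs : List A) (c g : A → ℕ) (h : ℤ) → (∀ x → c x ≡ 0 ⊎ ℤ.+ g x ≡ h) →
        ℤ.+ ∑[ x ∈ xs ] (c x * g x) ≡ ℤ.+ ∑[ x ∈ xs ] (c x * 1) ℤ.* h
  ℤ-∑ []       c g h eq = refl
  ℤ-∑ (x ∷ xs) c g h eq = begin
    ℤ.+ (c x * g x + ∑[ x ∈ xs ] (c x * g x))
      ≡⟨ ℤₚ.pos-+ (c x * g x) _ ⟩
    ℤ.+ (c x * g x) ℤ.+ ℤ.+ ∑[ x ∈ xs ] (c x * g x)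
      ≡⟨ cong₂ ℤ._+_ head (ℤ-∑ xs c g h eq) ⟩
    ℤ.+ (c x * 1) ℤ.* h ℤ.+ ℤ.+ ∑[ x ∈ xs ] (c x * 1) ℤ.* h
      ≡⟨ ℤₚ.*-distribʳ-+ h (ℤ.+ (c x * 1)) (ℤ.+ ∑[ x ∈ xs ] (c x * 1)) ⟨
    (ℤ.+ (c x * 1) ℤ.+ ℤ.+ ∑[ x ∈ xs ] (c x * 1)) ℤ.* h
      ≡⟨ cong (ℤ._* h) (ℤₚ.pos-+ (c x * 1) _) ⟨
    ℤ.+ (c x * 1 + ∑[ x ∈ xs ] (c x * 1)) ℤ.* h ∎
    where
    head : ℤ.+ (c x * g x) ≡ ℤ.+ (c x * 1) ℤ.* h
    head with c x | eq x
    ... | _ | inj₁ refl = refl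
    ... | k | inj₂ refl = trans (ℤₚ.pos-* k (g x)) (cong (λ l → ℤ.+ l ℤ.* ℤ.+ g x) (sym (ℕₚ.*-identityʳ k)))
  value : ∀ {j ℓ t} → j ∈ₗ sizes → ℓ ∈ₗ labels j → t ∈ₗ triClass j ℓ → ∀ π →
    inClass (parts μ) π ≡ 0 ⊎ ℤ.+ ∑Inj n j (λ w → match π w t) ≡ H j ℓ (ℤ.+ n) (ℤ.+ pp μ) (ℤ.+ qq μ) (ℤ.+ rr μ)
  value {j} {ℓ} {t} j∈ ℓ∈ t∈ π with Inj? π | sameMultiset (cycleType π) (parts μ) in same
  ... | no _    | _     = inj₁ refl
  ... | yes _   | false = inj₁ refl
  ... | yes inj | true  = inj₂ (trans
      (All.lookup (All.lookup (All.lookup (Decomposition.match-value π inj (qq μ) (rr μ)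
        (trans (Cycles.twoCyclePoints-cycleType π inj) (cong (2 *_) (counts 2)))
        (trans (Cycles.threeCyclePoints-cycleType π inj) (cong (3 *_) (counts 3)))) j∈) ℓ∈) t∈)
      (cong (λ p → H j ℓ (ℤ.+ n) (ℤ.+ p) (ℤ.+ qq μ) (ℤ.+ rr μ)) (trans (Cycles.fixedPoints-cycleType π inj) (counts 1))))
    where
    counts : ∀ m → count m (cycleType π) ≡ count m (parts μ)
    counts = sameMultiset⁻ (cycleType π) (parts μ) same

-- Increasing sequences with prescribed tight gaps

-- Ways to write `s` as an ordered sum of `f` numbers, zero allowed; the recursion asks whether the
-- first summand is 0.
weakCompositions : ℕ → ℕ → ℕ
weakCompositions f       zero    = 1
weakCompositions zero    (suc s) = 0
weakCompositions (suc f) (suc s) = weakCompositions f (suc s) + weakCompositions (suc f) s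

weakCompositions-1 : ∀ s → weakCompositions 1 s ≡ 1
weakCompositions-1 zero    = refl
weakCompositions-1 (suc s) = weakCompositions-1 s

-- Stars and bars, by Pascal's rule.
weakCompositions-C : ∀ c s → weakCompositions (suc c) s ≡ (s + c) C c
weakCompositions-C c       zero    = sym (Comb.nCn≡1 c)
weakCompositions-C zero    (suc s) = weakCompositions-C zero s
weakCompositions-C (suc c) (suc s) = begin
  weakCompositions (suc c) (suc s) + weakCompositions (suc (suc c)) s ≡⟨ cong₂ _+_ (weakCompositions-C c (suc s)) (weakCompositions-C (suc c) s) ⟩
  (suc s + c) C c + (s + suc c) C suc c     ≡⟨ cong (λ k → k C c + (s + suc c) C suc c) (sym (ℕₚ.+-suc s c)) ⟩
  (s + suc c) C c + (s + suc c) C suc c     ≡⟨ Comb.nCk+nC[k+1]≡[n+1]C[k+1] (s + suc c) c ⟩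
  suc (s + suc c) C suc c                   ∎
  where open ≡-Reasoning

-- bs marks the gaps in the sequence p - 1, v₀, v₁, …, n that have to be tight.
Chain : ℕ → (ℕ → Bool) → Vec (Fin n) m → Set
Chain {n} p bs []      = p ≤ n × (bs 0 ≡ true → n ≡ p)
Chain     p bs (x ∷ v) = (p ≤ toℕ x × (bs 0 ≡ true → toℕ x ≡ p)) × Chain (suc (toℕ x)) (bs ∘ suc) v

gap? : (b : Bool) (x y : ℕ) → Dec (b ≡ true → x ≡ y)
gap? false x y = yes λ ()
gap? true  x y = map′ (λ eq _ → eq) (λ f → f refl) (x ℕₚ.≟ y)

Chain? : (p : ℕ) (bs : ℕ → Bool) (v : Vec (Fin n) m) → Dec (Chain p bs v)
Chain? {n} p bs []      = (p ℕₚ.≤? n) ×-dec gap? (bs 0) n p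
Chain?     p bs (x ∷ v) = ((p ℕₚ.≤? toℕ x) ×-dec gap? (bs 0) (toℕ x) p) ×-dec Chain? (suc (toℕ x)) (bs ∘ suc) v

Chain-bound : (p : ℕ) (bs : ℕ → Bool) (v : Vec (Fin n) m) → Chain p bs v → p + m ≤ n
Chain-bound         p bs []      (p≤n , _)        = subst (_≤ _) (sym (ℕₚ.+-identityʳ p)) p≤n
Chain-bound {m = suc m} p bs (x ∷ v) ((p≤x , _) , ch) = ℕₚ.≤-trans
  (subst (p + suc m ≤_) (ℕₚ.+-suc (toℕ x) m) (ℕₚ.+-monoˡ-≤ (suc m) p≤x))
  (Chain-bound (suc (toℕ x)) (bs ∘ suc) v ch)

chains : (n m p : ℕ) → (ℕ → Bool) → ℕ
chains n m p bs = ∑[ v ∈ allVecs n m ] ⟦ Chain? p bs v ⟧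

chains-zero : (n m p : ℕ) (bs : ℕ → Bool) → n < p + m → chains n m p bs ≡ 0
chains-zero n m p bs n< = trans
  (∑-cong (allVecs n m) (λ v → ⟦⟧-no (Chain? p bs v) (λ ch → ℕₚ.<⇒≱ n< (Chain-bound p bs v ch))))
  (∑-zero (allVecs n m))

module _ (n m p : ℕ) (bs : ℕ → Bool) where

  chains-suc : chains n (suc m) p bs ≡
    ∑[ x ∈ allFin n ] (⟦ (p ℕₚ.≤? toℕ x) ×-dec gap? (bs 0) (toℕ x) p ⟧ * chains n m (suc (toℕ x)) (bs ∘ suc))
  chains-suc = begin
    ∑[ v ∈ allVecs n (suc m) ] ⟦ Chain? p bs v ⟧
      ≡⟨ ∑-allVecs-suc {n} {m} (λ v → ⟦ Chain? p bs v ⟧) ⟩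
    ∑[ v ∈ allVecs n m ] ∑[ x ∈ allFin n ] ⟦ Chain? p bs (x ∷ v) ⟧
      ≡⟨ ∑-swap (allVecs n m) (allFin n) ⟩
    ∑[ x ∈ allFin n ] ∑[ v ∈ allVecs n m ] ⟦ Chain? p bs (x ∷ v) ⟧
      ≡⟨ ∑-cong (allFin n) (λ x → trans
           (∑-cong (allVecs n m) (λ v → ⟦⟧-× ((p ℕₚ.≤? toℕ x) ×-dec gap? (bs 0) (toℕ x) p) (Chain? (suc (toℕ x)) (bs ∘ suc) v)))
           (∑-*ˡ (allVecs n m) ⟦ (p ℕₚ.≤? toℕ x) ×-dec gap? (bs 0) (toℕ x) p ⟧)) ⟩
    ∑[ x ∈ allFin n ] (⟦ (p ℕₚ.≤? toℕ x) ×-dec gap? (bs 0) (toℕ x) p ⟧ * chains n m (suc (toℕ x)) (bs ∘ suc)) ∎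
    where open ≡-Reasoning

  first-at : (p<n : p < n) (F : ℕ → ℕ) → ∑[ x ∈ allFin n ] (⟦ toℕ x ℕₚ.≟ p ⟧ * F (toℕ x)) ≡ F p
  first-at p<n F = begin
    ∑[ x ∈ allFin n ] (⟦ toℕ x ℕₚ.≟ p ⟧ * F (toℕ x))
      ≡⟨ ∑-cong (allFin n) (λ x → cong (_* F (toℕ x)) (⟦⟧-⇔ (toℕ x ℕₚ.≟ p) (x Finₚ.≟ fromℕ< p<n)
           (λ eq → Finₚ.toℕ-injective (trans eq (sym (Finₚ.toℕ-fromℕ< p<n))))
           (λ eq → trans (cong toℕ eq) (Finₚ.toℕ-fromℕ< p<n)))) ⟩
    ∑[ x ∈ allFin n ] (⟦ x Finₚ.≟ fromℕ< p<n ⟧ * F (toℕ x))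
      ≡⟨ Enum.∑-δ (FinEnum n) (fromℕ< p<n) (F ∘ toℕ) ⟩
    F (toℕ (fromℕ< p<n))
      ≡⟨ cong F (Finₚ.toℕ-fromℕ< p<n) ⟩
    F p ∎
    where open ≡-Reasoning

chains-tight : ∀ n m p bs → p < n → bs 0 ≡ true → chains n (suc m) p bs ≡ chains n m (suc p) (bs ∘ suc)
chains-tight n m p bs p<n tight = trans (chains-suc n m p bs) (trans
  (∑-cong (allFin n) (λ x → cong (_* chains n m (suc (toℕ x)) (bs ∘ suc))
    (⟦⟧-⇔ ((p ℕₚ.≤? toℕ x) ×-dec gap? (bs 0) (toℕ x) p) (toℕ x ℕₚ.≟ p)
      (λ (_ , gap) → gap tight) (λ eq → ℕₚ.≤-reflexive (sym eq) , λ _ → eq))))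
  (first-at n m p bs p<n (λ x → chains n m (suc x) (bs ∘ suc))))

-- The first entry is either `p` itself or larger, and in the latter case the sequence may as well
-- start from `p + 1`, its first gap still being free.
chains-free : ∀ n m p bs → p < n → bs 0 ≡ false →
              chains n (suc m) p bs ≡ chains n m (suc p) (bs ∘ suc) + chains n (suc m) (suc p) bs
chains-free n m p bs p<n free = begin
  chains n (suc m) p bs
    ≡⟨ chains-suc n m p bs ⟩
  ∑[ x ∈ allFin n ] (⟦ (p ℕₚ.≤? toℕ x) ×-dec gap? (bs 0) (toℕ x) p ⟧ * F (toℕ x))
    ≡⟨ ∑-cong (allFin n) (λ x → trans (cong (_* F (toℕ x)) (split (toℕ x)))
         (ℕₚ.*-distribʳ-+ (F (toℕ x)) ⟦ toℕ x ℕₚ.≟ p ⟧ _)) ⟩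
  ∑[ x ∈ allFin n ] (⟦ toℕ x ℕₚ.≟ p ⟧ * F (toℕ x) + ⟦ (suc p ℕₚ.≤? toℕ x) ×-dec gap? (bs 0) (toℕ x) (suc p) ⟧ * F (toℕ x))
    ≡⟨ ∑-+ (allFin n) ⟩
  ∑[ x ∈ allFin n ] (⟦ toℕ x ℕₚ.≟ p ⟧ * F (toℕ x)) +
  ∑[ x ∈ allFin n ] (⟦ (suc p ℕₚ.≤? toℕ x) ×-dec gap? (bs 0) (toℕ x) (suc p) ⟧ * F (toℕ x))
    ≡⟨ cong₂ _+_ (first-at n m p bs p<n F) (sym (chains-suc n m (suc p) bs)) ⟩
  chains n m (suc p) (bs ∘ suc) + chains n (suc m) (suc p) bs ∎
  where
  open ≡-Reasoning
  F : ℕ → ℕ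
  F x = chains n m (suc x) (bs ∘ suc)
  no-gap : ∀ {A : Set} → bs 0 ≡ true → A
  no-gap tight = case trans (sym tight) free of λ ()
  split : ∀ x → ⟦ (p ℕₚ.≤? x) ×-dec gap? (bs 0) x p ⟧ ≡ ⟦ x ℕₚ.≟ p ⟧ + ⟦ (suc p ℕₚ.≤? x) ×-dec gap? (bs 0) x (suc p) ⟧
  split x with ℕₚ.<-cmp x p
  ... | tri< x<p _ _ = trans (⟦⟧-no ((p ℕₚ.≤? x) ×-dec gap? (bs 0) x p) (λ (p≤x , _) → ℕₚ.<⇒≱ x<p p≤x))
          (sym (cong₂ _+_ (⟦⟧-no (x ℕₚ.≟ p) (ℕₚ.<⇒≢ x<p))
            (⟦⟧-no ((suc p ℕₚ.≤? x) ×-dec gap? (bs 0) x (suc p)) (λ (p<x , _) → ℕₚ.<-asym x<p p<x))))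
  ... | tri≈ _ refl _ = trans (⟦⟧-yes ((p ℕₚ.≤? x) ×-dec gap? (bs 0) x p) (ℕₚ.≤-refl , no-gap))
          (sym (cong₂ _+_ (⟦⟧-yes (x ℕₚ.≟ p) refl)
            (⟦⟧-no ((suc p ℕₚ.≤? x) ×-dec gap? (bs 0) x (suc p)) (λ (p<x , _) → ℕₚ.<-irrefl refl p<x))))
  ... | tri> _ _ p<x = trans (⟦⟧-yes ((p ℕₚ.≤? x) ×-dec gap? (bs 0) x p) (ℕₚ.<⇒≤ p<x , no-gap))
          (sym (cong₂ _+_ (⟦⟧-no (x ℕₚ.≟ p) (ℕₚ.<⇒≢ p<x ∘ sym))
            (⟦⟧-yes ((suc p ℕₚ.≤? x) ×-dec gap? (bs 0) x (suc p)) (p<x , no-gap))))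

-- `m` entries leave `m + 1` gaps, the last one before `n`.
frees : ℕ → (ℕ → Bool) → ℕ
frees zero    bs = b2n (not (bs 0))
frees (suc m) bs = b2n (not (bs 0)) + frees m (bs ∘ suc)

-- The surplus `s` is what remains of the range after placing `m` entries; it is distributed among
-- the gaps that are not tight.
chains-count : ∀ n m p bs s → p + m + s ≡ n → chains n m p bs ≡ weakCompositions (frees m bs) s
chains-count n zero p bs s refl = trans (ℕₚ.+-identityʳ _) (trans (⟦⟧-× (p ℕₚ.≤? p + 0 + s) (gap? (bs 0) (p + 0 + s) p))
  (trans (cong (_* ⟦ gap? (bs 0) (p + 0 + s) p ⟧) (⟦⟧-yes (p ℕₚ.≤? p + 0 + s)
    (ℕₚ.≤-trans (ℕₚ.m≤m+n p 0) (ℕₚ.m≤m+n (p + 0) s)))) (trans (ℕₚ.*-identityˡ _) (last (bs 0) s))))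
  where
  last : ∀ b s → ⟦ gap? b (p + 0 + s) p ⟧ ≡ weakCompositions (b2n (not b)) s
  last false s       = sym (weakCompositions-1 s)
  last true  zero    = ⟦⟧-yes (gap? true (p + 0 + 0) p) (λ _ → trans (ℕₚ.+-identityʳ _) (ℕₚ.+-identityʳ p))
  last true  (suc s) = ⟦⟧-no (gap? true (p + 0 + suc s) p)
    (λ eq → ℕₚ.m+1+n≢m p (trans (sym (cong (_+ suc s) (ℕₚ.+-identityʳ p))) (eq refl)))
chains-count n (suc m) p bs s eq = cases (bs 0) refl s eq
  where
  shift : ∀ {s} → p + suc m + s ≡ n → suc p + m + s ≡ n
  shift {s} eq = trans (cong (_+ s) (sym (ℕₚ.+-suc p m))) eq
  p<n : ∀ {s} → p + suc m + s ≡ n → p < n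
  p<n {s} eq = subst (p <_) eq (ℕₚ.≤-trans (ℕₚ.m<m+n p (s≤s z≤n)) (ℕₚ.m≤m+n (p + suc m) s))
  cases : ∀ b → bs 0 ≡ b → ∀ s → p + suc m + s ≡ n → chains n (suc m) p bs ≡ weakCompositions (b2n (not b) + frees m (bs ∘ suc)) s
  cases true  tight s eq = trans (chains-tight n m p bs (p<n eq) tight) (chains-count n m (suc p) (bs ∘ suc) s (shift eq))
  -- Without surplus there is no room to start later, so the second summand is 0.
  cases false free zero eq = trans (chains-free n m p bs (p<n eq) free) (trans
    (cong₂ _+_ (chains-count n m (suc p) (bs ∘ suc) 0 (shift eq))
      (chains-zero n (suc m) (suc p) bs (s≤s (ℕₚ.≤-reflexive (trans (sym eq) (ℕₚ.+-identityʳ _))))))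
    (ℕₚ.+-identityʳ _))
  cases false free (suc s) eq = trans (chains-free n m p bs (p<n eq) free)
    (cong₂ _+_ (chains-count n m (suc p) (bs ∘ suc) (suc s) (shift eq))
      (trans (chains-count n (suc m) (suc p) bs s (trans (sym (ℕₚ.+-suc (p + suc m) s)) eq))
             (cong (λ b → weakCompositions (b2n (not b) + frees m (bs ∘ suc)) s) free)))

frees-∑ : ∀ m bs → frees m bs ≡ ∑[ g ∈ allFin (suc m) ] b2n (not (bs (toℕ g)))
frees-∑ zero    bs = sym (ℕₚ.+-identityʳ _)
frees-∑ (suc m) bs = trans (cong (b2n (not (bs 0)) +_) (frees-∑ m (bs ∘ suc)))
  (sym (∑-allFin-suc {suc m} (λ g → b2n (not (bs (toℕ g))))))

-- The sequence p, v₀ + 1, v₁ + 1, …, n + 1: a gap is tight when it joins two terms that differ by one.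
term : ℕ → Vec (Fin n) m → ℕ → ℕ
term     p v       zero    = p
term {n} p []      (suc g) = suc n
term     p (x ∷ v) (suc g) = term (suc (toℕ x)) v g

term-lookup : (p : ℕ) (v : Vec (Fin n) m) (i : Fin m) → term p v (suc (toℕ i)) ≡ suc (toℕ (lookup v i))
term-lookup p (x ∷ [])    zero    = refl
term-lookup p (x ∷ y ∷ v) zero    = refl
term-lookup p (x ∷ v)     (suc i) = term-lookup (suc (toℕ x)) v i

term-end : (p : ℕ) (v : Vec (Fin n) m) → term p v (suc m) ≡ suc n
term-end p []      = refl
term-end p (x ∷ v) = term-end (suc (toℕ x)) v

Chain⁺ : (p : ℕ) (bs : ℕ → Bool) (v : Vec (Fin n) m) →
         (∀ g → g ≤ m → term p v g < term p v (suc g)) →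
         (∀ g → g ≤ m → bs g ≡ true → term p v (suc g) ≡ suc (term p v g)) → Chain p bs v
Chain⁺ p bs []      inc tight = ℕₚ.≤-pred (inc 0 z≤n) , λ b → ℕₚ.suc-injective (tight 0 z≤n b)
Chain⁺ p bs (x ∷ v) inc tight = (ℕₚ.≤-pred (inc 0 z≤n) , λ b → ℕₚ.suc-injective (tight 0 z≤n b)) ,
  Chain⁺ (suc (toℕ x)) (bs ∘ suc) v (λ g g≤ → inc (suc g) (s≤s g≤)) (λ g g≤ → tight (suc g) (s≤s g≤))

Chain⁻ : (p : ℕ) (bs : ℕ → Bool) (v : Vec (Fin n) m) → Chain p bs v → ∀ g → g ≤ m →
         term p v g < term p v (suc g) × (bs g ≡ true → term p v (suc g) ≡ suc (term p v g))
Chain⁻ p bs []      (p≤ , gap)        zero    _        = s≤s p≤ , λ b → cong suc (gap b)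
Chain⁻ p bs (x ∷ v) ((p≤ , gap) , ch) zero    _        = s≤s p≤ , λ b → cong suc (gap b)
Chain⁻ p bs (x ∷ v) (_ , ch)          (suc g) (s≤s g≤) = Chain⁻ (suc (toℕ x)) (bs ∘ suc) v ch g g≤

-- Order types and the conditions imposed by the pattern

SameOrder : {k : ℕ} → (Fin k → ℕ) → (Fin k → ℕ) → Set
SameOrder f g = ∀ i j → (f i <ᵇ f j) ≡ (g i <ᵇ g j)

SameOrder? : {k : ℕ} (f g : Fin k → ℕ) → Dec (SameOrder f g)
SameOrder? f g = Finₚ.all? λ i → Finₚ.all? λ j → (f i <ᵇ f j) Boolₚ.≟ (g i <ᵇ g j)

<ᵇ-true : ∀ {a b} → a < b → (a <ᵇ b) ≡ true
<ᵇ-true {a} {b} a<b = dec-true (T? (a <ᵇ b)) (ℕₚ.<⇒<ᵇ a<b)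

<ᵇ-true⁻ : ∀ {a b} → (a <ᵇ b) ≡ true → a < b
<ᵇ-true⁻ {a} {b} eq = ℕₚ.<ᵇ⇒< a b (subst T (sym eq) tt)

Increasing : Vec (Fin n) m → Set
Increasing v = SameOrder toℕ (toℕ ∘ lookup v)

Increasing? : (v : Vec (Fin n) m) → Dec (Increasing v)
Increasing? v = SameOrder? toℕ (toℕ ∘ lookup v)

Increasing-term : (p : ℕ) (v : Vec (Fin n) m) → p ≤ n → (∀ i → p ≤ toℕ (lookup v i)) → Increasing v →
                  ∀ g → g ≤ m → term p v g < term p v (suc g)
Increasing-term p []      p≤n p≤v inc zero    _        = s≤s p≤n
Increasing-term p (x ∷ v) p≤n p≤v inc zero    _        = s≤s (p≤v zero)
Increasing-term p (x ∷ v) p≤n p≤v inc (suc g) (s≤s g≤) = Increasing-term (suc (toℕ x)) v (Finₚ.toℕ<n x)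
  (λ i → <ᵇ-true⁻ (sym (inc zero (suc i)))) (λ i j → inc (suc i) (suc j)) g g≤

steps-mono : (t : ℕ → ℕ) (m : ℕ) → (∀ g → g ≤ m → t g < t (suc g)) → ∀ {a b} → a < b → b ≤ suc m → t a < t b
steps-mono t m step {a} {suc b} (s≤s a≤b) (s≤s b≤m) with ℕₚ.m≤n⇒m<n∨m≡n a≤b
... | inj₁ a<b  = ℕₚ.<-trans (steps-mono t m step a<b (ℕₚ.m≤n⇒m≤1+n b≤m)) (step b b≤m)
... | inj₂ refl = step b b≤m

-- A strictly increasing sequence gains at least 2 over two or more steps, so a gain of 1 takes a
-- single step.
steps-consecutive : (t : ℕ → ℕ) (m : ℕ) → (∀ g → g ≤ m → t g < t (suc g)) →
                    ∀ {a b} → a < b → b ≤ suc m → t b ≡ suc (t a) → b ≡ suc a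
steps-consecutive t m step {a} {b} a<b b≤ eq with ℕₚ.m≤n⇒m<n∨m≡n a<b
... | inj₂ refl = refl
... | inj₁ a+1<b = contradiction (subst (suc (t a) <_) eq (ℕₚ.≤-<-trans (step a (ℕₚ.≤-pred (ℕₚ.≤-trans a<b b≤)))
                     (steps-mono t m step a+1<b b≤))) (ℕₚ.<-irrefl refl)

term-Increasing : (v : Vec (Fin n) m) → (∀ g → g ≤ m → term 0 v g < term 0 v (suc g)) → Increasing v
term-Increasing {m = m} v step i j = Bool-⇔ (λ eq → <ᵇ-true (mono (<ᵇ-true⁻ eq))) from
  where
  mono : ∀ {i j} → toℕ i < toℕ j → toℕ (lookup v i) < toℕ (lookup v j)
  mono {i} {j} i<j = ℕₚ.≤-pred (subst₂ _<_ (term-lookup 0 v i) (term-lookup 0 v j)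
    (steps-mono (term 0 v) m step (s≤s i<j) (s≤s (ℕₚ.<⇒≤ (Finₚ.toℕ<n j)))))
  from : (toℕ (lookup v i) <ᵇ toℕ (lookup v j)) ≡ true → (toℕ i <ᵇ toℕ j) ≡ true
  from eq with ℕₚ.<-cmp (toℕ i) (toℕ j)
  ... | tri< i<j _ _ = <ᵇ-true i<j
  ... | tri≈ _ i≡j _ = contradiction (<ᵇ-true⁻ eq) (ℕₚ.<-irrefl (cong (toℕ ∘ lookup v) (Finₚ.toℕ-injective i≡j)))
  ... | tri> _ _ j<i = contradiction (<ᵇ-true⁻ eq) (ℕₚ.<-asym (mono j<i))

-- `right` says `suc c ≡ m` in place of the truncated `m ∸ 1` of `CI`; the two agree as soon as `m`
-- is positive.
record Conditions (φ : VPattern) (m a b c : ℕ) : Set where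
  constructor conditions
  field
    a<b   : a < b
    b<c   : b < c
    left  : leftSq φ ≡ true → a ≡ 0
    right : rightSq φ ≡ true → suc c ≡ m
    adj₁₂ : dash12 φ ≡ false → b ≡ suc a
    adj₂₃ : dash23 φ ≡ false → c ≡ suc b

implies⁻ : ∀ b {x y} → (not b ∨ (x ≡ᵇ y)) ≡ true → b ≡ true → x ≡ y
implies⁻ true {x} {y} eq refl = ≡ᵇ⇒≡ x y eq

implies⁺ : ∀ b {x y} → (b ≡ true → x ≡ y) → (not b ∨ (x ≡ᵇ y)) ≡ true
implies⁺ false eq = refl
implies⁺ true  eq = ≡⇒≡ᵇ (eq refl)

unless⁻ : ∀ b {x y} → (b ∨ (x ≡ᵇ y)) ≡ true → b ≡ false → x ≡ y
unless⁻ false {x} {y} eq refl = ≡ᵇ⇒≡ x y eq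

unless⁺ : ∀ b {x y} → (b ≡ false → x ≡ y) → (b ∨ (x ≡ᵇ y)) ≡ true
unless⁺ true  eq = refl
unless⁺ false eq = ≡⇒≡ᵇ (eq refl)

CI⁻ : (φ : VPattern) (m a b c : ℕ) → 1 ≤ m → CI φ m a b c ≡ true → Conditions φ m a b c
CI⁻ φ (suc m) a b c _ eq =
  let a<b , eq = ∧-true {a <ᵇ b} eq
      b<c , eq = ∧-true {b <ᵇ c} eq
      l , eq = ∧-true {not (leftSq φ) ∨ (a ≡ᵇ 0)} eq
      r , eq = ∧-true {not (rightSq φ) ∨ (c ≡ᵇ m)} eq
      d , e = ∧-true {dash12 φ ∨ (b ≡ᵇ suc a)} eq
  in conditions (<ᵇ-true⁻ a<b) (<ᵇ-true⁻ b<c) (implies⁻ (leftSq φ) l) (cong suc ∘ implies⁻ (rightSq φ) r)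
       (unless⁻ (dash12 φ) d) (unless⁻ (dash23 φ) e)

CI⁺ : (φ : VPattern) (m a b c : ℕ) → 1 ≤ m → Conditions φ m a b c → CI φ m a b c ≡ true
CI⁺ φ (suc m) a b c _ (conditions a<b b<c l r d e) =
  cong₂ _∧_ (<ᵇ-true a<b) (cong₂ _∧_ (<ᵇ-true b<c) (cong₂ _∧_ (implies⁺ (leftSq φ) l)
    (cong₂ _∧_ (implies⁺ (rightSq φ) (ℕₚ.suc-injective ∘ r)) (cong₂ _∧_ (unless⁺ (dash12 φ) d) (unless⁺ (dash23 φ) e)))))

-- Gap `g` lies just before the entry of rank `g`. Hence a left bracket tightens gap 0, an adjacency
-- the gap after its first letter, and a right bracket the gap after i₃.
tight : VPattern → (a b c : ℕ) → ℕ → Bool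
tight φ a b c g = (leftSq φ ∧ (g ≡ᵇ 0)) ∨ ((not (dash12 φ) ∧ (g ≡ᵇ suc a)) ∨ ((not (dash23 φ) ∧ (g ≡ᵇ suc b)) ∨ (rightSq φ ∧ (g ≡ᵇ suc c))))

∨-true : ∀ {a b} → a ∨ b ≡ true → a ≡ true ⊎ b ≡ true
∨-true {true}  eq = inj₁ refl
∨-true {false} eq = inj₂ eq

∨-trueˡ : ∀ {a b} → a ≡ true → a ∨ b ≡ true
∨-trueˡ refl = refl

∨-trueʳ : ∀ {a b} → b ≡ true → a ∨ b ≡ true
∨-trueʳ {a} refl = Boolₚ.∨-zeroʳ a

not-true : ∀ {b} → not b ≡ true → b ≡ false
not-true {false} eq = refl

module _ {n m : ℕ} (φ : VPattern) (v : Vec (Fin n) m) (a b c : Fin m) where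

  private
    t : ℕ → ℕ
    t = term 0 v
    V : Fin m → ℕ
    V i = toℕ (lookup v i)
    at-t : ∀ i → t (suc (toℕ i)) ≡ suc (V i)
    at-t = term-lookup 0 v
    inside : ∀ (i : Fin m) → suc (toℕ i) ≤ m
    inside i = Finₚ.toℕ<n i
    marks = tight φ (toℕ a) (toℕ b) (toℕ c)

  -- Consecutive positions in [n] leave no room for another entry, so `steps-consecutive` turns each
  -- requirement on positions into compatibility of the ranks together with one tight gap.
  conditions⇒chain : Increasing v → Conditions φ n (V a) (V b) (V c) →
                     Conditions φ m (toℕ a) (toℕ b) (toℕ c) × Chain 0 marks v
  conditions⇒chain inc (conditions Va<Vb Vb<Vc l r d e) =
    conditions a<b b<c l′ r′ d′ e′ , Chain⁺ 0 marks v step marked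
    where
    step : ∀ g → g ≤ m → t g < t (suc g)
    step = Increasing-term 0 v z≤n (λ _ → z≤n) inc
    a<b = <ᵇ-true⁻ (trans (inc a b) (<ᵇ-true Va<Vb))
    b<c = <ᵇ-true⁻ (trans (inc b c) (<ᵇ-true Vb<Vc))
    tˡ : leftSq φ ≡ true → t (suc (toℕ a)) ≡ suc (t 0)
    tˡ eq = trans (at-t a) (cong suc (l eq))
    t₁₂ : dash12 φ ≡ false → t (suc (toℕ b)) ≡ suc (t (suc (toℕ a)))
    t₁₂ eq = trans (at-t b) (cong suc (trans (d eq) (sym (at-t a))))
    t₂₃ : dash23 φ ≡ false → t (suc (toℕ c)) ≡ suc (t (suc (toℕ b)))
    t₂₃ eq = trans (at-t c) (cong suc (trans (e eq) (sym (at-t b))))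
    tʳ : rightSq φ ≡ true → t (suc m) ≡ suc (t (suc (toℕ c)))
    tʳ eq = trans (term-end 0 v) (cong suc (trans (sym (r eq)) (sym (at-t c))))
    l′ : leftSq φ ≡ true → toℕ a ≡ 0
    l′ eq = ℕₚ.suc-injective (steps-consecutive t m step (s≤s z≤n) (ℕₚ.m≤n⇒m≤1+n (inside a)) (tˡ eq))
    d′ : dash12 φ ≡ false → toℕ b ≡ suc (toℕ a)
    d′ eq = ℕₚ.suc-injective (steps-consecutive t m step (s≤s a<b) (ℕₚ.m≤n⇒m≤1+n (inside b)) (t₁₂ eq))
    e′ : dash23 φ ≡ false → toℕ c ≡ suc (toℕ b)
    e′ eq = ℕₚ.suc-injective (steps-consecutive t m step (s≤s b<c) (ℕₚ.m≤n⇒m≤1+n (inside c)) (t₂₃ eq))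
    r′ : rightSq φ ≡ true → suc (toℕ c) ≡ m
    r′ eq = sym (ℕₚ.suc-injective (steps-consecutive t m step (s≤s (inside c)) ℕₚ.≤-refl (tʳ eq)))
    marked : ∀ g → g ≤ m → marks g ≡ true → t (suc g) ≡ suc (t g)
    marked g _ eq with ∨-true {leftSq φ ∧ (g ≡ᵇ 0)} eq
    ... | inj₁ eq with on , g≡ ← ∧-true {leftSq φ} eq with refl ← ≡ᵇ⇒≡ g 0 g≡ =
      trans (cong (t ∘ suc) (sym (l′ on))) (tˡ on)
    ... | inj₂ eq with ∨-true {not (dash12 φ) ∧ (g ≡ᵇ suc (toℕ a))} eq
    ...   | inj₁ eq with on , g≡ ← ∧-true {not (dash12 φ)} eq with refl ← ≡ᵇ⇒≡ g (suc (toℕ a)) g≡ =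
      trans (cong (t ∘ suc) (sym (d′ (not-true on)))) (t₁₂ (not-true on))
    ...   | inj₂ eq with ∨-true {not (dash23 φ) ∧ (g ≡ᵇ suc (toℕ b))} eq
    ...     | inj₁ eq with on , g≡ ← ∧-true {not (dash23 φ)} eq with refl ← ≡ᵇ⇒≡ g (suc (toℕ b)) g≡ =
      trans (cong (t ∘ suc) (sym (e′ (not-true on)))) (t₂₃ (not-true on))
    ...     | inj₂ eq with on , g≡ ← ∧-true {rightSq φ} eq with refl ← ≡ᵇ⇒≡ g (suc (toℕ c)) g≡ =
      trans (cong (t ∘ suc) (r′ on)) (tʳ on)

  chain⇒conditions : Conditions φ m (toℕ a) (toℕ b) (toℕ c) → Chain 0 marks v →
                     Increasing v × Conditions φ n (V a) (V b) (V c)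
  chain⇒conditions (conditions a<b b<c l r d e) ch = inc ,
    conditions (mono a b a<b) (mono b c b<c) l′ r′ d′ e′
    where
    step : ∀ g → g ≤ m → t g < t (suc g)
    step g g≤ = proj₁ (Chain⁻ 0 marks v ch g g≤)
    inc : Increasing v
    inc = term-Increasing v step
    mono : ∀ i j → toℕ i < toℕ j → V i < V j
    mono i j i<j = <ᵇ-true⁻ (trans (sym (inc i j)) (<ᵇ-true i<j))
    at-mark : ∀ g → g ≤ m → marks g ≡ true → t (suc g) ≡ suc (t g)
    at-mark g g≤ = proj₂ (Chain⁻ 0 marks v ch g g≤)
    on-0 : leftSq φ ≡ true → marks 0 ≡ true
    on-0 on = ∨-trueˡ (cong₂ _∧_ on refl)
    on-a : dash12 φ ≡ false → marks (suc (toℕ a)) ≡ true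
    on-a off = ∨-trueʳ {leftSq φ ∧ false} (∨-trueˡ (cong₂ _∧_ (cong not off) (≡⇒≡ᵇ {toℕ a} refl)))
    on-b : dash23 φ ≡ false → marks (suc (toℕ b)) ≡ true
    on-b off = ∨-trueʳ {leftSq φ ∧ false} (∨-trueʳ {not (dash12 φ) ∧ (toℕ b ≡ᵇ toℕ a)}
      (∨-trueˡ (cong₂ _∧_ (cong not off) (≡⇒≡ᵇ {toℕ b} refl))))
    on-c : rightSq φ ≡ true → marks (suc (toℕ c)) ≡ true
    on-c on = ∨-trueʳ {leftSq φ ∧ false} (∨-trueʳ {not (dash12 φ) ∧ (toℕ c ≡ᵇ toℕ a)}
      (∨-trueʳ {not (dash23 φ) ∧ (toℕ c ≡ᵇ toℕ b)} (cong₂ _∧_ on (≡⇒≡ᵇ {toℕ c} refl))))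
    l′ : leftSq φ ≡ true → V a ≡ 0
    l′ on = ℕₚ.suc-injective (trans (sym (at-t a)) (trans (cong (t ∘ suc) (l on)) (at-mark 0 z≤n (on-0 on))))
    d′ : dash12 φ ≡ false → V b ≡ suc (V a)
    d′ off = ℕₚ.suc-injective (trans (sym (at-t b)) (trans (cong (t ∘ suc) (d off))
      (trans (at-mark (suc (toℕ a)) (inside a) (on-a off)) (cong suc (at-t a)))))
    e′ : dash23 φ ≡ false → V c ≡ suc (V b)
    e′ off = ℕₚ.suc-injective (trans (sym (at-t c)) (trans (cong (t ∘ suc) (e off))
      (trans (at-mark (suc (toℕ b)) (inside b) (on-b off)) (cong suc (at-t b)))))
    r′ : rightSq φ ≡ true → suc (V c) ≡ n
    r′ on = ℕₚ.suc-injective (trans (cong suc (sym (at-t c))) (trans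
      (sym (at-mark (suc (toℕ c)) (inside c) (on-c on))) (trans (cong (t ∘ suc) (r on)) (term-end 0 v))))

  Increasing-CI : 1 ≤ n → 1 ≤ m →
    ⟦ Increasing? v ⟧ * b2n (CI φ n (V a) (V b) (V c)) ≡ b2n (CI φ m (toℕ a) (toℕ b) (toℕ c)) * ⟦ Chain? 0 marks v ⟧
  Increasing-CI 1≤n 1≤m = trans
    (trans (cong (⟦ Increasing? v ⟧ *_) (sym CIₙ)) (sym (⟦⟧-× (Increasing? v) (CI φ n (V a) (V b) (V c) Boolₚ.≟ true))))
    (trans (⟦⟧-⇔ (Increasing? v ×-dec (CI φ n (V a) (V b) (V c) Boolₚ.≟ true))
                 ((CI φ m (toℕ a) (toℕ b) (toℕ c) Boolₚ.≟ true) ×-dec Chain? 0 marks v)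
      (λ (inc , ci) → let cs , ch = conditions⇒chain inc (CI⁻ φ n (V a) (V b) (V c) 1≤n ci) in CI⁺ φ m (toℕ a) (toℕ b) (toℕ c) 1≤m cs , ch)
      (λ (ci , ch) → let inc , cs = chain⇒conditions (CI⁻ φ m (toℕ a) (toℕ b) (toℕ c) 1≤m ci) ch in inc , CI⁺ φ n (V a) (V b) (V c) 1≤n cs))
    (trans (⟦⟧-× (CI φ m (toℕ a) (toℕ b) (toℕ c) Boolₚ.≟ true) (Chain? 0 marks v))
      (cong (_* ⟦ Chain? 0 marks v ⟧) (≟true (CI φ m (toℕ a) (toℕ b) (toℕ c))))))
    where
    ≟true : ∀ b → ⟦ b Boolₚ.≟ true ⟧ ≡ b2n b
    ≟true true  = refl
    ≟true false = refl
    CIₙ : ⟦ CI φ n (V a) (V b) (V c) Boolₚ.≟ true ⟧ ≡ b2n (CI φ n (V a) (V b) (V c))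
    CIₙ = ≟true (CI φ n (V a) (V b) (V c))

b2n-∨-disjoint : ∀ {a b} → ¬ (a ≡ true × b ≡ true) → b2n (a ∨ b) ≡ b2n a + b2n b
b2n-∨-disjoint {true}  {true}  dis = contradiction (refl , refl) dis
b2n-∨-disjoint {true}  {false} dis = refl
b2n-∨-disjoint {false} {b}     dis = refl

∑-mark : ∀ b m g → g < m → ∑[ h ∈ allFin m ] b2n (b ∧ (toℕ h ≡ᵇ g)) ≡ b2n b
∑-mark b m g g<m = begin
  ∑[ h ∈ allFin m ] b2n (b ∧ (toℕ h ≡ᵇ g))
    ≡⟨ ∑-cong (allFin m) (λ h → trans (b2n-∧ b (toℕ h ≡ᵇ g)) (cong (b2n b *_)
         (⟦⟧-⇔ (toℕ h ℕₚ.≟ g) (h Finₚ.≟ fromℕ< g<m) (λ eq → Finₚ.toℕ-injective (trans eq (sym (Finₚ.toℕ-fromℕ< g<m))))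
           (λ eq → trans (cong toℕ eq) (Finₚ.toℕ-fromℕ< g<m))))) ⟩
  ∑[ h ∈ allFin m ] (b2n b * ⟦ h Finₚ.≟ fromℕ< g<m ⟧)
    ≡⟨ trans (∑-*ˡ (allFin m) (b2n b)) (cong (b2n b *_) (Enum.once (FinEnum m) (fromℕ< g<m))) ⟩
  b2n b * 1
    ≡⟨ ℕₚ.*-identityʳ _ ⟩
  b2n b ∎
  where open ≡-Reasoning

-- The possible marks sit at 0, `a + 1`, `b + 1`, `c + 1`, which are distinct and at most `m`; so
-- exactly `kφ φ` of the `m + 1` gaps are tight.
frees-tight : (φ : VPattern) (m a b c : ℕ) → a < b → b < c → c < m → frees m (tight φ a b c) + kφ φ ≡ suc m
frees-tight φ m a b c a<b b<c c<m = begin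
  frees m marks + kφ φ
    ≡⟨ cong₂ _+_ (frees-∑ m marks) (sym trues) ⟩
  ∑[ g ∈ gs ] b2n (not (marks (toℕ g))) + ∑[ g ∈ gs ] b2n (marks (toℕ g))
    ≡⟨ ∑-+ gs {λ g → b2n (not (marks (toℕ g)))} {λ g → b2n (marks (toℕ g))} ⟨
  ∑[ g ∈ gs ] (b2n (not (marks (toℕ g))) + b2n (marks (toℕ g)))
    ≡⟨ ∑-cong gs (λ g → complement (marks (toℕ g))) ⟩
  ∑[ _ ∈ gs ] 1
    ≡⟨ ∑-allFin-1 (suc m) ⟩
  suc m ∎
  where
  open ≡-Reasoning
  marks = tight φ a b c
  gs = allFin (suc m)
  complement : ∀ b → b2n (not b) + b2n b ≡ 1
  complement true  = refl
  complement false = refl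
  b<m = ℕₚ.<-trans b<c c<m
  a<m = ℕₚ.<-trans a<b b<m
  l d e r : ℕ → Bool
  l g = leftSq φ ∧ (g ≡ᵇ 0)
  d g = not (dash12 φ) ∧ (g ≡ᵇ suc a)
  e g = not (dash23 φ) ∧ (g ≡ᵇ suc b)
  r g = rightSq φ ∧ (g ≡ᵇ suc c)
  mark≡ : ∀ x g h → x ∧ (g ≡ᵇ h) ≡ true → g ≡ h
  mark≡ true g h eq = ≡ᵇ⇒≡ g h eq
  split : ∀ g → b2n (marks g) ≡ b2n (l g) + (b2n (d g) + (b2n (e g) + b2n (r g)))
  split g = begin
    b2n (l g ∨ (d g ∨ (e g ∨ r g)))
      ≡⟨ b2n-∨-disjoint {l g} (λ (p , q) → l-other (mark≡ (leftSq φ) g 0 p) q) ⟩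
    b2n (l g) + b2n (d g ∨ (e g ∨ r g))
      ≡⟨ cong (b2n (l g) +_) (b2n-∨-disjoint {d g} (λ (p , q) → d-other (mark≡ (not (dash12 φ)) g (suc a) p) q)) ⟩
    b2n (l g) + (b2n (d g) + b2n (e g ∨ r g))
      ≡⟨ cong (λ k → b2n (l g) + (b2n (d g) + k)) (b2n-∨-disjoint {e g} (λ (p , q) →
           ℕₚ.<⇒≢ b<c (ℕₚ.suc-injective (trans (sym (mark≡ (not (dash23 φ)) g (suc b) p)) (mark≡ (rightSq φ) g (suc c) q))))) ⟩
    b2n (l g) + (b2n (d g) + (b2n (e g) + b2n (r g))) ∎
    where
    d-other : g ≡ suc a → ¬ (e g ∨ r g ≡ true)
    d-other g≡ q with ∨-true {e g} q
    ... | inj₁ q = ℕₚ.<⇒≢ a<b (ℕₚ.suc-injective (trans (sym g≡) (mark≡ (not (dash23 φ)) g (suc b) q)))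
    ... | inj₂ q = ℕₚ.<⇒≢ (ℕₚ.<-trans a<b b<c) (ℕₚ.suc-injective (trans (sym g≡) (mark≡ (rightSq φ) g (suc c) q)))
    l-other : g ≡ 0 → ¬ (d g ∨ (e g ∨ r g) ≡ true)
    l-other g≡ q with ∨-true {d g} q
    ... | inj₁ q = case trans (sym g≡) (mark≡ (not (dash12 φ)) g (suc a) q) of λ ()
    ... | inj₂ q with ∨-true {e g} q
    ...   | inj₁ q = case trans (sym g≡) (mark≡ (not (dash23 φ)) g (suc b) q) of λ ()
    ...   | inj₂ q = case trans (sym g≡) (mark≡ (rightSq φ) g (suc c) q) of λ ()
  trues : ∑[ g ∈ gs ] b2n (marks (toℕ g)) ≡ kφ φ
  trues = begin
    ∑[ g ∈ gs ] b2n (marks (toℕ g))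
      ≡⟨ ∑-cong gs (λ g → split (toℕ g)) ⟩
    ∑[ g ∈ gs ] (b2n (l (toℕ g)) + (b2n (d (toℕ g)) + (b2n (e (toℕ g)) + b2n (r (toℕ g)))))
      ≡⟨ trans (∑-+ gs {λ g → b2n (l (toℕ g))} {λ g → b2n (d (toℕ g)) + (b2n (e (toℕ g)) + b2n (r (toℕ g)))})
           (cong (∑[ g ∈ gs ] b2n (l (toℕ g)) +_) (trans
             (∑-+ gs {λ g → b2n (d (toℕ g))} {λ g → b2n (e (toℕ g)) + b2n (r (toℕ g))})
             (cong (∑[ g ∈ gs ] b2n (d (toℕ g)) +_) (∑-+ gs {λ g → b2n (e (toℕ g))} {λ g → b2n (r (toℕ g))})))) ⟩
    ∑[ g ∈ gs ] b2n (l (toℕ g)) + (∑[ g ∈ gs ] b2n (d (toℕ g)) + (∑[ g ∈ gs ] b2n (e (toℕ g)) + ∑[ g ∈ gs ] b2n (r (toℕ g))))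
      ≡⟨ cong₂ _+_ (∑-mark (leftSq φ) (suc m) 0 (s≤s z≤n)) (cong₂ _+_ (∑-mark (not (dash12 φ)) (suc m) (suc a) (s≤s a<m))
           (cong₂ _+_ (∑-mark (not (dash23 φ)) (suc m) (suc b) (s≤s b<m)) (∑-mark (rightSq φ) (suc m) (suc c) (s≤s c<m)))) ⟩
    b2n (leftSq φ) + (b2n (not (dash12 φ)) + (b2n (not (dash23 φ)) + b2n (rightSq φ)))
      ≡⟨ rearrange (b2n (leftSq φ)) (b2n (rightSq φ)) (b2n (not (dash12 φ))) (b2n (not (dash23 φ))) ⟩
    kφ φ ∎
    where
    rearrange : ∀ l r d e → l + (d + (e + r)) ≡ l + r + d + e
    rearrange = ℕ-Solver.solve-∀

-- With compatible ranks there are `m - k + 1` free gaps and a surplus of `n - m`, and stars and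
-- bars gives the binomial coefficient.
∑-Increasing-CI : (φ : VPattern) {n m : ℕ} (a b c : Fin m) → 1 ≤ m → m ≤ n → kφ φ ≤ m →
  ∑[ v ∈ allVecs n m ] (⟦ Increasing? v ⟧ * b2n (CI φ n (toℕ (lookup v a)) (toℕ (lookup v b)) (toℕ (lookup v c)))) ≡
  b2n (CI φ m (toℕ a) (toℕ b) (toℕ c)) * ((n ∸ kφ φ) C (m ∸ kφ φ))
∑-Increasing-CI φ {n} {m} a b c 1≤m m≤n k≤m = begin
  ∑[ v ∈ allVecs n m ] (⟦ Increasing? v ⟧ * b2n (CI φ n (toℕ (lookup v a)) (toℕ (lookup v b)) (toℕ (lookup v c))))
    ≡⟨ ∑-cong (allVecs n m) (λ v → Increasing-CI φ v a b c (ℕₚ.≤-trans 1≤m m≤n) 1≤m) ⟩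
  ∑[ v ∈ allVecs n m ] (b2n CIₘ * ⟦ Chain? 0 marks v ⟧)
    ≡⟨ ∑-*ˡ (allVecs n m) (b2n CIₘ) ⟩
  b2n CIₘ * chains n m 0 marks
    ≡⟨ counted CIₘ refl ⟩
  b2n CIₘ * ((n ∸ kφ φ) C (m ∸ kφ φ)) ∎
  where
  open ≡-Reasoning
  CIₘ = CI φ m (toℕ a) (toℕ b) (toℕ c)
  marks = tight φ (toℕ a) (toℕ b) (toℕ c)
  counted : ∀ ci → CI φ m (toℕ a) (toℕ b) (toℕ c) ≡ ci → b2n ci * chains n m 0 marks ≡ b2n ci * ((n ∸ kφ φ) C (m ∸ kφ φ))
  counted false _  = refl
  counted true  ci = cong (1 *_) (begin
    chains n m 0 marks
      ≡⟨ chains-count n m 0 marks (n ∸ m) (ℕₚ.m+[n∸m]≡n m≤n) ⟩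
    weakCompositions (frees m marks) (n ∸ m)
      ≡⟨ cong (λ f → weakCompositions f (n ∸ m)) frees≡ ⟩
    weakCompositions (suc (m ∸ kφ φ)) (n ∸ m)
      ≡⟨ weakCompositions-C (m ∸ kφ φ) (n ∸ m) ⟩
    (n ∸ m + (m ∸ kφ φ)) C (m ∸ kφ φ)
      ≡⟨ cong (_C (m ∸ kφ φ)) (trans (sym (ℕₚ.+-∸-assoc (n ∸ m) k≤m)) (cong (_∸ kφ φ) (ℕₚ.m∸n+n≡m m≤n))) ⟩
    (n ∸ kφ φ) C (m ∸ kφ φ) ∎)
    where
    open Conditions (CI⁻ φ m (toℕ a) (toℕ b) (toℕ c) 1≤m ci)
    frees≡ : frees m marks ≡ suc (m ∸ kφ φ)
    frees≡ = trans (sym (ℕₚ.m+n∸n≡m _ (kφ φ))) (trans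
      (cong (_∸ kφ φ) (frees-tight φ m (toℕ a) (toℕ b) (toℕ c) a<b b<c (Finₚ.toℕ<n c)))
      (ℕₚ.+-∸-assoc 1 k≤m))

-- Standardization

b2n≤1 : ∀ b → b2n b ≤ 1
b2n≤1 true  = s≤s z≤n
b2n≤1 false = z≤n

∑-mono : (xs : List A) {f g : A → ℕ} → (∀ x → f x ≤ g x) → ∑ xs f ≤ ∑ xs g
∑-mono []       le = z≤n
∑-mono (x ∷ xs) le = ℕₚ.+-mono-≤ (le x) (∑-mono xs le)

∑-strict : {f g : Fin m → ℕ} (i : Fin m) → (∀ k → f k + ⟦ k Finₚ.≟ i ⟧ ≤ g k) → ∑ (allFin m) f < ∑ (allFin m) g
∑-strict {m} {f} {g} i le = subst (_≤ ∑ (allFin m) g)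
  (trans (∑-+ (allFin m)) (trans (cong (∑ (allFin m) f +_) (Enum.once (FinEnum m) i)) (ℕₚ.+-comm _ 1)))
  (∑-mono (allFin m) le)

∑-below : ∀ {m x} → x ≤ m → ∑[ y ∈ allFin m ] b2n (toℕ y <ᵇ x) ≡ x
∑-below {m}     {zero}  _         = ∑-zero (allFin m)
∑-below {suc m} {suc x} (s≤s x≤m) = trans (∑-allFin-suc {m} (λ y → b2n (toℕ y <ᵇ suc x))) (cong suc (∑-below x≤m))

module _ {n m : ℕ} (w : Vec (Fin n) m) where

  private
    W : Fin m → ℕ
    W i = toℕ (lookup w i)

  -- The 0-based rank of an entry, defined for any tuple, injective or not.
  entriesBelow : Fin m → ℕ
  entriesBelow i = ∑[ k ∈ allFin m ] b2n (W k <ᵇ W i)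

  entriesBelow-bound : ∀ i → entriesBelow i < m
  entriesBelow-bound i = subst (entriesBelow i <_) (∑-allFin-1 m) (∑-strict i le)
    where
    le : ∀ k → b2n (W k <ᵇ W i) + ⟦ k Finₚ.≟ i ⟧ ≤ 1
    le k with k Finₚ.≟ i
    ... | yes refl = ℕₚ.≤-reflexive (cong (_+ 1) (⟦⟧-no (T? (W k <ᵇ W k)) (λ lt → ℕₚ.<-irrefl refl (ℕₚ.<ᵇ⇒< (W k) (W k) lt))))
    ... | no _ = subst (_≤ 1) (sym (ℕₚ.+-identityʳ _)) (b2n≤1 (W k <ᵇ W i))

  entriesBelow-mono : ∀ {a b} → W a < W b → entriesBelow a < entriesBelow b
  entriesBelow-mono {a} {b} Wa<Wb = ∑-strict a le
    where
    le : ∀ k → b2n (W k <ᵇ W a) + ⟦ k Finₚ.≟ a ⟧ ≤ b2n (W k <ᵇ W b)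
    le k with k Finₚ.≟ a
    ... | yes refl = ℕₚ.≤-reflexive (trans
            (cong (_+ 1) (⟦⟧-no (T? (W k <ᵇ W k)) (λ lt → ℕₚ.<-irrefl refl (ℕₚ.<ᵇ⇒< (W k) (W k) lt))))
            (cong b2n (sym (<ᵇ-true Wa<Wb))))
    ... | no _ with W k <ᵇ W a in eq
    ...   | false = z≤n
    ...   | true  = ℕₚ.≤-reflexive (cong b2n (sym (<ᵇ-true (ℕₚ.<-trans (<ᵇ-true⁻ eq) Wa<Wb))))

  standardize : Vec (Fin m) m
  standardize = tabulate (λ i → fromℕ< (entriesBelow-bound i))

  lookup-standardize : ∀ i → toℕ (lookup standardize i) ≡ entriesBelow i
  lookup-standardize i = trans (cong toℕ (Vecₚ.lookup∘tabulate _ i)) (Finₚ.toℕ-fromℕ< (entriesBelow-bound i))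

  entriesBelow-cong : ∀ {a b} → W a ≡ W b → entriesBelow a ≡ entriesBelow b
  entriesBelow-cong eq = ∑-cong (allFin m) (λ k → cong (λ x → b2n (W k <ᵇ x)) eq)

  SameOrder-standardize : SameOrder (toℕ ∘ lookup standardize) W
  SameOrder-standardize a b rewrite lookup-standardize a | lookup-standardize b = Bool-⇔
    (λ eq → case ℕₚ.<-cmp (W a) (W b) of λ
      { (tri< lt _ _) → <ᵇ-true lt
      ; (tri≈ _ Wa≡Wb _) → contradiction (<ᵇ-true⁻ eq) (ℕₚ.<-irrefl (entriesBelow-cong Wa≡Wb))
      ; (tri> _ _ gt) → contradiction (<ᵇ-true⁻ eq) (ℕₚ.<-asym (entriesBelow-mono gt)) })
    (λ eq → <ᵇ-true (entriesBelow-mono (<ᵇ-true⁻ eq)))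

SameOrder-Inj : {l : ℕ} (v : Vec (Fin n) m) (w : Vec (Fin l) m) → SameOrder (toℕ ∘ lookup v) (toℕ ∘ lookup w) → Inj w → Inj v
SameOrder-Inj v w same inj i j eq = inj i j (Finₚ.toℕ-injective (case ℕₚ.<-cmp (toℕ (lookup w i)) (toℕ (lookup w j)) of λ
  { (tri< lt _ _) → contradiction (<ᵇ-true⁻ (trans (same i j) (<ᵇ-true lt))) (ℕₚ.<-irrefl (cong toℕ eq))
  ; (tri≈ _ w≡ _) → w≡
  ; (tri> _ _ gt) → contradiction (<ᵇ-true⁻ (trans (same j i) (<ᵇ-true gt))) (ℕₚ.<-irrefl (cong toℕ (sym eq))) }))

-- A permutation runs through all values once, so counting entries below a value is counting numbers
-- below it.
entriesBelow-permutation : (σ : Vec (Fin m) m) → Inj σ → ∀ i → entriesBelow σ i ≡ toℕ (lookup σ i)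
entriesBelow-permutation {m} σ inj i = trans
  (Cycles.∑-iter σ inj 1 (λ y → b2n (toℕ y <ᵇ toℕ (lookup σ i))))
  (∑-below (ℕₚ.<⇒≤ (Finₚ.toℕ<n (lookup σ i))))

-- Ranks depend on the order type alone, and a permutation is its own vector of ranks.
SameOrder-permutation-unique : (σ : Vec (Fin m) m) (w : Vec (Fin n) m) → Inj σ →
  SameOrder (toℕ ∘ lookup σ) (toℕ ∘ lookup w) → σ ≡ standardize w
SameOrder-permutation-unique {m} σ w inj same = trans (sym (Vecₚ.tabulate∘lookup σ)) (Vecₚ.tabulate-cong λ i →
  Finₚ.toℕ-injective (begin
    toℕ (lookup σ i)   ≡⟨ entriesBelow-permutation σ inj i ⟨
    entriesBelow σ i   ≡⟨ ∑-cong (allFin m) (λ k → cong b2n (same k i)) ⟩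
    entriesBelow w i   ≡⟨ Finₚ.toℕ-fromℕ< (entriesBelow-bound w i) ⟨
    toℕ (fromℕ< (entriesBelow-bound w i)) ∎))
  where open ≡-Reasoning

pattern? : (σ : Vec (Fin m) m) (w : Vec (Fin n) m) → Dec (SameOrder (toℕ ∘ lookup σ) (toℕ ∘ lookup w))
pattern? σ w = SameOrder? (toℕ ∘ lookup σ) (toℕ ∘ lookup w)

-- A partition of unity: an injective tuple has the order type of its standardization and of no
-- other permutation.
∑-patterns : (w : Vec (Fin n) m) → Inj w → ∑[ σ ∈ allVecs m m ] (⟦ Inj? σ ⟧ * ⟦ pattern? σ w ⟧) ≡ 1
∑-patterns {m = m} w inj = trans
  (∑-cong (allVecs m m) (λ σ → trans (sym (⟦⟧-× (Inj? σ) (pattern? σ w)))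
    (⟦⟧-⇔ (Inj? σ ×-dec pattern? σ w) (Enum._≟_ (VecEnum m m) σ (standardize w))
      (λ (inj-σ , same) → SameOrder-permutation-unique σ w inj-σ same)
      (λ { refl → SameOrder-Inj (standardize w) w (SameOrder-standardize w) inj , SameOrder-standardize w }))))
  (Enum.once (VecEnum m m) (standardize w))

opaque
  unfolding ∑Inj

  ∑Inj-def : (F : Vec (Fin n) m → ℕ) → ∑Inj n m F ≡ ∑[ w ∈ allVecs n m ] (⟦ Inj? w ⟧ * F w)
  ∑Inj-def F = refl

module _ (φ : VPattern) {n m : ℕ} (σ : Vec (Fin m) m) (σ-inj : Inj σ) (t : Triple) (wf : WellFormed m t) where

  private
    x = proj₁ t
    y = proj₁ (proj₂ t)
    z = proj₂ (proj₂ t)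
    3≤m = proj₁ wf
    x<m = proj₁ (proj₂ wf)
    y<m = proj₁ (proj₂ (proj₂ wf))
    z<m = proj₂ (proj₂ (proj₂ wf))
    0<m : 0 < m
    0<m = ℕₚ.≤-trans (s≤s z≤n) 3≤m
    1<m : 1 < m
    1<m = ℕₚ.≤-trans (s≤s (s≤s z≤n)) 3≤m
    i₁ i₂ i₃ : Fin m
    i₁ = fromℕ< 0<m
    i₂ = fromℕ< 1<m
    i₃ = fromℕ< 3≤m

  O-pattern : (w : Vec (Fin n) m) → SameOrder (toℕ ∘ lookup σ) (toℕ ∘ lookup w) →
              O-φ φ (at w x) (at w y) (at w z) ≡ O-φ φ (at σ x) (at σ y) (at σ z)
  O-pattern w same rewrite at-fromℕ< w x<m | at-fromℕ< w y<m | at-fromℕ< w z<m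
                         | at-fromℕ< σ x<m | at-fromℕ< σ y<m | at-fromℕ< σ z<m
    = cong b2n (sameOrder-cong (toℕ ∘ lookup w) (toℕ ∘ lookup σ) (λ i j → sym (same i j)) (fromℕ< x<m) (fromℕ< y<m) (fromℕ< z<m))
    where
    sameOrder-cong : {k : ℕ} (f g : Fin k → ℕ) → SameOrder f g → ∀ a b c →
      sameOrder (f a , f b , f c) (φcTriple φ) ≡ sameOrder (g a , g b , g c) (φcTriple φ)
    sameOrder-cong f g same a b c rewrite same a b | same a c | same b c = refl

  open Cycles σ σ-inj using (asPermutation; f⁻¹; f-f⁻¹)

  -- Tuples of order type `σ` are increasing sequences read in the order `σ`, so reindexing by `σ`
  -- sorts them.
  permute-increasing : (v : Vec (Fin n) m) → let w = permute asPermutation v in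
    ⟦ Inj? w ⟧ * ⟦ pattern? σ w ⟧ ≡ ⟦ Increasing? v ⟧
  permute-increasing v = trans (sym (⟦⟧-× (Inj? w) (pattern? σ w)))
    (⟦⟧-⇔ (Inj? w ×-dec pattern? σ w) (Increasing? v) (λ (_ , same) → to same) (λ inc → SameOrder-Inj w σ (λ i j → sym (from inc i j)) σ-inj , from inc))
    where
    w = permute asPermutation v
    lookup-w : ∀ i → lookup w i ≡ lookup v (lookup σ i)
    lookup-w = Vecₚ.lookup∘tabulate _
    from : Increasing v → SameOrder (toℕ ∘ lookup σ) (toℕ ∘ lookup w)
    from inc i j rewrite lookup-w i | lookup-w j = inc (lookup σ i) (lookup σ j)
    to : SameOrder (toℕ ∘ lookup σ) (toℕ ∘ lookup w) → Increasing v
    to same a b = subst₂ (λ a b → (toℕ a <ᵇ toℕ b) ≡ (toℕ (lookup v a) <ᵇ toℕ (lookup v b))) (f-f⁻¹ a) (f-f⁻¹ b)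
      (trans (same (f⁻¹ a) (f⁻¹ b)) (cong₂ (λ p q → toℕ p <ᵇ toℕ q) (lookup-w (f⁻¹ a)) (lookup-w (f⁻¹ b))))

  ∑Inj-pattern : m ≤ n → kφ φ ≤ m →
    ∑Inj n m (λ w → ⟦ pattern? σ w ⟧ * weight-φ φ w t) ≡ weight-φ φ σ t * ((n ∸ kφ φ) C (m ∸ kφ φ))
  ∑Inj-pattern m≤n k≤m = begin
    ∑Inj n m (λ w → ⟦ pattern? σ w ⟧ * weight-φ φ w t)
      ≡⟨ ∑Inj-cong (λ w _ → trans
           (⟦⟧*-cong (pattern? σ w) (λ same → cong (K-φ φ n (at w 0) (at w 1) (at w 2) *_) (O-pattern w same)))
           (sym (ℕₚ.*-assoc ⟦ pattern? σ w ⟧ _ _))) ⟩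
    ∑Inj n m (λ w → ⟦ pattern? σ w ⟧ * K-φ φ n (at w 0) (at w 1) (at w 2) * Oσ)
      ≡⟨ ∑Inj-*ʳ Oσ ⟩
    ∑Inj n m (λ w → ⟦ pattern? σ w ⟧ * K-φ φ n (at w 0) (at w 1) (at w 2)) * Oσ
      ≡⟨ cong (_* Oσ) (trans (∑Inj-def _) (sym (∑-permute asPermutation (λ w → ⟦ Inj? w ⟧ * (⟦ pattern? σ w ⟧ * K-φ φ n (at w 0) (at w 1) (at w 2)))))) ⟩
    ∑[ v ∈ allVecs n m ] (let w = permute asPermutation v in ⟦ Inj? w ⟧ * (⟦ pattern? σ w ⟧ * K-φ φ n (at w 0) (at w 1) (at w 2))) * Oσ
      ≡⟨ cong (_* Oσ) (∑-cong (allVecs n m) (λ v → let w = permute asPermutation v in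
           trans (sym (ℕₚ.*-assoc ⟦ Inj? w ⟧ ⟦ pattern? σ w ⟧ _)) (cong₂ _*_ (permute-increasing v) (positions v)))) ⟩
    ∑[ v ∈ allVecs n m ] (⟦ Increasing? v ⟧ * b2n (CI φ n (toℕ (lookup v (lookup σ i₁))) (toℕ (lookup v (lookup σ i₂))) (toℕ (lookup v (lookup σ i₃))))) * Oσ
      ≡⟨ cong (_* Oσ) (∑-Increasing-CI φ (lookup σ i₁) (lookup σ i₂) (lookup σ i₃) 0<m m≤n k≤m) ⟩
    b2n (CI φ m (toℕ (lookup σ i₁)) (toℕ (lookup σ i₂)) (toℕ (lookup σ i₃))) * binomial * Oσ
      ≡⟨ cong (λ k → k * binomial * Oσ) (sym (cong₃ (K-φ φ m) (at-fromℕ< σ 0<m) (at-fromℕ< σ 1<m) (at-fromℕ< σ 3≤m))) ⟩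
    K-φ φ m (at σ 0) (at σ 1) (at σ 2) * binomial * Oσ
      ≡⟨ exchange (K-φ φ m (at σ 0) (at σ 1) (at σ 2)) binomial Oσ ⟩
    weight-φ φ σ t * binomial ∎
    where
    open ≡-Reasoning
    Oσ = O-φ φ (at σ x) (at σ y) (at σ z)
    binomial = (n ∸ kφ φ) C (m ∸ kφ φ)
    exchange : ∀ a b c → a * b * c ≡ a * c * b
    exchange = ℕ-Solver.solve-∀
    cong₃ : (f : ℕ → ℕ → ℕ → ℕ) {a b c a′ b′ c′ : ℕ} → a ≡ a′ → b ≡ b′ → c ≡ c′ → f a b c ≡ f a′ b′ c′
    cong₃ f refl refl refl = refl
    positions : ∀ v → let w = permute asPermutation v in K-φ φ n (at w 0) (at w 1) (at w 2) ≡
      b2n (CI φ n (toℕ (lookup v (lookup σ i₁))) (toℕ (lookup v (lookup σ i₂))) (toℕ (lookup v (lookup σ i₃))))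
    positions v = cong₃ (K-φ φ n) (position 0<m) (position 1<m) (position 3≤m)
      where
      position : ∀ {s} (s<m : s < m) → at (permute asPermutation v) s ≡ toℕ (lookup v (lookup σ (fromℕ< s<m)))
      position s<m = trans (at-fromℕ< (permute asPermutation v) s<m) (cong toℕ (Vecₚ.lookup∘tabulate _ (fromℕ< s<m)))

∑Inj-weight : (φ : VPattern) (t : Triple) → WellFormed m t → m ≤ n → kφ φ ≤ m →
  ∑Inj n m (λ w → weight-φ φ w t) ≡ ∑Inj m m (λ σ → weight-φ φ σ t) * ((n ∸ kφ φ) C (m ∸ kφ φ))
∑Inj-weight {m} {n} φ t wf m≤n k≤m = begin
  ∑Inj n m (λ w → weight-φ φ w t)
    ≡⟨ ∑Inj-cong (λ w inj → trans (sym (ℕₚ.*-identityˡ _)) (trans (cong (_* weight-φ φ w t) (sym (∑-patterns w inj)))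
         (trans (sym (∑-*ʳ (allVecs m m) (weight-φ φ w t))) (∑-cong (allVecs m m) (λ σ → ℕₚ.*-assoc ⟦ Inj? σ ⟧ _ _))))) ⟩
  ∑Inj n m (λ w → ∑[ σ ∈ allVecs m m ] (⟦ Inj? σ ⟧ * (⟦ pattern? σ w ⟧ * weight-φ φ w t)))
    ≡⟨ ∑-∑Inj (allVecs m m) (λ σ → ⟦ Inj? σ ⟧) ⟨
  ∑[ σ ∈ allVecs m m ] (⟦ Inj? σ ⟧ * ∑Inj n m (λ w → ⟦ pattern? σ w ⟧ * weight-φ φ w t))
    ≡⟨ ∑-cong (allVecs m m) (λ σ → trans (⟦⟧*-cong (Inj? σ) (λ inj → ∑Inj-pattern φ σ inj t wf m≤n k≤m))
         (sym (ℕₚ.*-assoc ⟦ Inj? σ ⟧ (weight-φ φ σ t) _))) ⟩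
  ∑[ σ ∈ allVecs m m ] (⟦ Inj? σ ⟧ * weight-φ φ σ t * ((n ∸ kφ φ) C (m ∸ kφ φ)))
    ≡⟨ ∑-*ʳ (allVecs m m) _ ⟩
  ∑[ σ ∈ allVecs m m ] (⟦ Inj? σ ⟧ * weight-φ φ σ t) * ((n ∸ kφ φ) C (m ∸ kφ φ))
    ≡⟨ cong (_* ((n ∸ kφ φ) C (m ∸ kφ φ))) (∑Inj-def (λ σ → weight-φ φ σ t)) ⟨
  ∑Inj m m (λ σ → weight-φ φ σ t) * ((n ∸ kφ φ) C (m ∸ kφ φ)) ∎
  where open ≡-Reasoning

u-∑Inj : (j ℓ : ℕ) (φ : VPattern) → u j ℓ φ ≡ ∑[ t ∈ triClass j ℓ ] ∑Inj j j (λ σ → weight-φ φ σ t)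
u-∑Inj j ℓ φ = begin
  u j ℓ φ
    ≡⟨ length-filterᵇ _ pairs ⟩
  ∑ pairs good
    ≡⟨ ∑-concatMap _ (filterᵇ (compatible φ) (Sym j)) ⟩
  ∑[ σ ∈ filterᵇ (compatible φ) (Sym j) ] ∑ (map (λ t → (σ , t)) (triClass j ℓ)) good
    ≡⟨ ∑-cong (filterᵇ (compatible φ) (Sym j)) (λ σ → ∑-map (λ t → (σ , t)) (triClass j ℓ)) ⟩
  ∑[ σ ∈ filterᵇ (compatible φ) (Sym j) ] ∑[ t ∈ triClass j ℓ ] good (σ , t)
    ≡⟨ ∑-filterᵇ (compatible φ) (Sym j) ⟩
  ∑[ σ ∈ Sym j ] (b2n (compatible φ σ) * ∑[ t ∈ triClass j ℓ ] good (σ , t))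
    ≡⟨ ∑-filterᵇ isPerm (allVecs j j) ⟩
  ∑[ σ ∈ allVecs j j ] (b2n (isPerm σ) * (b2n (compatible φ σ) * ∑[ t ∈ triClass j ℓ ] good (σ , t)))
    ≡⟨ ∑-cong (allVecs j j) (λ σ → cong₂ _*_ (cong b2n (sym (does-Inj? σ))) (sym (∑-*ˡ (triClass j ℓ) (b2n (compatible φ σ))))) ⟩
  ∑[ σ ∈ allVecs j j ] (⟦ Inj? σ ⟧ * ∑[ t ∈ triClass j ℓ ] weight-φ φ σ t)
    ≡⟨ ∑Inj-def (λ σ → ∑[ t ∈ triClass j ℓ ] weight-φ φ σ t) ⟨
  ∑Inj j j (λ σ → ∑[ t ∈ triClass j ℓ ] weight-φ φ σ t)
    ≡⟨ ∑Inj-∑ (triClass j ℓ) ⟩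
  ∑[ t ∈ triClass j ℓ ] ∑Inj j j (λ σ → weight-φ φ σ t) ∎
  where
  open ≡-Reasoning
  pairs : List (Vec (Fin j) j × Triple)
  pairs = concatMap (λ σ → map (λ t → (σ , t)) (triClass j ℓ)) (filterᵇ (compatible φ) (Sym j))
  good : Vec (Fin j) j × Triple → ℕ
  good (σ , (x , y , z)) = b2n (sameOrder (rank σ x , rank σ y , rank σ z) (φcTriple φ))

-- Permutations of given cycle type

-- The product of the two periods is a common period; one step fewer of it, applied to the equal
-- images, returns `i` and `j` themselves.
periodic⇒Inj : (π : Vec (Fin n) n) → (∀ i → ∃ λ c → iter π (suc c) i ≡ i) → Inj π
periodic⇒Inj π periodic i j eq with a , returns-i ← periodic i | b , returns-j ← periodic j = begin
  i                                 ≡⟨ iter-* π (suc b) {suc a} returns-i ⟨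
  iter π (suc b * suc a) i          ≡⟨ iter-comm π 1 (a + b * suc a) i ⟩
  iter π (a + b * suc a) (lookup π i) ≡⟨ cong (iter π (a + b * suc a)) eq ⟩
  iter π (a + b * suc a) (lookup π j) ≡⟨ iter-comm π 1 (a + b * suc a) j ⟨
  iter π (suc b * suc a) j          ≡⟨ cong (λ k → iter π k j) (ℕₚ.*-comm (suc b) (suc a)) ⟩
  iter π (suc a * suc b) j          ≡⟨ iter-* π (suc a) {suc b} returns-j ⟩
  j                                 ∎
  where open ≡-Reasoning

rotation : (c : ℕ) → Vec (Fin (suc c)) (suc c)
rotation c = tabulate (λ i → fromℕ< (DivMod.m%n<n (suc (toℕ i)) (suc c)))

lookup-rotation : ∀ c i → toℕ (lookup (rotation c) i) ≡ suc (toℕ i) % suc c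
lookup-rotation c i = trans
  (cong toℕ (Vecₚ.lookup∘tabulate (λ i → fromℕ< (DivMod.m%n<n (suc (toℕ i)) (suc c))) i))
  (Finₚ.toℕ-fromℕ< (DivMod.m%n<n (suc (toℕ i)) (suc c)))

iter-rotation : ∀ c k i → toℕ (iter (rotation c) k i) ≡ (toℕ i + k) % suc c
iter-rotation c zero i = sym (trans (cong (_% suc c) (ℕₚ.+-identityʳ (toℕ i))) (DivMod.m<n⇒m%n≡m (Finₚ.toℕ<n i)))
iter-rotation c (suc k) i = begin
  toℕ (lookup (rotation c) (iter (rotation c) k i))
    ≡⟨ lookup-rotation c (iter (rotation c) k i) ⟩
  suc (toℕ (iter (rotation c) k i)) % suc c
    ≡⟨ cong (λ x → suc x % suc c) (iter-rotation c k i) ⟩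
  (1 + (toℕ i + k) % suc c) % suc c
    ≡⟨ DivMod.%-distribˡ-+ 1 ((toℕ i + k) % suc c) (suc c) ⟩
  (1 % suc c + (toℕ i + k) % suc c % suc c) % suc c
    ≡⟨ cong (λ x → (1 % suc c + x) % suc c) (DivMod.m%n%n≡m%n (toℕ i + k) (suc c)) ⟩
  (1 % suc c + (toℕ i + k) % suc c) % suc c
    ≡⟨ DivMod.%-distribˡ-+ 1 (toℕ i + k) (suc c) ⟨
  suc (toℕ i + k) % suc c
    ≡⟨ cong (_% suc c) (ℕₚ.+-suc (toℕ i) k) ⟨
  (toℕ i + suc k) % suc c ∎
  where open ≡-Reasoning

rotation-cycleLength : ∀ c i → IsCycleLength (rotation c) i (suc c)
rotation-cycleLength c i = cycleLength (s≤s z≤n)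
  (Finₚ.toℕ-injective (trans (iter-rotation c (suc c) i)
    (trans (DivMod.[m+n]%n≡m%n (toℕ i) (suc c)) (DivMod.m<n⇒m%n≡m (Finₚ.toℕ<n i)))))
  (λ k 1≤k k<m eq → moved k 1≤k k<m (trans (sym (iter-rotation c k i)) (cong toℕ eq)))
  where
  moved : ∀ k → 1 ≤ k → k < suc c → (toℕ i + k) % suc c ≢ toℕ i
  moved k 1≤k k<m eq with (toℕ i + k) ℕₚ.<? suc c
  ... | yes lt = ℕₚ.<⇒≢ (ℕₚ.m<m+n (toℕ i) 1≤k) (sym (trans (sym (DivMod.m<n⇒m%n≡m lt)) eq))
  -- After wrapping around, equality with `i` would force `k` to be a full turn.
  ... | no ≮ = ℕₚ.<⇒≢ k<m (ℕₚ.+-cancelˡ-≡ (toℕ i) k (suc c) (begin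
      toℕ i + k                       ≡⟨ ℕₚ.m∸n+n≡m le ⟨
      (toℕ i + k ∸ suc c) + suc c     ≡⟨ cong (_+ suc c) reduced ⟩
      toℕ i + suc c                   ∎))
    where
    open ≡-Reasoning
    le : suc c ≤ toℕ i + k
    le = ℕₚ.≮⇒≥ ≮
    small : toℕ i + k ∸ suc c < suc c
    small = ℕₚ.+-cancelʳ-< (suc c) _ _ (subst (_< suc c + suc c) (sym (ℕₚ.m∸n+n≡m le)) (ℕₚ.+-mono-< (Finₚ.toℕ<n i) k<m))
    reduced : toℕ i + k ∸ suc c ≡ toℕ i
    reduced = begin
      toℕ i + k ∸ suc c                     ≡⟨ DivMod.m<n⇒m%n≡m small ⟨
      (toℕ i + k ∸ suc c) % suc c           ≡⟨ DivMod.[m+n]%n≡m%n (toℕ i + k ∸ suc c) (suc c) ⟨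
      (toℕ i + k ∸ suc c + suc c) % suc c   ≡⟨ cong (_% suc c) (ℕₚ.m∸n+n≡m le) ⟩
      (toℕ i + k) % suc c                   ≡⟨ eq ⟩
      toℕ i                                 ∎

∑-allFin-+ : ∀ a s (F : Fin (a + s) → ℕ) →
             ∑ (allFin (a + s)) F ≡ ∑[ i ∈ allFin a ] F (i ↑ˡ s) + ∑[ j ∈ allFin s ] F (a ↑ʳ j)
∑-allFin-+ zero    s F = refl
∑-allFin-+ (suc a) s F = begin
  ∑ (allFin (suc a + s)) F
    ≡⟨ ∑-allFin-suc F ⟩
  F zero + ∑[ i ∈ allFin (a + s) ] F (suc i)
    ≡⟨ cong (F zero +_) (∑-allFin-+ a s (F ∘ suc)) ⟩
  F zero + (∑[ i ∈ allFin a ] F (suc i ↑ˡ s) + ∑[ j ∈ allFin s ] F (suc a ↑ʳ j))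
    ≡⟨ ℕₚ.+-assoc (F zero) _ _ ⟨
  F zero + ∑[ i ∈ allFin a ] F (suc i ↑ˡ s) + ∑[ j ∈ allFin s ] F (suc a ↑ʳ j)
    ≡⟨ cong (_+ ∑[ j ∈ allFin s ] F (suc a ↑ʳ j)) (∑-allFin-suc {a} (λ i → F (i ↑ˡ s))) ⟨
  ∑[ i ∈ allFin (suc a) ] F (i ↑ˡ s) + ∑[ j ∈ allFin s ] F (suc a ↑ʳ j) ∎
  where open ≡-Reasoning

count-∷ : ∀ m x xs → count m (x ∷ xs) ≡ b2n (x ≡ᵇ m) + count m xs
count-∷ m x xs with x ≡ᵇ m
... | true  = refl
... | false = refl

-- Counting points by cycle length is additive under disjoint unions and independent of the order in
-- which `cycleType` lists the cycles.
LengthCounts : Vec (Fin n) n → List ℕ → Set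
LengthCounts {n} π ps = ∀ m → ∑[ i ∈ allFin n ] ⟦ cycleLen π i ℕₚ.≟ m ⟧ ≡ m * count m ps

module _ (c : ℕ) {s : ℕ} (π : Vec (Fin s) s) (π-inj : Inj π) where

  addCycle : Vec (Fin (suc c + s)) (suc c + s)
  addCycle = Vec.map (_↑ˡ s) (rotation c) Vec.++ Vec.map (suc c ↑ʳ_) π

  private
    length-left : ∀ i → IsCycleLength addCycle (i ↑ˡ s) (suc c)
    length-left i = IsCycleLength-map (_↑ˡ s) (Finₚ.↑ˡ-injective s _ _) (rotation c) addCycle
      (λ i → trans (Vecₚ.lookup-++ˡ (Vec.map (_↑ˡ s) (rotation c)) _ i) (Vecₚ.lookup-map i (_↑ˡ s) (rotation c)))
      (rotation-cycleLength c i)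

    length-right : ∀ j → IsCycleLength addCycle (suc c ↑ʳ j) (cycleLen π j)
    length-right j = IsCycleLength-map (suc c ↑ʳ_) (Finₚ.↑ʳ-injective (suc c) _ _) π addCycle
      (λ j → trans (Vecₚ.lookup-++ʳ (Vec.map (_↑ˡ s) (rotation c)) _ j) (Vecₚ.lookup-map j (suc c ↑ʳ_) π))
      (Cycles.cycleLen-spec π π-inj j)

    positive⇒periodic : ∀ {i m} → IsCycleLength addCycle i m → ∃ λ c → iter addCycle (suc c) i ≡ i
    positive⇒periodic {m = suc m} spec = m , IsCycleLength.returns spec

  -- Both blocks consist of periodic points, and a self-map all of whose points are periodic is
  -- injective.
  addCycle-Inj : Inj addCycle
  addCycle-Inj = periodic⇒Inj addCycle periodic
    where
    periodic : ∀ i → ∃ λ c → iter addCycle (suc c) i ≡ i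
    periodic i with Fin.splitAt (suc c) i in eq
    ... | inj₁ i′ = subst (λ i → ∃ λ c → iter addCycle (suc c) i ≡ i) (Finₚ.splitAt⁻¹-↑ˡ eq) (positive⇒periodic (length-left i′))
    ... | inj₂ j  = subst (λ i → ∃ λ c → iter addCycle (suc c) i ≡ i) (Finₚ.splitAt⁻¹-↑ʳ {m = suc c} eq) (positive⇒periodic (length-right j))

  addCycle-counts : ∀ {ps} → LengthCounts π ps → LengthCounts addCycle (suc c ∷ ps)
  addCycle-counts {ps} counts m = begin
    ∑[ i ∈ allFin (suc c + s) ] ⟦ cycleLen addCycle i ℕₚ.≟ m ⟧
      ≡⟨ ∑-allFin-+ (suc c) s (λ i → ⟦ cycleLen addCycle i ℕₚ.≟ m ⟧) ⟩
    ∑[ i ∈ allFin (suc c) ] ⟦ cycleLen addCycle (i ↑ˡ s) ℕₚ.≟ m ⟧ + ∑[ j ∈ allFin s ] ⟦ cycleLen addCycle (suc c ↑ʳ j) ℕₚ.≟ m ⟧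
      ≡⟨ cong₂ _+_
           (∑-cong (allFin (suc c)) (λ i → cong (λ l → ⟦ l ℕₚ.≟ m ⟧) (IsCycleLength-unique (spec (i ↑ˡ s)) (length-left i))))
           (∑-cong (allFin s) (λ j → cong (λ l → ⟦ l ℕₚ.≟ m ⟧) (IsCycleLength-unique (spec (suc c ↑ʳ j)) (length-right j)))) ⟩
    ∑[ i ∈ allFin (suc c) ] ⟦ suc c ℕₚ.≟ m ⟧ + ∑[ j ∈ allFin s ] ⟦ cycleLen π j ℕₚ.≟ m ⟧
      ≡⟨ cong₂ _+_ (trans (∑-const (allFin (suc c)) ⟦ suc c ℕₚ.≟ m ⟧) (cong (_* ⟦ suc c ℕₚ.≟ m ⟧) (Listₚ.length-tabulate {n = suc c} id))) (counts m) ⟩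
    suc c * ⟦ suc c ℕₚ.≟ m ⟧ + m * count m ps
      ≡⟨ cong (_+ m * count m ps) (trans (ℕₚ.*-comm (suc c) ⟦ suc c ℕₚ.≟ m ⟧)
           (trans (⟦⟧*-cong (suc c ℕₚ.≟ m) id) (ℕₚ.*-comm ⟦ suc c ℕₚ.≟ m ⟧ m))) ⟩
    m * ⟦ suc c ℕₚ.≟ m ⟧ + m * count m ps
      ≡⟨ ℕₚ.*-distribˡ-+ m ⟦ suc c ℕₚ.≟ m ⟧ (count m ps) ⟨
    m * (⟦ suc c ℕₚ.≟ m ⟧ + count m ps)
      ≡⟨ cong (m *_) (count-∷ m (suc c) ps) ⟨
    m * count m (suc c ∷ ps) ∎
    where
    open ≡-Reasoning
    spec = Cycles.cycleLen-spec addCycle addCycle-Inj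

withParts : (ps : List ℕ) → all (λ x → 1 ≤ᵇ x) ps ≡ true →
            ∃ λ (π : Vec (Fin (sumℕ ps)) (sumℕ ps)) → Inj π × LengthCounts π ps
withParts []           _   = [] , (λ ()) , (λ m → sym (ℕₚ.*-zeroʳ m))
withParts (suc c ∷ ps) pos with π , inj , counts ← withParts ps pos =
  addCycle c π inj , addCycle-Inj c π inj , addCycle-counts c π inj {ps} counts

count-0 : (ps : List ℕ) → all (λ x → 1 ≤ᵇ x) ps ≡ true → count 0 ps ≡ 0
count-0 []           _   = refl
count-0 (suc x ∷ ps) pos = count-0 ps pos

withSum : (ps : List ℕ) → all (λ x → 1 ≤ᵇ x) ps ≡ true → sumℕ ps ≡ n →
          ∃ λ (π : Vec (Fin n) n) → Inj π × LengthCounts π ps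
withSum ps pos refl = withParts ps pos

-- One rotation per part yields a member. An empty class would leave the mean to `inv 0`, which is 0
-- by convention.
ConjClass-nonempty : (μ : Partition n) → length (ConjClass n μ) ≢ 0
ConjClass-nonempty {n} μ with π , inj , counts ← withSum (parts μ) (positive μ) (sums μ) = λ empty →
  case subst (1 ≤_) (trans (sym (trans (length-∑ (ConjClass n μ)) (∑-ConjClass μ (λ _ → 1)))) empty) bound of λ ()
  where
  same : ∀ m → count m (cycleType π) ≡ count m (parts μ)
  same zero    = trans (Cycles.count-cycleType-0 π inj) (sym (count-0 (parts μ) (positive μ)))
  same (suc m) = ℕₚ.*-cancelˡ-≡ _ _ (suc m) (trans (sym (Cycles.lengthCount-cycleType π inj (suc m))) (counts (suc m)))
  inClass≡1 : inClass (parts μ) π ≡ 1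
  inClass≡1 = cong₂ _*_ (⟦⟧-yes (Inj? π) inj) (cong b2n (sameMultiset⁺ (cycleType π) (parts μ) same))
  bound : 1 ≤ ∑[ ρ ∈ allVecs n n ] (inClass (parts μ) ρ * 1)
  bound = subst (_≤ ∑[ ρ ∈ allVecs n n ] (inClass (parts μ) ρ * 1))
    (trans (Enum.∑-δ (VecEnum n n) π (λ ρ → inClass (parts μ) ρ * 1)) (trans (ℕₚ.*-identityʳ _) inClass≡1))
    (∑-mono (allVecs n n) (λ ρ → ℕₚ.≤-trans (ℕₚ.*-monoˡ-≤ _ (b2n≤1 (does (Enum._≟_ (VecEnum n n) ρ π)))) (ℕₚ.≤-reflexive (ℕₚ.*-identityˡ _))))

-- The coefficient u₆₁

all-elems : (E : Enum A) (p : A → Bool) → all p (Enum.elems E) ≡ true → ∀ y → p y ≡ true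
all-elems E p eq y = search (Enum.elems E) eq (λ zero → case trans (sym zero) (Enum.once E y) of λ ())
  where
  _≟_ = Enum._≟_ E
  search : ∀ xs → all p xs ≡ true → ∑[ x ∈ xs ] ⟦ x ≟ y ⟧ ≢ 0 → p y ≡ true
  search []       eq ≢0 = contradiction refl ≢0
  search (x ∷ xs) eq ≢0 with x ≟ y
  ... | yes refl = proj₁ (∧-true eq)
  ... | no _     = search xs (proj₂ (∧-true {p x} eq)) ≢0

orderOf : Vec (Fin 3) 3 → Vec (Fin n) m → ℕ
orderOf p w = b2n (sameOrder (at w 3 , at w 4 , at w 5) (toℕ (lookup p 0F) , toℕ (lookup p 1F) , toℕ (lookup p 2F)))

increasing₃ : Vec (Fin n) 3 → Bool
increasing₃ w = (at w 0 <ᵇ at w 1) ∧ (at w 1 <ᵇ at w 2)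

placedOnce : Vec (Fin 6) 3 → Vec (Fin 3) 3 → Bool
placedOnce w p = not (increasing₃ w ∧ isPerm p) ∨ (∑Rest 6 w (orderOf p) ≡ᵇ 1)

opaque
  unfolding ∑Inj ∑∉

  -- The three values outside an increasing triple of positions can be placed in the order p in exactly one way.
  remaining-checked : all (λ w → all (placedOnce w) (allVecs 3 3)) (allVecs 6 3) ≡ true
  remaining-checked = refl

  -- `CI` ignores `φc`, so computation over brackets and dashes suffices; the one excluded case
  -- imposes four conditions. Placing three positions gives binom(6 - k, 3 - k), equal to binom(6 -
  -- k, 3).
  CI-triples-checked : ∀ p p-perm l r d e → let φ = record { φc = p ; φc-perm = p-perm ; leftSq = l ; rightSq = r ; dash12 = d ; dash23 = e } in
    kφ φ ≤ 3 → ∑Inj 6 3 (λ w → K-φ φ 6 (at w 0) (at w 1) (at w 2)) ≡ (6 ∸ kφ φ) C 3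
  CI-triples-checked p p-perm true  true  true  true  _ = refl
  CI-triples-checked p p-perm true  true  true  false _ = refl
  CI-triples-checked p p-perm true  true  false true  _ = refl
  CI-triples-checked p p-perm true  true  false false (s≤s (s≤s (s≤s ())))
  CI-triples-checked p p-perm true  false true  true  _ = refl
  CI-triples-checked p p-perm true  false true  false _ = refl
  CI-triples-checked p p-perm true  false false true  _ = refl
  CI-triples-checked p p-perm true  false false false _ = refl
  CI-triples-checked p p-perm false true  true  true  _ = refl
  CI-triples-checked p p-perm false true  true  false _ = refl
  CI-triples-checked p p-perm false true  false true  _ = refl
  CI-triples-checked p p-perm false true  false false _ = refl
  CI-triples-checked p p-perm false false true  true  _ = refl
  CI-triples-checked p p-perm false false true  false _ = refl
  CI-triples-checked p p-perm false false false true  _ = refl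
  CI-triples-checked p p-perm false false false false _ = refl

∑Rest-orderOf : (w : Vec (Fin 6) 3) (p : Vec (Fin 3) 3) → increasing₃ w ≡ true → isPerm p ≡ true → ∑Rest 6 w (orderOf p) ≡ 1
∑Rest-orderOf w p inc perm = ≡ᵇ⇒≡ _ 1 (subst (λ b → not b ∨ (∑Rest 6 w (orderOf p) ≡ᵇ 1) ≡ true) (cong₂ _∧_ inc perm)
  (all-elems (VecEnum 3 3) (placedOnce w) (all-elems (VecEnum 6 3) (λ w → all (placedOnce w) (allVecs 3 3)) remaining-checked w) p))

-- `CI` involves only the ranks of i₁, i₂, i₃; the three ranks left over can be given to a₄, a₅, a₆
-- in the order `φc` in one way, so only the choice of the triple remains.
u-61 : (φ : VPattern) → kφ φ ≤ 3 → u 6 1 φ ≡ (6 ∸ kφ φ) C 3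
u-61 φ k≤3 = begin
  u 6 1 φ
    ≡⟨ trans (u-∑Inj 6 1 φ) (ℕₚ.+-identityʳ _) ⟩
  ∑Inj 6 6 (λ w → weight-φ φ w (3 , 4 , 5))
    ≡⟨ trans (∑Inj-suc _) (trans (∑Inj-suc _) (∑Inj-suc _)) ⟩
  ∑Inj 6 3 (λ w → ∑Rest 6 w (λ v → weight-φ φ v (3 , 4 , 5)))
    ≡⟨ ∑Inj-cong (λ { (a ∷ b ∷ c ∷ []) _ → step a b c }) ⟩
  ∑Inj 6 3 (λ w → K-φ φ 6 (at w 0) (at w 1) (at w 2))
    ≡⟨ CI-triples-checked (φc φ) (φc-perm φ) (leftSq φ) (rightSq φ) (dash12 φ) (dash23 φ) k≤3 ⟩
  (6 ∸ kφ φ) C 3 ∎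
  where
  open ≡-Reasoning
  step : ∀ a b c → let w = a ∷ b ∷ c ∷ [] in
         ∑Rest 6 w (λ v → weight-φ φ v (3 , 4 , 5)) ≡ K-φ φ 6 (at w 0) (at w 1) (at w 2)
  step a b c = trans
    (trans (∑∉-cong w (λ d _ → trans (∑∉-cong (w ∷ʳ d) (λ e _ → ∑∉-*ˡ (w ∷ʳ d ∷ʳ e) k)) (∑∉-*ˡ (w ∷ʳ d) k))) (∑∉-*ˡ w k))
    (counted (CI φ 6 (toℕ a) (toℕ b) (toℕ c)) refl)
    where
    w = a ∷ b ∷ c ∷ []
    k = K-φ φ 6 (toℕ a) (toℕ b) (toℕ c)
    counted : ∀ ci → CI φ 6 (toℕ a) (toℕ b) (toℕ c) ≡ ci → b2n ci * ∑Rest 6 w (orderOf (φc φ)) ≡ b2n ci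
    counted false _  = refl
    counted true  ci = let a<b , b<c = CI-increasing φ 6 (toℕ a) (toℕ b) (toℕ c) ci in
      trans (ℕₚ.*-identityˡ _) (∑Rest-orderOf w (φc φ) (cong₂ _∧_ (<ᵇ-true a<b) (<ᵇ-true b<c)) (φc-perm φ))

-- Normalization

ι : ℤ → ℚ
ι z = z ℚ./ 1

-- Identities are checked on unnormalised fractions, where no reduction to lowest terms intervenes.
toℚᵘ-/ : ∀ z d → ℚ.toℚᵘ (z ℚ./ suc d) ℚᵘ.≃ ℚᵘ.mkℚᵘ z d
toℚᵘ-/ z d = ℚₚ.toℚᵘ-fromℚᵘ (ℚᵘ.mkℚᵘ z d)

ι-+ : ∀ a b → ι (a ℤ.+ b) ≡ ι a ℚ.+ ι b
ι-+ a b = ℚₚ.toℚᵘ-injective (begin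
  ℚ.toℚᵘ (ι (a ℤ.+ b))              ≈⟨ toℚᵘ-/ (a ℤ.+ b) 0 ⟩
  ℚᵘ.mkℚᵘ (a ℤ.+ b) 0               ≈⟨ ℚᵘ.*≡* (ring a b) ⟩
  ℚᵘ.mkℚᵘ a 0 ℚᵘ.+ ℚᵘ.mkℚᵘ b 0      ≈⟨ ℚᵘₚ.+-cong (toℚᵘ-/ a 0) (toℚᵘ-/ b 0) ⟨
  ℚ.toℚᵘ (ι a) ℚᵘ.+ ℚ.toℚᵘ (ι b)    ≈⟨ ℚₚ.toℚᵘ-homo-+ (ι a) (ι b) ⟨
  ℚ.toℚᵘ (ι a ℚ.+ ι b)              ∎)
  where
  open ℚᵘₚ.≃-Reasoning
  ring : ∀ a b → (a ℤ.+ b) ℤ.* ℤ.+ 1 ≡ (a ℤ.* ℤ.+ 1 ℤ.+ b ℤ.* ℤ.+ 1) ℤ.* ℤ.+ 1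
  ring = ℤ-Solver.solve-∀

ι-* : ∀ a b → ι (a ℤ.* b) ≡ ι a ℚ.* ι b
ι-* a b = ℚₚ.toℚᵘ-injective (begin
  ℚ.toℚᵘ (ι (a ℤ.* b))              ≈⟨ toℚᵘ-/ (a ℤ.* b) 0 ⟩
  ℚᵘ.mkℚᵘ (a ℤ.* b) 0               ≈⟨ ℚᵘₚ.*-cong (toℚᵘ-/ a 0) (toℚᵘ-/ b 0) ⟨
  ℚ.toℚᵘ (ι a) ℚᵘ.* ℚ.toℚᵘ (ι b)    ≈⟨ ℚₚ.toℚᵘ-homo-* (ι a) (ι b) ⟨
  ℚ.toℚᵘ (ι a ℚ.* ι b)              ∎)
  where open ℚᵘₚ.≃-Reasoning

inv-ι : ∀ d → d ≢ 0 → inv d ℚ.* ι (ℤ.+ d) ≡ ℚ.1ℚ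
inv-ι zero    d≢0 = contradiction refl d≢0
inv-ι (suc d) _   = ℚₚ.toℚᵘ-injective (begin
  ℚ.toℚᵘ (inv (suc d) ℚ.* ι (ℤ.+ suc d))              ≈⟨ ℚₚ.toℚᵘ-homo-* (inv (suc d)) (ι (ℤ.+ suc d)) ⟩
  ℚ.toℚᵘ (inv (suc d)) ℚᵘ.* ℚ.toℚᵘ (ι (ℤ.+ suc d))    ≈⟨ ℚᵘₚ.*-cong (toℚᵘ-/ (ℤ.+ 1) d) (toℚᵘ-/ (ℤ.+ suc d) 0) ⟩
  ℚᵘ.mkℚᵘ (ℤ.+ 1) d ℚᵘ.* ℚᵘ.mkℚᵘ (ℤ.+ suc d) 0        ≈⟨ ℚᵘ.*≡* (cong ℤ.+_ (ring d)) ⟩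
  ℚᵘ.1ℚᵘ                                              ∎)
  where
  open ℚᵘₚ.≃-Reasoning
  ring : ∀ d → (suc d + 0) * 1 ≡ 1 * (suc d * 1)
  ring = ℕ-Solver.solve-∀

-- The factors `D` and `E` are inserted on the left together with their inverses, which lets the
-- integer identity be used.
divide-out : ∀ {X N D E} {z : ℤ} → N ≢ 0 → D ≢ 0 → E ≢ 0 → ℤ.+ (X * (D * E)) ≡ ℤ.+ N ℤ.* z →
             ι (ℤ.+ X) ℚ.* inv N ≡ inv D ℚ.* inv E ℚ.* ι z
divide-out {X} {N} {D} {E} {z} N≢0 D≢0 E≢0 eq = begin
  x ℚ.* ν′                                    ≡⟨ ones x ν′ ⟩
  x ℚ.* ν′ ℚ.* ℚ.1ℚ ℚ.* ℚ.1ℚ                  ≡⟨ cong₂ (λ p q → x ℚ.* ν′ ℚ.* p ℚ.* q) (sym (inv-ι D D≢0)) (sym (inv-ι E E≢0)) ⟩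
  x ℚ.* ν′ ℚ.* (d′ ℚ.* d) ℚ.* (e′ ℚ.* e)      ≡⟨ collect x ν′ d′ d e′ e ⟩
  d′ ℚ.* e′ ℚ.* (x ℚ.* (d ℚ.* e)) ℚ.* ν′      ≡⟨ cong (λ p → d′ ℚ.* e′ ℚ.* p ℚ.* ν′) product ⟩
  d′ ℚ.* e′ ℚ.* (ν ℚ.* ι z) ℚ.* ν′            ≡⟨ regroup d′ e′ ν (ι z) ν′ ⟩
  d′ ℚ.* e′ ℚ.* ι z ℚ.* (ν′ ℚ.* ν)            ≡⟨ cong (d′ ℚ.* e′ ℚ.* ι z ℚ.*_) (inv-ι N N≢0) ⟩
  d′ ℚ.* e′ ℚ.* ι z ℚ.* ℚ.1ℚ                  ≡⟨ ℚₚ.*-identityʳ _ ⟩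
  d′ ℚ.* e′ ℚ.* ι z                           ∎
  where
  open ≡-Reasoning
  x = ι (ℤ.+ X)
  ν = ι (ℤ.+ N)
  d = ι (ℤ.+ D)
  e = ι (ℤ.+ E)
  ν′ = inv N
  d′ = inv D
  e′ = inv E
  open +-*-Solver using (solve; _:*_; _:=_)
  ones : ∀ a b → a ℚ.* b ≡ a ℚ.* b ℚ.* ℚ.1ℚ ℚ.* ℚ.1ℚ
  ones a b = sym (trans (ℚₚ.*-identityʳ _) (ℚₚ.*-identityʳ _))
  collect : ∀ x ν′ d′ d e′ e → x ℚ.* ν′ ℚ.* (d′ ℚ.* d) ℚ.* (e′ ℚ.* e) ≡ d′ ℚ.* e′ ℚ.* (x ℚ.* (d ℚ.* e)) ℚ.* ν′
  collect = solve 6 (λ x ν′ d′ d e′ e → x :* ν′ :* (d′ :* d) :* (e′ :* e) := d′ :* e′ :* (x :* (d :* e)) :* ν′) refl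
  regroup : ∀ d′ e′ ν z ν′ → d′ ℚ.* e′ ℚ.* (ν ℚ.* z) ℚ.* ν′ ≡ d′ ℚ.* e′ ℚ.* z ℚ.* (ν′ ℚ.* ν)
  regroup = solve 5 (λ d′ e′ ν z ν′ → d′ :* e′ :* (ν :* z) :* ν′ := d′ :* e′ :* z :* (ν′ :* ν)) refl
  product : x ℚ.* (d ℚ.* e) ≡ ν ℚ.* ι z
  product = begin
    x ℚ.* (d ℚ.* e)               ≡⟨ cong (x ℚ.*_) (trans (cong ι (ℤₚ.pos-* D E)) (ι-* (ℤ.+ D) (ℤ.+ E))) ⟨
    x ℚ.* ι (ℤ.+ (D * E))         ≡⟨ trans (cong ι (ℤₚ.pos-* X (D * E))) (ι-* (ℤ.+ X) (ℤ.+ (D * E))) ⟨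
    ι (ℤ.+ (X * (D * E)))         ≡⟨ cong ι eq ⟩
    ι (ℤ.+ N ℤ.* z)               ≡⟨ ι-* (ℤ.+ N) z ⟩
    ν ℚ.* ι z                     ∎

∑-sumℚ : (xs : List A) (f : A → ℕ) (g : A → ℚ) (c e : ℚ) → All (λ x → ι (ℤ.+ f x) ℚ.* c ≡ e ℚ.* g x) xs →
         ι (ℤ.+ ∑ xs f) ℚ.* c ≡ e ℚ.* sumℚ (map g xs)
∑-sumℚ [] f g c e [] = trans (ℚₚ.*-zeroˡ c) (sym (ℚₚ.*-zeroʳ e))
∑-sumℚ (x ∷ xs) f g c e (eq ∷ eqs) = begin
  ι (ℤ.+ (f x + ∑ xs f)) ℚ.* c                      ≡⟨ cong (ℚ._* c) (trans (cong ι (ℤₚ.pos-+ (f x) (∑ xs f))) (ι-+ (ℤ.+ f x) (ℤ.+ ∑ xs f))) ⟩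
  (ι (ℤ.+ f x) ℚ.+ ι (ℤ.+ ∑ xs f)) ℚ.* c            ≡⟨ ℚₚ.*-distribʳ-+ c (ι (ℤ.+ f x)) (ι (ℤ.+ ∑ xs f)) ⟩
  ι (ℤ.+ f x) ℚ.* c ℚ.+ ι (ℤ.+ ∑ xs f) ℚ.* c        ≡⟨ cong₂ ℚ._+_ eq (∑-sumℚ xs f g c e eqs) ⟩
  e ℚ.* g x ℚ.+ e ℚ.* sumℚ (map g xs)               ≡⟨ ℚₚ.*-distribˡ-+ e (g x) (sumℚ (map g xs)) ⟨
  e ℚ.* (g x ℚ.+ sumℚ (map g xs))                   ∎
  where open ≡-Reasoning

sumℚ-ι : (xs : List A) (f : A → ℕ) (h : ℤ) → sumℚ (map (λ x → ι (ℤ.+ f x ℤ.* h)) xs) ≡ ι (ℤ.+ ∑ xs f ℤ.* h)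
sumℚ-ι []       f h = refl
sumℚ-ι (x ∷ xs) f h = begin
  ι (ℤ.+ f x ℤ.* h) ℚ.+ sumℚ (map (λ x → ι (ℤ.+ f x ℤ.* h)) xs) ≡⟨ cong (ι (ℤ.+ f x ℤ.* h) ℚ.+_) (sumℚ-ι xs f h) ⟩
  ι (ℤ.+ f x ℤ.* h) ℚ.+ ι (ℤ.+ ∑ xs f ℤ.* h)                    ≡⟨ ι-+ (ℤ.+ f x ℤ.* h) (ℤ.+ ∑ xs f ℤ.* h) ⟨
  ι (ℤ.+ f x ℤ.* h ℤ.+ ℤ.+ ∑ xs f ℤ.* h)                        ≡⟨ cong ι (ℤₚ.*-distribʳ-+ h (ℤ.+ f x) (ℤ.+ ∑ xs f)) ⟨
  ι ((ℤ.+ f x ℤ.+ ℤ.+ ∑ xs f) ℤ.* h)                            ≡⟨ cong (λ k → ι (k ℤ.* h)) (ℤₚ.pos-+ (f x) (∑ xs f)) ⟨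
  ι (ℤ.+ (f x + ∑ xs f) ℤ.* h)                                  ∎
  where open ≡-Reasoning

P-+ : ∀ n k m → n P (k + m) ≡ (n P k) * ((n ∸ k) P m)
P-+ n k zero    = trans (cong (n P_) (ℕₚ.+-identityʳ k)) (sym (ℕₚ.*-identityʳ (n P k)))
P-+ n k (suc m) = begin
  n P (k + suc m)                             ≡⟨ cong (n P_) (ℕₚ.+-suc k m) ⟩
  n P suc (k + m)                             ≡⟨ P-suc n (k + m) ⟩
  (n P (k + m)) * (n ∸ (k + m))               ≡⟨ cong₂ _*_ (P-+ n k m) (sym (ℕₚ.∸-+-assoc n k m)) ⟩
  (n P k) * ((n ∸ k) P m) * (n ∸ k ∸ m)       ≡⟨ ℕₚ.*-assoc (n P k) _ _ ⟩
  (n P k) * (((n ∸ k) P m) * (n ∸ k ∸ m))     ≡⟨ cong ((n P k) *_) (P-suc (n ∸ k) m) ⟨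
  (n P k) * ((n ∸ k) P suc m)                 ∎
  where open ≡-Reasoning

C*!≡P : ∀ {n k} → k ≤ n → (n C k) * k ! ≡ n P k
C*!≡P {n} {k} k≤n = ℕₚ.*-cancelʳ-≡ _ _ ((n ∸ k) !) {{(n ∸ k) ℕₚ.!≢0}} (trans C-side (sym P-side))
  where
  open ≡-Reasoning
  C-side : (n C k) * k ! * (n ∸ k) ! ≡ n !
  C-side = begin
    (n C k) * k ! * (n ∸ k) !                              ≡⟨ ℕₚ.*-assoc (n C k) _ _ ⟩
    (n C k) * (k ! * (n ∸ k) !)                            ≡⟨ cong (_* (k ! * (n ∸ k) !)) (Comb.nCk≡n!/k![n-k]! k≤n) ⟩
    ((n ! / (k ! * (n ∸ k) !)) {{k!m!}}) * (k ! * (n ∸ k) !) ≡⟨ DivMod.m/n*n≡m {{k!m!}} (subst (_∣ n !) (ℕₚ.*-comm ((n ∸ k) !) (k !)) (Comb.[n∸k]!k!∣n! k≤n)) ⟩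
    n !                                                    ∎
    where k!m! = ℕₚ.m*n≢0 (k !) ((n ∸ k) !) {{k ℕₚ.!≢0}} {{(n ∸ k) ℕₚ.!≢0}}
  P-side : (n P k) * (n ∸ k) ! ≡ n !
  P-side = begin
    (n P k) * (n ∸ k) !              ≡⟨ cong ((n P k) *_) (Comb.nPn≡n! (n ∸ k)) ⟨
    (n P k) * ((n ∸ k) P (n ∸ k))    ≡⟨ P-+ n k (n ∸ k) ⟨
    n P (k + (n ∸ k))                ≡⟨ cong (n P_) (ℕₚ.m+[n∸m]≡n k≤n) ⟩
    n P n                            ≡⟨ Comb.nPn≡n! n ⟩
    n !                              ∎

P≢0 : ∀ {n k} → k ≤ n → n P k ≢ 0
P≢0 {n} {k} k≤n eq = ℕ.≢-nonZero⁻¹ (n !) {{n ℕₚ.!≢0}} (begin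
  n !                              ≡⟨ Comb.nPn≡n! n ⟨
  n P n                            ≡⟨ cong (n P_) (ℕₚ.m+[n∸m]≡n k≤n) ⟨
  n P (k + (n ∸ k))                ≡⟨ P-+ n k (n ∸ k) ⟩
  (n P k) * ((n ∸ k) P (n ∸ k))    ≡⟨ cong (_* ((n ∸ k) P (n ∸ k))) eq ⟩
  0                                ∎)
  where open ≡-Reasoning

module _ (n : ℕ) (3≤n : 3 ≤ n) (φ : VPattern) (k≤3 : kφ φ ≤ 3) (μ : Partition n) where

  private
    k = kφ φ
    N = length (ConjClass n μ)
    Hⱼ : ℕ → ℕ → ℤ
    Hⱼ j ℓ = H j ℓ (ℤ.+ n) (ℤ.+ pp μ) (ℤ.+ qq μ) (ℤ.+ rr μ)
    matches : {m : ℕ} → Triple → Vec (Fin n) m → ℕ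
    matches t w = classMatches n (parts μ) w t
    contribution orders : (j : ℕ) → Triple → ℕ
    contribution j t = ∑Inj n j (λ w → matches t w * weight-φ φ w t)
    orders j t = ∑Inj j j (λ σ → weight-φ φ σ t)

  -- With denominators cleared the equation also covers `j > n`, where both sides vanish for lack of
  -- injective `j`-tuples. For `j ≤ n` the nonzero factor binom(n - k, j - k) is cancelled.
  product-formula : ∀ j t → WellFormed j t → contribution j t * ((n P k) * (j ∸ k) !) ≡ ∑Inj n j (matches t) * orders j t
  product-formula j t wf with j ℕₚ.≤? n
  ... | no j≰n = trans (cong (_* ((n P k) * (j ∸ k) !)) (none _)) (sym (cong (_* orders j t) (none (matches t))))
    where
    pigeonhole : (w : Vec (Fin n) j) → ¬ Inj w
    pigeonhole w inj = j≰n (Finₚ.injective⇒≤ {f = lookup w} (inj _ _))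
    none : (F : Vec (Fin n) j → ℕ) → ∑Inj n j F ≡ 0
    none F = trans (∑Inj-cong {G = λ _ → 0 * 0} (λ w inj → contradiction inj (pigeonhole w)))
      (trans (∑Inj-*ʳ 0 {λ _ → 0}) (ℕₚ.*-zeroʳ (∑Inj n j (λ _ → 0))))
  ... | yes j≤n = ℕₚ.*-cancelˡ-≡ _ _ ((n ∸ k) C (j ∸ k)) {{ℕ.≢-nonZero C≢0}} (begin
      binomial * (X * ((n P k) * (j ∸ k) !))
        ≡⟨ shuffle binomial X (n P k) ((j ∸ k) !) ⟩
      (n P k) * (binomial * (j ∸ k) !) * X
        ≡⟨ cong (_* X) falling ⟩
      (n P j) * X
        ≡⟨ ∑Inj-constant-* (matches t) (λ w → weight-φ φ w t) (classMatches-constant (parts μ) t wf) ⟩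
      ∑Inj n j (matches t) * ∑Inj n j (λ w → weight-φ φ w t)
        ≡⟨ cong (∑Inj n j (matches t) *_) (∑Inj-weight φ t wf j≤n k≤j) ⟩
      ∑Inj n j (matches t) * (orders j t * binomial)
        ≡⟨ rotate (∑Inj n j (matches t)) (orders j t) binomial ⟩
      binomial * (∑Inj n j (matches t) * orders j t) ∎)
    where
    open ≡-Reasoning
    X = contribution j t
    binomial = (n ∸ k) C (j ∸ k)
    k≤j : k ≤ j
    k≤j = ℕₚ.≤-trans k≤3 (proj₁ wf)
    shuffle : ∀ b x p f → b * (x * (p * f)) ≡ p * (b * f) * x
    shuffle = ℕ-Solver.solve-∀
    rotate : ∀ a o b → a * (o * b) ≡ b * (a * o)
    rotate = ℕ-Solver.solve-∀
    C*! : binomial * (j ∸ k) ! ≡ (n ∸ k) P (j ∸ k)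
    C*! = C*!≡P (ℕₚ.∸-monoˡ-≤ k j≤n)
    C≢0 : binomial ≢ 0
    C≢0 eq = P≢0 (ℕₚ.∸-monoˡ-≤ k j≤n) (trans (sym C*!) (cong (_* (j ∸ k) !) eq))
    -- (n)_k (n - k)_(j - k) is (n)_j, since k ≤ 3 ≤ j.
    falling : (n P k) * (binomial * (j ∸ k) !) ≡ n P j
    falling = trans (cong ((n P k) *_) C*!) (trans (sym (P-+ n k (j ∸ k))) (cong (n P_) (ℕₚ.m+[n∸m]≡n k≤j)))

  normalized : AllClass (λ j ℓ t → ι (ℤ.+ contribution j t) ℚ.* inv N ≡ inv (n P k) ℚ.* inv ((j ∸ k) !) ℚ.* ι (ℤ.+ orders j t ℤ.* Hⱼ j ℓ))
  normalized = zipClass step wellFormed (∑Inj-classMatches μ)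
    where
    step : ∀ {j ℓ t} → WellFormed j t → ℤ.+ ∑Inj n j (matches t) ≡ ℤ.+ N ℤ.* Hⱼ j ℓ →
           ι (ℤ.+ contribution j t) ℚ.* inv N ≡ inv (n P k) ℚ.* inv ((j ∸ k) !) ℚ.* ι (ℤ.+ orders j t ℤ.* Hⱼ j ℓ)
    step {j} {ℓ} {t} wf total = divide-out {contribution j t} (ConjClass-nonempty μ) (P≢0 (ℕₚ.≤-trans k≤3 3≤n))
      (ℕ.≢-nonZero⁻¹ ((j ∸ k) !) {{(j ∸ k) ℕₚ.!≢0}}) (begin
      ℤ.+ (contribution j t * ((n P k) * (j ∸ k) !))    ≡⟨ cong toℤ (product-formula j t wf) ⟩
      ℤ.+ (∑Inj n j (matches t) * orders j t)           ≡⟨ ℤₚ.pos-* (∑Inj n j (matches t)) (orders j t) ⟩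
      ℤ.+ ∑Inj n j (matches t) ℤ.* ℤ.+ orders j t       ≡⟨ cong (ℤ._* ℤ.+ orders j t) total ⟩
      ℤ.+ N ℤ.* Hⱼ j ℓ ℤ.* ℤ.+ orders j t               ≡⟨ ring (ℤ.+ N) (Hⱼ j ℓ) (ℤ.+ orders j t) ⟩
      ℤ.+ N ℤ.* (ℤ.+ orders j t ℤ.* Hⱼ j ℓ)             ∎)
      where
      open ≡-Reasoning
      ring : ∀ n h o → n ℤ.* h ℤ.* o ≡ n ℤ.* (o ℤ.* h)
      ring = ℤ-Solver.solve-∀

  mean-formula : meanPat n φ μ ≡ formulaRHS n φ μ
  mean-formula = begin
    ι (ℤ.+ ∑ (ConjClass n μ) (pat φ)) ℚ.* inv N
      ≡⟨ cong (λ s → ι (ℤ.+ s) ℚ.* inv N) (trans (∑-ConjClass μ (pat φ)) (trans (∑-pat φ (parts μ)) (∑class-def _))) ⟩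
    ι (ℤ.+ ∑[ j ∈ sizes ] ∑[ ℓ ∈ labels j ] ∑[ t ∈ triClass j ℓ ] contribution j t) ℚ.* inv N
      ≡⟨ ∑-sumℚ sizes (λ j → ∑ (labels j) (classTotal j)) (λ j → inv ((j ∸ k) !) ℚ.* sumℚ (map (summand j) (labels j))) (inv N) (inv (n P k))
           (All.map (λ {j} eqs → trans
             (∑-sumℚ (labels j) (classTotal j) (summand j) (inv N) (inv (n P k) ℚ.* inv ((j ∸ k) !)) (All.map (λ {ℓ} → class-sum j ℓ) eqs))
             (ℚₚ.*-assoc (inv (n P k)) (inv ((j ∸ k) !)) (sumℚ (map (summand j) (labels j))))) normalized) ⟩
    formulaRHS n φ μ ∎
    where
    open ≡-Reasoning
    classTotal : ℕ → ℕ → ℕ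
    classTotal j ℓ = ∑ (triClass j ℓ) (contribution j)
    summand : ℕ → ℕ → ℚ
    summand j ℓ = ι (ℤ.+ u j ℓ φ ℤ.* Hⱼ j ℓ)
    class-sum : ∀ j ℓ → All (λ t → ι (ℤ.+ contribution j t) ℚ.* inv N ≡ inv (n P k) ℚ.* inv ((j ∸ k) !) ℚ.* ι (ℤ.+ orders j t ℤ.* Hⱼ j ℓ)) (triClass j ℓ) →
      ι (ℤ.+ classTotal j ℓ) ℚ.* inv N ≡ inv (n P k) ℚ.* inv ((j ∸ k) !) ℚ.* summand j ℓ
    class-sum j ℓ eqs = trans (∑-sumℚ (triClass j ℓ) (contribution j) (λ t → ι (ℤ.+ orders j t ℤ.* Hⱼ j ℓ)) (inv N) (inv (n P k) ℚ.* inv ((j ∸ k) !)) eqs) (cong (inv (n P k) ℚ.* inv ((j ∸ k) !) ℚ.*_)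
      (trans (sumℚ-ι (triClass j ℓ) (orders j) (Hⱼ j ℓ)) (cong (λ x → ι (ℤ.+ x ℤ.* Hⱼ j ℓ)) (sym (u-∑Inj j ℓ φ)))))

theorem4p3 : (n : ℕ) → 3 ≤ n → (φ : VPattern) → kφ φ ≤ 3 → (μ : Partition n) →
    (meanPat n φ μ ≡ formulaRHS n φ μ) × (u 6 1 φ ≡ (6 ∸ kφ φ) C 3)
theorem4p3 n 3≤n φ k≤3 μ = mean-formula n 3≤n φ k≤3 μ , u-61 φ k≤3
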